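{- The integer group determinants of $GA(1,27)$ are exactly the integers of the form $$D=AB^{26},\qquad A,B\in\mathbb Z,$$ where $B\equiv A\pmod{27}$ and $A$ satisfies: if $2\mid A$ then $4\mid A$, and if $13\mid A$ then $13^2\mid A$.
   Context: For a finite group $G=\{g_1,\dots,g_n\}$ and an element $\sum_{g\in G}a_g g$ of the group ring $\mathbb Z[G]$ (all $a_g\in\mathbb Z$), the group determinant is $D\left(\sum_{g\in G}a_g g\right)=\det\left(a_{g_ig_j^{ -1}}\right)_{i,j=1}^n$. An integer group determinant of $G$ is any integer of this form. The general affine group of degree one over $\mathbb F_{27}$ is $GA(1,27)=\left\{\begin{pmatrix} a & b\\ 0 & 1\end{pmatrix}: a\in\mathbb F_{27}^*,\ b\in\mathbb F_{27}\right\}$ under matrix multiplication (a group of order $702$). -}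

module Defs where

open import Algebra.Bundles using (CommutativeRing)
open import Algebra.Structures using (IsGroup; IsCommutativeRing)
import Algebra.Solver.Ring.NaturalCoefficients.Default as NatCoeffSolver
open import Data.Fin.Base using (Fin; zero; suc; toℕ; punchIn; punchOut)
open import Data.Fin.Properties using (_≟_; all?; any?; *↔×; punchOut-punchIn; punchIn-punchOut; punchInᵢ≢i)
open import Data.Integer.Base as ℤ using (ℤ; -1ℤ; 0ℤ; 1ℤ)
open import Data.Nat.Base as ℕ using (ℕ)
open import Data.Nat.DivMod using (_mod_)
open import Data.Product.Base using (_×_; _,_; proj₁; proj₂; ∃-syntax)
open import Data.Product.Properties using (≡-dec)
open import Data.Product.Function.NonDependent.Propositional using (_×-↔_)
open import Function.Base using (_∘_)
open import Function.Bundles using (_↔_; Inverse; mk↔ₛ′)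
open import Function.Construct.Composition using (_↔-∘_)
open import Function.Construct.Identity using (↔-id)
open import Level using (0ℓ)
open import Relation.Binary.PropositionalEquality
open import Relation.Nullary.Decidable using (Dec; ¬?; from-yes; _→-dec_)

------------------------------------------------------------------------
-- Determinants of integer matrices

Matrix : ℕ → Set
Matrix n = Fin n → Fin n → ℤ

sum : ∀ {n} → (Fin n → ℤ) → ℤ
sum {ℕ.zero}  f = 0ℤ
sum {ℕ.suc n} f = f zero ℤ.+ sum (f ∘ suc)

-- Laplace expansion along the first row.
det : ∀ {n} → Matrix n → ℤ
det {ℕ.zero}  M = 1ℤ
det {ℕ.suc n} M =
  sum λ j → (-1ℤ ℤ.^ toℕ j) ℤ.* M zero j ℤ.* det (λ i k → M (suc i) (punchIn j k))

------------------------------------------------------------------------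
-- Integer group determinants

record FiniteGroup (n : ℕ) : Set₁ where
  infixl 7 _∙_
  infix  8 _⁻¹
  field
    Carrier     : Set
    _∙_         : Carrier → Carrier → Carrier
    ε           : Carrier
    _⁻¹         : Carrier → Carrier
    isGroup     : IsGroup _≡_ _∙_ ε _⁻¹
    enumeration : Fin n ↔ Carrier

  element : Fin n → Carrier
  element = Inverse.to enumeration

-- The function a : G → ℤ stands for the group ring element Σ a(g) g. The
-- value does not depend on the enumeration of G, since changing it permutes
-- the rows and the columns simultaneously.
groupDeterminant : ∀ {n} (G : FiniteGroup n) → (FiniteGroup.Carrier G → ℤ) → ℤ
groupDeterminant G a = det λ i j → a (element i ∙ element j ⁻¹)
  where open FiniteGroup G

IsIntegerGroupDeterminant : ∀ {n} → FiniteGroup n → ℤ → Set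
IsIntegerGroupDeterminant G D = ∃[ a ] D ≡ groupDeterminant G a

------------------------------------------------------------------------
-- Finite fields

record FiniteField (q : ℕ) : Set₁ where
  infixl 6 _+_
  infixl 7 _*_
  infix  8 -_
  field
    Carrier           : Set
    _+_ _*_           : Carrier → Carrier → Carrier
    -_                : Carrier → Carrier
    0# 1#             : Carrier
    isCommutativeRing : IsCommutativeRing _≡_ _+_ _*_ -_ 0# 1#
    1#≢0#             : 1# ≢ 0#
    inverse           : ∀ x → x ≢ 0# → ∃[ y ] x * y ≡ 1#
    enumeration       : Fin q ↔ Carrier

  open IsCommutativeRing isCommutativeRing public
    hiding (refl; sym; trans; reflexive; isEquivalence; zero)

------------------------------------------------------------------------
-- The general affine group of degree one over a finite field

module GeneralAffine {m : ℕ} (F : FiniteField (ℕ.suc m)) where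
  open FiniteField F renaming (Carrier to K)

  -- The matrix with rows (a , b) and (0 , 1).
  record Affine : Set where
    constructor affine
    field
      a   : K
      b   : K
      a≢0 : a ≢ 0#

  open Affine

  toMatrix : Affine → Fin 2 → Fin 2 → K
  toMatrix g zero       zero       = a g
  toMatrix g zero       (suc zero) = b g
  toMatrix g (suc zero) zero       = 0#
  toMatrix g (suc zero) (suc zero) = 1#

  -- Proofs of x ≢ 0# are definitionally equal, as ⊥ is.
  affine-≡ : ∀ {g h} → a g ≡ a h → b g ≡ b h → g ≡ h
  affine-≡ refl refl = refl

  private
    recip : ∀ x → x ≢ 0# → K
    recip x x≢0 = proj₁ (inverse x x≢0)

    *-recip : ∀ x (x≢0 : x ≢ 0#) → x * recip x x≢0 ≡ 1#
    *-recip x x≢0 = proj₂ (inverse x x≢0)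

    recip-* : ∀ x (x≢0 : x ≢ 0#) → recip x x≢0 * x ≡ 1#
    recip-* x x≢0 = trans (*-comm _ _) (*-recip x x≢0)

    *-nonzero : ∀ {x y} → x ≢ 0# → y ≢ 0# → x * y ≢ 0#
    *-nonzero {x} {y} x≢0 y≢0 xy≡0 = y≢0 (begin
      y                        ≡⟨ *-identityˡ y ⟨
      1# * y                   ≡⟨ cong (_* y) (recip-* x x≢0) ⟨
      recip x x≢0 * x * y      ≡⟨ *-assoc _ _ _ ⟩
      recip x x≢0 * (x * y)    ≡⟨ cong (recip x x≢0 *_) xy≡0 ⟩
      recip x x≢0 * 0#         ≡⟨ zeroʳ _ ⟩
      0#                       ∎)
      where open ≡-Reasoning

    recip-nonzero : ∀ {x} (x≢0 : x ≢ 0#) → recip x x≢0 ≢ 0#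
    recip-nonzero {x} x≢0 r≡0 =
      1#≢0# (trans (sym (*-recip x x≢0)) (trans (cong (x *_) r≡0) (zeroʳ x)))

  infixl 7 _∙_
  _∙_ : Affine → Affine → Affine
  g ∙ h = affine (a g * a h) (a g * b h + b g) (*-nonzero (a≢0 g) (a≢0 h))

  toMatrix-∙ : ∀ g h i k → toMatrix (g ∙ h) i k ≡
    toMatrix g i zero * toMatrix h zero k + toMatrix g i (suc zero) * toMatrix h (suc zero) k
  toMatrix-∙ g h zero zero =
    sym (trans (cong (_ +_) (zeroʳ _)) (+-identityʳ _))
  toMatrix-∙ g h zero (suc zero) =
    cong (_ +_) (sym (*-identityʳ _))
  toMatrix-∙ g h (suc zero) zero =
    sym (trans (cong₂ _+_ (zeroˡ _) (zeroʳ _)) (+-identityˡ _))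
  toMatrix-∙ g h (suc zero) (suc zero) =
    sym (trans (cong₂ _+_ (zeroˡ _) (*-identityˡ _)) (+-identityˡ _))

  ε : Affine
  ε = affine 1# 0# 1#≢0#

  inv : Affine → Affine
  inv g = affine r (- (r * b g)) (recip-nonzero (a≢0 g))
    where
    r : K
    r = recip (a g) (a≢0 g)

  private
    ∙-assoc : ∀ g h k → (g ∙ h) ∙ k ≡ g ∙ (h ∙ k)
    ∙-assoc g h k = affine-≡ (*-assoc _ _ _) (begin
      a g * a h * b k + (a g * b h + b g)    ≡⟨ +-assoc _ _ _ ⟨
      a g * a h * b k + a g * b h + b g      ≡⟨ cong (λ z → z + a g * b h + b g) (*-assoc _ _ _) ⟩
      a g * (a h * b k) + a g * b h + b g    ≡⟨ cong (_+ b g) (distribˡ _ _ _) ⟨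
      a g * (a h * b k + b h) + b g          ∎)
      where open ≡-Reasoning

    ∙-identityˡ : ∀ g → ε ∙ g ≡ g
    ∙-identityˡ g = affine-≡ (*-identityˡ _)
      (trans (+-identityʳ _) (*-identityˡ _))

    ∙-identityʳ : ∀ g → g ∙ ε ≡ g
    ∙-identityʳ g = affine-≡ (*-identityʳ _)
      (trans (cong (_+ b g) (zeroʳ _)) (+-identityˡ _))

    inv-inverseˡ : ∀ g → inv g ∙ g ≡ ε
    inv-inverseˡ g = affine-≡ (recip-* _ (a≢0 g)) (-‿inverseʳ _)

    inv-inverseʳ : ∀ g → g ∙ inv g ≡ ε
    inv-inverseʳ g = begin
      g ∙ inv g                             ≡⟨ ∙-identityˡ (g ∙ inv g) ⟨
      ε ∙ (g ∙ inv g)                       ≡⟨ cong (_∙ (g ∙ inv g)) (inv-inverseˡ (inv g)) ⟨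
      inv (inv g) ∙ inv g ∙ (g ∙ inv g)     ≡⟨ ∙-assoc (inv (inv g)) (inv g) (g ∙ inv g) ⟩
      inv (inv g) ∙ (inv g ∙ (g ∙ inv g))   ≡⟨ cong (inv (inv g) ∙_) (∙-assoc (inv g) g (inv g)) ⟨
      inv (inv g) ∙ (inv g ∙ g ∙ inv g)     ≡⟨ cong (λ z → inv (inv g) ∙ (z ∙ inv g)) (inv-inverseˡ g) ⟩
      inv (inv g) ∙ (ε ∙ inv g)             ≡⟨ cong (inv (inv g) ∙_) (∙-identityˡ (inv g)) ⟩
      inv (inv g) ∙ inv g                   ≡⟨ inv-inverseˡ (inv g) ⟩
      ε                                     ∎
      where open ≡-Reasoning

  Affine-isGroup : IsGroup _≡_ _∙_ ε inv
  Affine-isGroup = record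
    { isMonoid = record
      { isSemigroup = record
        { isMagma = record { isEquivalence = isEquivalence ; ∙-cong = cong₂ _∙_ }
        ; assoc   = ∙-assoc
        }
      ; identity = ∙-identityˡ , ∙-identityʳ
      }
    ; inverse = inv-inverseˡ , inv-inverseʳ
    ; ⁻¹-cong = cong inv
    }

  private
    enum : Fin (ℕ.suc m) → K
    enum = Inverse.to enumeration

    index : K → Fin (ℕ.suc m)
    index = Inverse.from enumeration

    enum-index : ∀ x → enum (index x) ≡ x
    enum-index = Inverse.strictlyInverseˡ enumeration

    index-enum : ∀ i → index (enum i) ≡ i
    index-enum = Inverse.strictlyInverseʳ enumeration

    index≢ : ∀ {x} → x ≢ 0# → index 0# ≢ index x
    index≢ x≢0 eq = x≢0 (trans (sym (enum-index _)) (trans (cong enum (sym eq)) (enum-index 0#)))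

    enum≢ : ∀ i → enum (punchIn (index 0#) i) ≢ 0#
    enum≢ i eq = punchInᵢ≢i (index 0#) i (trans (sym (index-enum _)) (cong index eq))

    to : Fin m × Fin (ℕ.suc m) → Affine
    to (i , j) = affine (enum (punchIn (index 0#) i)) (enum j) (enum≢ i)

    from : Affine → Fin m × Fin (ℕ.suc m)
    from g = punchOut (index≢ (a≢0 g)) , index (b g)

    to-from : ∀ g → to (from g) ≡ g
    to-from g = affine-≡
      (trans (cong enum (punchIn-punchOut (index≢ (a≢0 g)))) (enum-index (a g)))
      (enum-index (b g))

    punchOut-≡ : ∀ {i k : Fin (ℕ.suc m)} {j} (i≢k : i ≢ k) → k ≡ punchIn i j → punchOut i≢k ≡ j
    punchOut-≡ {i} _ refl = punchOut-punchIn i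

    from-to : ∀ p → from (to p) ≡ p
    from-to (i , j) = cong₂ _,_ (punchOut-≡ (index≢ (enum≢ i)) (index-enum _)) (index-enum j)

  -- Enumerates the nonzero a by skipping 0# in the enumeration of F.
  Affine-enumeration : Fin (m ℕ.* ℕ.suc m) ↔ Affine
  Affine-enumeration = mk↔ₛ′ to from to-from from-to ↔-∘ *↔×

GA₁ : ∀ {m} → FiniteField (ℕ.suc m) → FiniteGroup (m ℕ.* ℕ.suc m)
GA₁ F = record
  { Carrier     = Affine
  ; _∙_         = _∙_
  ; ε           = ε
  ; _⁻¹         = inv
  ; isGroup     = Affine-isGroup
  ; enumeration = Affine-enumeration
  }
  where open GeneralAffine F

------------------------------------------------------------------------
-- The field with 3 elements, as the integers modulo 3

module 𝔽₃ where
  infixl 6 _+_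
  infixl 7 _*_
  infix  8 -_

  _+_ _*_ : Fin 3 → Fin 3 → Fin 3
  i + j = (toℕ i ℕ.+ toℕ j) mod 3
  i * j = (toℕ i ℕ.* toℕ j) mod 3

  -_ : Fin 3 → Fin 3
  - i = (3 ℕ.∸ toℕ i) mod 3

  0# 1# : Fin 3
  0# = zero
  1# = suc zero

  isCommutativeRing : IsCommutativeRing _≡_ _+_ _*_ -_ 0# 1#
  isCommutativeRing = record
    { isRing = record
      { +-isAbelianGroup = record
        { isGroup = record
          { isMonoid = record
            { isSemigroup = record
              { isMagma = record { isEquivalence = isEquivalence ; ∙-cong = cong₂ _+_ }
              ; assoc   = from-yes (all? λ x → all? λ y → all? λ z → ((x + y) + z) ≟ (x + (y + z)))
              }
            ; identity = from-yes (all? λ x → (0# + x) ≟ x) , from-yes (all? λ x → (x + 0#) ≟ x)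
            }
          ; inverse = from-yes (all? λ x → (- x + x) ≟ 0#) , from-yes (all? λ x → (x + - x) ≟ 0#)
          ; ⁻¹-cong = cong -_
          }
        ; comm = from-yes (all? λ x → all? λ y → (x + y) ≟ (y + x))
        }
      ; *-cong     = cong₂ _*_
      ; *-assoc    = from-yes (all? λ x → all? λ y → all? λ z → ((x * y) * z) ≟ (x * (y * z)))
      ; *-identity = from-yes (all? λ x → (1# * x) ≟ x) , from-yes (all? λ x → (x * 1#) ≟ x)
      ; distrib    = from-yes (all? λ x → all? λ y → all? λ z → (x * (y + z)) ≟ (x * y + x * z))
                   , from-yes (all? λ x → all? λ y → all? λ z → ((y + z) * x) ≟ (y * x + z * x))
      }
    ; *-comm = from-yes (all? λ x → all? λ y → (x * y) ≟ (y * x))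
    }

------------------------------------------------------------------------
-- The field with 27 elements, as 𝔽₃[x] / (x³ - x - 2)

-- The triple (a₀ , a₁ , a₂) stands for a₀ + a₁ x + a₂ x².
Triple : Set → Set
Triple A = A × A × A

addTriple : ∀ {A : Set} → (A → A → A) → Triple A → Triple A → Triple A
addTriple _+_ (a₀ , a₁ , a₂) (b₀ , b₁ , b₂) = a₀ + b₀ , a₁ + b₁ , a₂ + b₂

-- Uses x³ = x + 2 and x⁴ = x² + 2x to reduce the coefficients p₃ and p₄ of
-- the product.
mulTriple : ∀ {A : Set} → (A → A → A) → (A → A → A) → Triple A → Triple A → Triple A
mulTriple {A} _+_ _*_ (a₀ , a₁ , a₂) (b₀ , b₁ , b₂) =
  p₀ + (p₃ + p₃) , (p₁ + p₃) + (p₄ + p₄) , p₂ + p₄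
  where
  p₀ p₁ p₂ p₃ p₄ : A
  p₀ = a₀ * b₀
  p₁ = (a₀ * b₁) + (a₁ * b₀)
  p₂ = ((a₀ * b₂) + (a₁ * b₁)) + (a₂ * b₀)
  p₃ = (a₁ * b₂) + (a₂ * b₁)
  p₄ = a₂ * b₂

-- Ring laws of R[x] / (x³ - x - 2) for every commutative ring R.
module TripleLaws
  {A : Set} {add mul : A → A → A} {neg : A → A} {0# 1# : A}
  (isCR : IsCommutativeRing _≡_ add mul neg 0# 1#)
  where

  private
    R : CommutativeRing 0ℓ 0ℓ
    R = record { isCommutativeRing = isCR }

    open NatCoeffSolver (CommutativeRing.commutativeSemiring R)
      using (Polynomial; solve; _:=_; _:+_; _:*_; con)

    T : Set
    T = Triple A

    _⊕_ _⊗_ : T → T → T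
    _⊕_ = addTriple add
    _⊗_ = mulTriple add mul

    _:⊕_ _:⊗_ : ∀ {n} → Triple (Polynomial n) → Triple (Polynomial n) → Triple (Polynomial n)
    _:⊕_ = addTriple _:+_
    _:⊗_ = mulTriple _:+_ _:*_

    :1 : ∀ {n} → Triple (Polynomial n)
    :1 = con 1 , con 0 , con 0

    triple-≡ : ∀ {a₀ a₁ a₂ b₀ b₁ b₂ : A} → a₀ ≡ b₀ → a₁ ≡ b₁ → a₂ ≡ b₂ →
               (a₀ , a₁ , a₂) ≡ (b₀ , b₁ , b₂)
    triple-≡ refl refl refl = refl

  open IsCommutativeRing isCR
    hiding (refl; sym; trans; reflexive; isEquivalence; zero)

  ⊗-comm : ∀ s t → s ⊗ t ≡ t ⊗ s
  ⊗-comm (a , b , c) (d , e , f) = triple-≡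
    (solve 6 (λ a b c d e f → proj₁ ((a , b , c) :⊗ (d , e , f)) := proj₁ ((d , e , f) :⊗ (a , b , c))) refl a b c d e f)
    (solve 6 (λ a b c d e f → proj₁ (proj₂ ((a , b , c) :⊗ (d , e , f))) := proj₁ (proj₂ ((d , e , f) :⊗ (a , b , c)))) refl a b c d e f)
    (solve 6 (λ a b c d e f → proj₂ (proj₂ ((a , b , c) :⊗ (d , e , f))) := proj₂ (proj₂ ((d , e , f) :⊗ (a , b , c)))) refl a b c d e f)

  ⊗-assoc : ∀ s t u → (s ⊗ t) ⊗ u ≡ s ⊗ (t ⊗ u)
  ⊗-assoc (a , b , c) (d , e , f) (g , h , i) = triple-≡
    (solve 9 (λ a b c d e f g h i → proj₁ (lhs (a , b , c) (d , e , f) (g , h , i)) := proj₁ (rhs (a , b , c) (d , e , f) (g , h , i))) refl a b c d e f g h i)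
    (solve 9 (λ a b c d e f g h i → proj₁ (proj₂ (lhs (a , b , c) (d , e , f) (g , h , i))) := proj₁ (proj₂ (rhs (a , b , c) (d , e , f) (g , h , i)))) refl a b c d e f g h i)
    (solve 9 (λ a b c d e f g h i → proj₂ (proj₂ (lhs (a , b , c) (d , e , f) (g , h , i))) := proj₂ (proj₂ (rhs (a , b , c) (d , e , f) (g , h , i)))) refl a b c d e f g h i)
    where
    lhs rhs : ∀ {n} → (s t u : Triple (Polynomial n)) → Triple (Polynomial n)
    lhs s t u = (s :⊗ t) :⊗ u
    rhs s t u = s :⊗ (t :⊗ u)

  ⊗-distribˡ : ∀ s t u → s ⊗ (t ⊕ u) ≡ (s ⊗ t) ⊕ (s ⊗ u)
  ⊗-distribˡ (a , b , c) (d , e , f) (g , h , i) = triple-≡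
    (solve 9 (λ a b c d e f g h i → proj₁ (lhs (a , b , c) (d , e , f) (g , h , i)) := proj₁ (rhs (a , b , c) (d , e , f) (g , h , i))) refl a b c d e f g h i)
    (solve 9 (λ a b c d e f g h i → proj₁ (proj₂ (lhs (a , b , c) (d , e , f) (g , h , i))) := proj₁ (proj₂ (rhs (a , b , c) (d , e , f) (g , h , i)))) refl a b c d e f g h i)
    (solve 9 (λ a b c d e f g h i → proj₂ (proj₂ (lhs (a , b , c) (d , e , f) (g , h , i))) := proj₂ (proj₂ (rhs (a , b , c) (d , e , f) (g , h , i)))) refl a b c d e f g h i)
    where
    lhs rhs : ∀ {n} → (s t u : Triple (Polynomial n)) → Triple (Polynomial n)
    lhs s t u = s :⊗ (t :⊕ u)
    rhs s t u = (s :⊗ t) :⊕ (s :⊗ u)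

  ⊗-identityˡ : ∀ s → (1# , 0# , 0#) ⊗ s ≡ s
  ⊗-identityˡ (a , b , c) = triple-≡
    (solve 3 (λ a b c → proj₁ (:1 :⊗ (a , b , c)) := a) refl a b c)
    (solve 3 (λ a b c → proj₁ (proj₂ (:1 :⊗ (a , b , c))) := b) refl a b c)
    (solve 3 (λ a b c → proj₂ (proj₂ (:1 :⊗ (a , b , c))) := c) refl a b c)

  triple-isCommutativeRing : IsCommutativeRing _≡_ _⊕_ _⊗_
    (λ (a , b , c) → neg a , neg b , neg c) (0# , 0# , 0#) (1# , 0# , 0#)
  triple-isCommutativeRing = record
    { isRing = record
      { +-isAbelianGroup = record
        { isGroup = record
          { isMonoid = record
            { isSemigroup = record
              { isMagma = record { isEquivalence = isEquivalence ; ∙-cong = cong₂ _⊕_ }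
              ; assoc   = λ _ _ _ → triple-≡ (+-assoc _ _ _) (+-assoc _ _ _) (+-assoc _ _ _)
              }
            ; identity = (λ _ → triple-≡ (+-identityˡ _) (+-identityˡ _) (+-identityˡ _))
                       , (λ _ → triple-≡ (+-identityʳ _) (+-identityʳ _) (+-identityʳ _))
            }
          ; inverse = (λ _ → triple-≡ (-‿inverseˡ _) (-‿inverseˡ _) (-‿inverseˡ _))
                    , (λ _ → triple-≡ (-‿inverseʳ _) (-‿inverseʳ _) (-‿inverseʳ _))
          ; ⁻¹-cong = cong (λ (a , b , c) → neg a , neg b , neg c)
          }
        ; comm = λ _ _ → triple-≡ (+-comm _ _) (+-comm _ _) (+-comm _ _)
        }
      ; *-cong     = cong₂ _⊗_
      ; *-assoc    = ⊗-assoc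
      ; *-identity = ⊗-identityˡ , λ s → trans (⊗-comm s _) (⊗-identityˡ s)
      ; distrib    = ⊗-distribˡ
                   , λ s t u → trans (⊗-comm (t ⊕ u) s)
                       (trans (⊗-distribˡ s t u) (cong₂ _⊕_ (⊗-comm s t) (⊗-comm s u)))
      }
    ; *-comm = ⊗-comm
    }

module 𝔽₂₇ where
  infixl 7 _*_

  0# 1# : Triple (Fin 3)
  0# = 𝔽₃.0# , 𝔽₃.0# , 𝔽₃.0#
  1# = 𝔽₃.1# , 𝔽₃.0# , 𝔽₃.0#

  _*_ : Triple (Fin 3) → Triple (Fin 3) → Triple (Fin 3)
  _*_ = mulTriple 𝔽₃._+_ 𝔽₃._*_

  _≟ᵗ_ : (s t : Triple (Fin 3)) → Dec (s ≡ t)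
  _≟ᵗ_ = ≡-dec _≟_ (≡-dec _≟_ _≟_)

  inverse : ∀ a b c → (a , b , c) ≢ 0# →
            ∃[ d ] ∃[ e ] ∃[ f ] (a , b , c) * (d , e , f) ≡ 1#
  inverse = from-yes (all? λ a → all? λ b → all? λ c →
    ¬? ((a , b , c) ≟ᵗ 0#) →-dec
    any? λ d → any? λ e → any? λ f → ((a , b , c) * (d , e , f)) ≟ᵗ 1#)

  field₂₇ : FiniteField 27
  field₂₇ = record
    { Carrier           = Triple (Fin 3)
    ; isCommutativeRing = TripleLaws.triple-isCommutativeRing 𝔽₃.isCommutativeRing
    ; 1#≢0#             = λ ()
    ; inverse           = λ (a , b , c) s≢0 →
        let (d , e , f , eq) = inverse a b c s≢0 in (d , e , f) , eq
    ; enumeration       = (↔-id (Fin 3) ×-↔ *↔×) ↔-∘ *↔×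
    }

GA[1,27] : FiniteGroup 702
GA[1,27] = GA₁ 𝔽₂₇.field₂₇

-- Let K = 𝔽₂₇, H = K* and let ψ be a nontrivial additive character of K with values in ℤ[ω],
-- ω a cube root of unity. For a : GA(1,27) → ℤ and s ∈ K let E_s be the H × H matrix with
-- entries Σ_b ψ(s r⁻¹ b) a(r r′⁻¹, b). A Fourier transform over K conjugates the group matrix of
-- a into the block sum of the E_s. Translating r shows that det E_s is the same number B for
-- all s ≠ 0, and it is an integer as it is invariant under complex conjugation; A = det E_0 is
-- a group determinant of H ≅ C₂₆, and D = A B²⁶. As a function of s, det E_s is an integral
-- combination of the characters s ↦ ψ(s n), so its sum A + 26 B over all s is divisible by 27.
-- The circulant A is the product of two circulants of order 13 that are congruent modulo 2,
-- and a circulant of order 13 with row sum s equals s N, where N ≡ s¹² modulo 13; this gives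
-- the conditions at 2 and 13.
--
-- Conversely take a = c + n Σ y with c ∈ ℤ[H], n a translation, Σ the sum over H and y ∈ ℤ[K].
-- Then E_s is the circulant of c plus a matrix of rank one. If c c* = d = det c, the matrix
-- determinant lemma gives A = d + 26 σ k and B = d - σ k + 27 t, where σ is the sum of the
-- entries of c*, k that of the entries of y, and t = Σ_h c*(h) y(h). When the entries of c* are
-- coprime, k and t are arbitrary, so that all B ≡ A modulo 27 occur for A ≡ d modulo 26 σ. The
-- admissible residues of A modulo 676 are covered in this way by 26 choices of c.
module Submission where

open import Defs
open import Algebra.Bundles using (CommutativeRing)
import Algebra.Properties.Ring as RingProperties
import Algebra.Properties.Semiring.Sum as SemiringSum
import Algebra.Solver.Ring.NaturalCoefficients.Default as NatCoeffSolver
open import Algebra.Structures using (IsCommutativeRing; IsGroup)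
open import Data.Bool.Base using (Bool; true; false; if_then_else_)
open import Data.Empty using (⊥-elim)
open import Data.Fin.Base as Fin using (Fin; zero; suc; toℕ; fromℕ<; punchIn; inject₁; _↑ˡ_; _↑ʳ_; combine; remQuot)
open import Data.Fin.Permutation using (↔⇒≡)
open import Data.Fin.Properties as Fin using (_≟_; all?; any?; suc-injective; remQuot-combine; combine-remQuot)
import Data.Integer.DivMod as ℤ
open import Data.Integer.Divisibility using (_∣_)
open import Data.Integer.Divisibility.Signed as Signed using (divides; ∣⇒∣ᵤ; ∣ᵤ⇒∣; _∣?_) renaming (_∣_ to _∣ₛ_)
import Data.Integer.Properties as ℤ
open import Data.Integer.Tactic.RingSolver using (solve-∀)
open import Data.Nat.Base as ℕ using (ℕ; _≡ᵇ_; _<ᵇ_; _≤ᵇ_)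
import Data.Nat.Divisibility as ℕ
open import Data.Nat.DivMod using (_mod_; _%_; _/_)
open import Data.Nat.Primality using (Prime; prime?; euclidsLemma)
import Data.Nat.Properties as ℕ
open import Data.Product.Base using (_×_; _,_; proj₁; proj₂; Σ; ∃-syntax; ∃₂)
open import Data.Product.Properties using (≡-dec)
open import Data.Sum.Base using (_⊎_; inj₁; inj₂; [_,_]′)
open import Data.Vec.Base as Vec using (Vec; []; _∷_; lookup)
import Data.Vec.Functional as Vector
open import Function.Base using (_∘_)
open import Function.Bundles using (_↔_; Inverse; mk↔ₛ′; _⇔_; mk⇔; Equivalence)
open import Function.Construct.Composition using (_↔-∘_)
open import Function.Construct.Symmetry using (↔-sym)
open import Function.Properties.Equivalence using () renaming (trans to ⇔-trans)
open import Level using (0ℓ)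
open import Relation.Binary.Definitions using (tri<; tri≈; tri>)
open import Relation.Binary.PropositionalEquality hiding (resp; [_])
open import Relation.Nullary.Decidable using (Dec; yes; no; does; map′; ¬?; from-yes; dec-true; dec-false; _→-dec_; _×-dec_; _⊎-dec_)

-- Determinants over commutative rings

-- A Laplace expansion of order 26 or 702 cannot be evaluated, so every determinant is derived from
-- structure: multiplicativity, intertwining matrices, triangular blocks and rank one updates. Over
-- ℤ[ω] the Fourier matrix P of the group is not invertible. The relations P M = E P and P Q = 27
-- are used instead; Det P can be cancelled because 27 is not a zero divisor.
--
-- The translation n makes the converse work. Without it the column vector u of the rank one term
-- would be constant for every s, and 27 t would become 27 σ y(0), so that only every σ-th value of
-- B would be reached.
--
-- If c has coefficient sum e, then σ = d / e. Four kinds of c, with σ = 1, 2, 13, 26, serve the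
-- four values of gcd(A, 26); the steps 26 σ all divide 676 = 26². The determinants d are reduced by
-- telescoping products to those of 1 - y + t Σ in ℤ[C₁₃], with Σ the sum of all powers of y, which
-- are 169 t.

record StrictRing : Set₁ where
  infixl 6 _+_
  infixl 7 _*_
  infix  8 -_
  field
    A   : Set
    _+_ : A → A → A
    _*_ : A → A → A
    -_  : A → A
    0#  : A
    1#  : A
    isCommutativeRing : IsCommutativeRing _≡_ _+_ _*_ -_ 0# 1#

module Determinant (strictRing : StrictRing) where

  open Vector using () renaming (_∷_ to _◂_)

  open StrictRing strictRing

  R : CommutativeRing 0ℓ 0ℓ
  R = record { isCommutativeRing = isCommutativeRing }

  open IsCommutativeRing isCommutativeRing public
    hiding (refl; sym; trans; reflexive; isEquivalence; zero)
  open RingProperties (CommutativeRing.ring R) public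
    using (-‿distribˡ-*; -‿distribʳ-*; -‿involutive; x+x≈x⇒x≈0; -1*x≈-x; -0#≈0#; x∙y⁻¹≈ε⇒x≈y; +-inverseˡ-unique)
  module Sum = SemiringSum (CommutativeRing.semiring R)
  open NatCoeffSolver (CommutativeRing.commutativeSemiring R) public
    using (solve; _:=_; _:+_; _:*_; con)

  Mat : ℕ → Set
  Mat n = Fin n → Fin n → A

  opaque
    ∑ : ∀ {n} → (Fin n → A) → A
    ∑ = Sum.sum

    ∑-empty : (f : Fin 0 → A) → ∑ f ≡ 0#
    ∑-empty f = refl

    ∑-suc : ∀ {n} (f : Fin (ℕ.suc n) → A) → ∑ f ≡ f zero + ∑ (λ i → f (suc i))
    ∑-suc f = refl

    ∑-cong : ∀ {n} {f g : Fin n → A} → (∀ i → f i ≡ g i) → ∑ f ≡ ∑ g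
    ∑-cong = Sum.sum-cong-≗

    ∑-distrib-+ : ∀ {n} (f g : Fin n → A) → ∑ (λ i → f i + g i) ≡ ∑ f + ∑ g
    ∑-distrib-+ = Sum.∑-distrib-+

    ∑-comm : ∀ {m n} (f : Fin m → Fin n → A) → ∑ (λ i → ∑ λ j → f i j) ≡ ∑ (λ j → ∑ λ i → f i j)
    ∑-comm = Sum.∑-comm

    ∑-permute : ∀ {m n} (f : Fin n → A) (π : Fin m ↔ Fin n) → ∑ f ≡ ∑ (λ i → f (Inverse.to π i))
    ∑-permute = Sum.sum-permute

    *-distribˡ-∑ : ∀ {n} c (f : Fin n → A) → c * ∑ f ≡ ∑ (λ i → c * f i)
    *-distribˡ-∑ = Sum.*-distribˡ-sum

    *-distribʳ-∑ : ∀ {n} c (f : Fin n → A) → ∑ f * c ≡ ∑ (λ i → f i * c)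
    *-distribʳ-∑ = Sum.*-distribʳ-sum

    ∑-0 : ∀ n → ∑ {n} (λ _ → 0#) ≡ 0#
    ∑-0 = Sum.sum-replicate-zero

  ∑-zero : ∀ {n} {f : Fin n → A} → (∀ i → f i ≡ 0#) → ∑ f ≡ 0#
  ∑-zero {n} f≡0 = trans (∑-cong f≡0) (∑-0 n)

  δ : ∀ {n} → Fin n → Fin n → A
  δ i j = if does (i ≟ j) then 1# else 0#

  δ-refl : ∀ {n} (i : Fin n) → δ i i ≡ 1#
  δ-refl i rewrite dec-true (i ≟ i) refl = refl

  δ-≢ : ∀ {n} {i j : Fin n} → i ≢ j → δ i j ≡ 0#
  δ-≢ {i = i} {j} i≢j rewrite dec-false (i ≟ j) i≢j = refl

  δ-injective : ∀ {n m} (f : Fin n → Fin m) → (∀ {i j} → f i ≡ f j → i ≡ j) →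
                ∀ i j → δ (f i) (f j) ≡ δ i j
  δ-injective f f-inj i j with i ≟ j
  ... | yes refl = δ-refl (f i)
  ... | no i≢j   = δ-≢ (i≢j ∘ f-inj)

  δ-suc : ∀ {n} (i j : Fin n) → δ (suc i) (suc j) ≡ δ i j
  δ-suc = δ-injective suc suc-injective

  δ-sym : ∀ {n} (i j : Fin n) → δ i j ≡ δ j i
  δ-sym i j with i ≟ j
  ... | yes refl = sym (δ-refl i)
  ... | no i≢j   = sym (δ-≢ (i≢j ∘ sym))

  ∑-δˡ : ∀ {n} (i : Fin n) (f : Fin n → A) → ∑ (λ k → δ i k * f k) ≡ f i
  ∑-δˡ {ℕ.suc n} zero f = begin
    ∑ (λ k → δ zero k * f k)                        ≡⟨ ∑-suc _ ⟩
    1# * f zero + ∑ (λ k → 0# * f (suc k))          ≡⟨ cong₂ _+_ (*-identityˡ (f zero)) (∑-zero λ k → zeroˡ (f (suc k))) ⟩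
    f zero + 0#                                     ≡⟨ +-identityʳ (f zero) ⟩
    f zero                                          ∎
    where open ≡-Reasoning
  ∑-δˡ {ℕ.suc n} (suc i) f = begin
    ∑ (λ k → δ (suc i) k * f k)                     ≡⟨ ∑-suc _ ⟩
    0# * f zero + ∑ (λ k → δ (suc i) (suc k) * f (suc k)) ≡⟨ cong₂ _+_ (zeroˡ (f zero)) (∑-cong λ k → cong (_* f (suc k)) (δ-suc i k)) ⟩
    0# + ∑ (λ k → δ i k * f (suc k))                ≡⟨ +-identityˡ _ ⟩
    ∑ (λ k → δ i k * f (suc k))                     ≡⟨ ∑-δˡ i (f ∘ suc) ⟩
    f (suc i)                                       ∎
    where open ≡-Reasoning

  ∑-δʳ : ∀ {n} (i : Fin n) (f : Fin n → A) → ∑ (λ k → f k * δ k i) ≡ f i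
  ∑-δʳ i f = trans (∑-cong λ k → trans (*-comm (f k) (δ k i)) (cong (_* f k) (δ-sym k i))) (∑-δˡ i f)

  ∑-↑ : ∀ p {q} (f : Fin (p ℕ.+ q) → A) → ∑ f ≡ ∑ (λ i → f (i ↑ˡ q)) + ∑ (λ i → f (p ↑ʳ i))
  ∑-↑ ℕ.zero f = sym (trans (+-congʳ (∑-empty _)) (+-identityˡ (∑ f)))
  ∑-↑ (ℕ.suc p) {q} f = begin
    ∑ f                                                                            ≡⟨ ∑-suc f ⟩
    f zero + ∑ (f ∘ suc)                                                           ≡⟨ cong (f zero +_) (∑-↑ p (f ∘ suc)) ⟩
    f zero + (∑ (λ i → f (suc (i ↑ˡ q))) + ∑ (λ i → f (suc (p ↑ʳ i))))             ≡⟨ +-assoc _ _ _ ⟨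
    f zero + ∑ (λ i → f (suc (i ↑ˡ q))) + ∑ (λ i → f (suc (p ↑ʳ i)))               ≡⟨ +-congʳ (∑-suc (λ i → f (i ↑ˡ q))) ⟨
    ∑ (λ i → f (i ↑ˡ q)) + ∑ (λ i → f (suc (p ↑ʳ i)))                              ∎
    where open ≡-Reasoning

  ∑-combine : ∀ p q (f : Fin (p ℕ.* q) → A) → ∑ f ≡ ∑ (λ i → ∑ λ j → f (combine {p} {q} i j))
  ∑-combine ℕ.zero q f = trans (∑-empty f) (sym (∑-empty _))
  ∑-combine (ℕ.suc p) q f = begin
    ∑ f                                                                  ≡⟨ ∑-↑ q f ⟩
    ∑ (λ j → f (j ↑ˡ (p ℕ.* q))) + ∑ (λ i → f (q ↑ʳ i))                  ≡⟨ +-congˡ (∑-combine p q (λ i → f (q ↑ʳ i))) ⟩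
    ∑ (λ j → f (combine {ℕ.suc p} {q} zero j)) + ∑ (λ i → ∑ λ j → f (combine {ℕ.suc p} {q} (suc i) j)) ≡⟨ ∑-suc _ ⟨
    ∑ (λ i → ∑ λ j → f (combine {ℕ.suc p} {q} i j))                      ∎
    where open ≡-Reasoning

  -- Multilinear alternating functions and the characterisation of the determinant

  record Multilinear {n m} (F : (Fin n → Fin m → A) → A) : Set where
    field
      resp   : ∀ {M N} → (∀ i j → M i j ≡ N i j) → F M ≡ F N
      linear : ∀ i {M M₁ M₂} c → (∀ j → M i j ≡ M₁ i j + c * M₂ i j) →
               (∀ k → k ≢ i → ∀ j → M k j ≡ M₁ k j) → (∀ k → k ≢ i → ∀ j → M k j ≡ M₂ k j) →
               F M ≡ F M₁ + c * F M₂

  Alternating : ∀ {n m} → ((Fin n → Fin m → A) → A) → Set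
  Alternating F = ∀ {i k} → i ≢ k → ∀ {M} → (∀ j → M i j ≡ M k j) → F M ≡ 0#

  open Multilinear

  update : ∀ {n m} → (Fin n → Fin m → A) → Fin n → (Fin m → A) → Fin n → Fin m → A
  update M i r k = if does (k ≟ i) then r else M k

  update-≡ : ∀ {n m} (M : Fin n → Fin m → A) i r j → update M i r i j ≡ r j
  update-≡ M i r j rewrite dec-true (i ≟ i) refl = refl

  update-≢ : ∀ {n m} (M : Fin n → Fin m → A) i r {k} → k ≢ i → ∀ j → update M i r k j ≡ M k j
  update-≢ M i r {k} k≢i j rewrite dec-false (k ≟ i) k≢i = refl

  module _ {n m} {F : (Fin n → Fin m → A) → A} (ml : Multilinear F) where

    additive : ∀ i {M M₁ M₂} → (∀ j → M i j ≡ M₁ i j + M₂ i j) →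
               (∀ k → k ≢ i → ∀ j → M k j ≡ M₁ k j) → (∀ k → k ≢ i → ∀ j → M k j ≡ M₂ k j) →
               F M ≡ F M₁ + F M₂
    additive i {M} {M₁} {M₂} eq eq₁ eq₂ =
      trans (linear ml i 1# (λ j → trans (eq j) (+-congˡ (sym (*-identityˡ (M₂ i j))))) eq₁ eq₂)
            (+-congˡ (*-identityˡ (F M₂)))

    zero-row : ∀ i {M} → (∀ j → M i j ≡ 0#) → F M ≡ 0#
    zero-row i {M} Mi≡0 = x+x≈x⇒x≈0 _ (sym (additive i {M} {M} {M}
      (λ j → trans (Mi≡0 j) (sym (trans (cong₂ _+_ (Mi≡0 j) (Mi≡0 j)) (+-identityˡ _))))
      (λ _ _ _ → refl) (λ _ _ _ → refl)))

    -- Polarisation: F vanishes when rows i and k are both M i + M k, both M i, or both M k.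
    -- Expanding the first of these leaves only the two mixed terms.
    swap-rows : Alternating F → ∀ {i k} → i ≢ k → ∀ {M N} →
      (∀ j → N i j ≡ M k j) → (∀ j → N k j ≡ M i j) → (∀ l → l ≢ i → l ≢ k → ∀ j → N l j ≡ M l j) →
      F M + F N ≡ 0#
    swap-rows alt {i} {k} i≢k {M} {N} Ni Nk Nl = begin
      F M + F N                                       ≡⟨ cong₂ _+_ (resp ml M≗) (resp ml N≗) ⟩
      G a b + G b a                                   ≡⟨ cong₂ _+_ (sym (trans (+-congʳ (Guu a)) (+-identityˡ (G a b)))) (sym (trans (+-congˡ (Guu b)) (+-identityʳ (G b a)))) ⟩
      (G a a + G a b) + (G b a + G b b)               ≡⟨ cong₂ _+_ (Gʳ a) (Gʳ b) ⟨
      G a (λ j → a j + b j) + G b (λ j → a j + b j)   ≡⟨ Gˡ _ ⟨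
      G (λ j → a j + b j) (λ j → a j + b j)           ≡⟨ Guu _ ⟩
      0#                                              ∎
      where
      open ≡-Reasoning
      a b : Fin m → A
      a = M i
      b = M k
      X : (u v : Fin m → A) → Fin n → Fin m → A
      X u v = update (update M k v) i u
      Xi : ∀ u v j → X u v i j ≡ u j
      Xi u v = update-≡ (update M k v) i u
      Xk : ∀ u v j → X u v k j ≡ v j
      Xk u v j = trans (update-≢ (update M k v) i u (i≢k ∘ sym) j) (update-≡ M k v j)
      Xl : ∀ u v l → l ≢ i → l ≢ k → ∀ j → X u v l j ≡ M l j
      Xl u v l l≢i l≢k j = trans (update-≢ (update M k v) i u l≢i j) (update-≢ M k v l≢k j)
      G : (u v : Fin m → A) → A
      G u v = F (X u v)
      Guu : ∀ u → G u u ≡ 0#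
      Guu u = alt i≢k λ j → trans (Xi u u j) (sym (Xk u u j))
      agree : ∀ {P Q : Fin n → Fin m → A} → (∀ j → P i j ≡ Q i j) → (∀ j → P k j ≡ Q k j) →
              (∀ l → l ≢ i → l ≢ k → ∀ j → P l j ≡ Q l j) → ∀ l j → P l j ≡ Q l j
      agree ei ek el l with l ≟ i | l ≟ k
      ... | yes refl | _        = ei
      ... | no _     | yes refl = ek
      ... | no l≢i   | no l≢k   = el l l≢i l≢k
      M≗ : ∀ l j → M l j ≡ X a b l j
      M≗ = agree (λ j → sym (Xi a b j)) (λ j → sym (Xk a b j)) (λ l p q j → sym (Xl a b l p q j))
      N≗ : ∀ l j → N l j ≡ X b a l j
      N≗ = agree (λ j → trans (Ni j) (sym (Xi b a j))) (λ j → trans (Nk j) (sym (Xk b a j)))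
                 (λ l p q j → trans (Nl l p q j) (sym (Xl b a l p q j)))
      Gˡ : ∀ v → G (λ j → a j + b j) v ≡ G a v + G b v
      Gˡ v = additive i (λ j → trans (Xi _ v j) (sym (cong₂ _+_ (Xi a v j) (Xi b v j)))) (off a) (off b)
        where
        off : ∀ u l → l ≢ i → ∀ j → X (λ j → a j + b j) v l j ≡ X u v l j
        off u l l≢i j = trans (update-≢ (update M k v) i (λ j → a j + b j) l≢i j) (sym (update-≢ (update M k v) i u l≢i j))
      Gʳ : ∀ u → G u (λ j → a j + b j) ≡ G u a + G u b
      Gʳ u = additive k (λ j → trans (Xk u _ j) (sym (cong₂ _+_ (Xk u a j) (Xk u b j)))) (off a) (off b)
        where
        off : ∀ v l → l ≢ k → ∀ j → X u (λ j → a j + b j) l j ≡ X u v l j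
        off v l l≢k j with l ≟ i
        ... | yes refl = refl
        ... | no l≢i   = trans (update-≢ M k (λ j → a j + b j) l≢k j) (sym (update-≢ M k v l≢k j))

  module _ {n m} {F : (Fin (ℕ.suc n) → Fin m → A) → A} (ml : Multilinear F) where

    η-rows : ∀ M → F M ≡ F (M zero ◂ M ∘ suc)
    η-rows M = resp ml λ { zero j → refl ; (suc i) j → refl }

    -- This is where rectangular matrices enter: once row zero of a square matrix is fixed, one row
    -- fewer than columns remains.
    tail-multilinear : ∀ u → Multilinear (λ N → F (u ◂ N))
    tail-multilinear u .resp M≗N = resp ml λ { zero j → refl ; (suc i) j → M≗N i j }
    tail-multilinear u .linear i c eq eq₁ eq₂ = linear ml (suc i) c eq (other eq₁) (other eq₂)
      where
      other : ∀ {M N : Fin n → Fin m → A} → (∀ k → k ≢ i → ∀ j → M k j ≡ N k j) →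
              ∀ k → k ≢ suc i → ∀ j → (u ◂ M) k j ≡ (u ◂ N) k j
      other eq zero    _   j = refl
      other eq (suc k) k≢i j = eq k (k≢i ∘ cong suc) j

    tail-alternating : Alternating F → ∀ u → Alternating (λ N → F (u ◂ N))
    tail-alternating alt u i≢k eq = alt (i≢k ∘ suc-injective) eq

    head-linear : ∀ N c {u u₁ u₂} → (∀ j → u j ≡ u₁ j + c * u₂ j) → F (u ◂ N) ≡ F (u₁ ◂ N) + c * F (u₂ ◂ N)
    head-linear N c eq = linear ml zero c eq other other
      where
      other : ∀ {u v : Fin m → A} k → k ≢ zero → ∀ j → (u ◂ N) k j ≡ (v ◂ N) k j
      other zero    k≢0 = ⊥-elim (k≢0 refl)
      other (suc k) k≢0 j = refl

    head-expand : ∀ N {p} (c : Fin p → A) (v : Fin p → Fin m → A) →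
                  F ((λ k → ∑ λ j → c j * v j k) ◂ N) ≡ ∑ λ j → c j * F (v j ◂ N)
    head-expand N {ℕ.zero}  c v = trans (zero-row ml zero λ j → ∑-empty _) (sym (∑-empty _))
    head-expand N {ℕ.suc p} c v = begin
      F ((λ k → ∑ λ j → c j * v j k) ◂ N)                                          ≡⟨ head-linear N (c zero) (λ k → trans (∑-suc _) (+-comm _ _)) ⟩
      F ((λ k → ∑ λ j → c (suc j) * v (suc j) k) ◂ N) + c zero * F (v zero ◂ N)    ≡⟨ +-comm _ _ ⟩
      c zero * F (v zero ◂ N) + F ((λ k → ∑ λ j → c (suc j) * v (suc j) k) ◂ N)    ≡⟨ +-congˡ (head-expand N (c ∘ suc) (v ∘ suc)) ⟩
      c zero * F (v zero ◂ N) + ∑ (λ j → c (suc j) * F (v (suc j) ◂ N))            ≡⟨ ∑-suc _ ⟨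
      ∑ (λ j → c j * F (v j ◂ N))                                                  ∎
      where open ≡-Reasoning

  -- Meant for a `w` that F already holds as a fixed row: each term that linearity splits off has
  -- `w` twice and vanishes.
  clear-multiples : ∀ {n m} {F : (Fin n → Fin m → A) → A} → Multilinear F → ∀ (w : Fin m → A) →
    (∀ M i → (∀ j → M i j ≡ w j) → F M ≡ 0#) →
    ∀ (c : Fin n → A) {M N} → (∀ i j → M i j ≡ N i j + c i * w j) → F M ≡ F N
  clear-multiples {ℕ.zero}  ml w vanish c eq = resp ml λ ()
  clear-multiples {ℕ.suc n} {F = F} ml w vanish c {M} {N} eq = begin
    F M                                                       ≡⟨ η-rows ml M ⟩
    F (M zero ◂ M ∘ suc)                                      ≡⟨ head-linear ml (M ∘ suc) (c zero) (eq zero) ⟩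
    F (N zero ◂ M ∘ suc) + c zero * F (w ◂ M ∘ suc)           ≡⟨ cong (λ z → F (N zero ◂ M ∘ suc) + c zero * z) (vanish _ zero λ j → refl) ⟩
    F (N zero ◂ M ∘ suc) + c zero * 0#                        ≡⟨ trans (+-congˡ (zeroʳ _)) (+-identityʳ _) ⟩
    F (N zero ◂ M ∘ suc)                                      ≡⟨ clear-multiples (tail-multilinear ml (N zero)) w (λ M i → vanish _ (suc i)) (c ∘ suc) (λ i → eq (suc i)) ⟩
    F (N zero ◂ N ∘ suc)                                      ≡⟨ η-rows ml N ⟨
    F N                                                       ∎
    where open ≡-Reasoning

  sgn : ∀ {n} → Fin n → A
  sgn zero    = 1#
  sgn (suc i) = - sgn i

  minor : ∀ {n} → Mat (ℕ.suc n) → Fin (ℕ.suc n) → Mat n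
  minor M j i k = M (suc i) (punchIn j k)

  opaque
    Det : ∀ {n} → Mat n → A
    Det {ℕ.zero}  M = 1#
    Det {ℕ.suc n} M = ∑ λ j → sgn j * M zero j * Det (minor M j)

    Det-empty : (M : Mat 0) → Det M ≡ 1#
    Det-empty M = refl

    Det-suc : ∀ {n} (M : Mat (ℕ.suc n)) → Det M ≡ ∑ (λ j → sgn j * M zero j * Det (minor M j))
    Det-suc M = refl

    Det-cong : ∀ {n} {M N : Mat n} → (∀ i j → M i j ≡ N i j) → Det M ≡ Det N
    Det-cong {ℕ.zero}  eq = refl
    Det-cong {ℕ.suc n} eq = ∑-cong λ j → cong₂ (λ x y → sgn j * x * y) (eq zero j)
      (Det-cong λ i k → eq (suc i) (punchIn j k))

  private
    ∑-linear : ∀ {n} c (f g : Fin n → A) → ∑ (λ j → f j + c * g j) ≡ ∑ f + c * ∑ g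
    ∑-linear c f g = trans (∑-distrib-+ f (λ j → c * g j)) (cong (∑ f +_) (sym (*-distribˡ-∑ c g)))

  opaque
    unfolding Det

    Det-multilinear : ∀ {n} → Multilinear (Det {n})
    Det-multilinear .resp = Det-cong
    Det-multilinear {ℕ.suc n} .linear zero {M} {M₁} {M₂} c eq eq₁ eq₂ = trans
      (∑-cong λ j → trans
        (cong (λ z → sgn j * z * Det (minor M j)) (eq j))
        (trans
          (solve 5 (λ s a b c d → s :* (a :+ c :* b) :* d := s :* a :* d :+ c :* (s :* b :* d)) refl (sgn j) (M₁ zero j) (M₂ zero j) c (Det (minor M j)))
          (cong₂ (λ x y → sgn j * M₁ zero j * x + c * (sgn j * M₂ zero j * y))
            (Det-cong λ i k → eq₁ (suc i) (λ ()) (punchIn j k))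
            (Det-cong λ i k → eq₂ (suc i) (λ ()) (punchIn j k)))))
      (∑-linear c (λ j → sgn j * M₁ zero j * Det (minor M₁ j)) (λ j → sgn j * M₂ zero j * Det (minor M₂ j)))
    Det-multilinear {ℕ.suc n} .linear (suc i) {M} {M₁} {M₂} c eq eq₁ eq₂ = trans
      (∑-cong λ j → trans
        (cong (sgn j * M zero j *_) (linear Det-multilinear i c (λ k → eq (punchIn j k))
          (λ k k≢i l → eq₁ (suc k) (k≢i ∘ suc-injective) (punchIn j l))
          (λ k k≢i l → eq₂ (suc k) (k≢i ∘ suc-injective) (punchIn j l))))
        (trans
          (solve 5 (λ s a c d e → s :* a :* (d :+ c :* e) := s :* a :* d :+ c :* (s :* a :* e)) refl (sgn j) (M zero j) c (Det (minor M₁ j)) (Det (minor M₂ j)))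
          (cong₂ (λ x y → sgn j * x * Det (minor M₁ j) + c * (sgn j * y * Det (minor M₂ j)))
            (eq₁ zero (λ ()) j) (eq₂ zero (λ ()) j))))
      (∑-linear c _ _)

  private
    -- The double Laplace expansion along two equal rows: the terms (0, k) and
    -- (k + 1, 0) cancel, the remaining ones form the same sum in one dimension less.
    double-expansion : ∀ n (v : Fin (2 ℕ.+ n) → A) (Ψ : (Fin n → Fin (2 ℕ.+ n)) → A) →
      (∀ {g h} → (∀ c → g c ≡ h c) → Ψ g ≡ Ψ h) →
      ∑ (λ j → ∑ λ k → sgn j * v j * (sgn k * v (punchIn j k) * Ψ (punchIn j ∘ punchIn k))) ≡ 0#
    double-expansion n v Ψ Ψ-cong = begin
      ∑ (λ j → ∑ (X j))                                                          ≡⟨ trans (∑-suc _) (+-congˡ (∑-cong λ j → ∑-suc (X (suc j)))) ⟩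
      ∑ (X zero) + ∑ (λ j → X (suc j) zero + ∑ λ k → X (suc j) (suc k))         ≡⟨ cong (∑ (X zero) +_) (∑-distrib-+ (λ j → X (suc j) zero) (λ j → ∑ λ k → X (suc j) (suc k))) ⟩
      ∑ (X zero) + (∑ (λ j → X (suc j) zero) + ∑ λ j → ∑ λ k → X (suc j) (suc k)) ≡⟨ +-assoc _ _ _ ⟨
      ∑ (X zero) + ∑ (λ j → X (suc j) zero) + ∑ (λ j → ∑ λ k → X (suc j) (suc k)) ≡⟨ cong₂ _+_ cancel (rest n v Ψ Ψ-cong) ⟩
      0# + 0#                                                                    ≡⟨ +-identityˡ _ ⟩
      0#                                                                         ∎
      where
      open ≡-Reasoning
      X : ∀ j k → A
      X j k = sgn j * v j * (sgn k * v (punchIn j k) * Ψ (punchIn j ∘ punchIn k))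
      cancel : ∑ (X zero) + ∑ (λ j → X (suc j) zero) ≡ 0#
      cancel = trans (sym (∑-distrib-+ (X zero) (λ j → X (suc j) zero))) (∑-zero λ k → begin
        1# * v zero * (sgn k * v (suc k) * Ψ (suc ∘ punchIn k)) + - sgn k * v (suc k) * (1# * v zero * Ψ (suc ∘ punchIn k))
          ≡⟨ solve 5 (λ s t a b p → con 1 :* a :* (s :* b :* p) :+ t :* b :* (con 1 :* a :* p) := (s :+ t) :* (a :* b :* p)) refl
               (sgn k) (- sgn k) (v zero) (v (suc k)) (Ψ (suc ∘ punchIn k)) ⟩
        (sgn k + - sgn k) * (v zero * v (suc k) * Ψ (suc ∘ punchIn k))
          ≡⟨ trans (cong (_* (v zero * v (suc k) * Ψ (suc ∘ punchIn k))) (-‿inverseʳ _)) (zeroˡ _) ⟩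
        0# ∎)
      rest : ∀ n (v : Fin (2 ℕ.+ n) → A) (Ψ : (Fin n → Fin (2 ℕ.+ n)) → A) →
        (∀ {g h} → (∀ c → g c ≡ h c) → Ψ g ≡ Ψ h) →
        ∑ (λ j → ∑ λ k → sgn (suc j) * v (suc j) * (sgn (suc k) * v (punchIn (suc j) (suc k)) *
          Ψ (punchIn (suc j) ∘ punchIn (suc k)))) ≡ 0#
      rest ℕ.zero    v Ψ Ψ-cong = ∑-zero λ j → ∑-empty _
      rest (ℕ.suc n) v Ψ Ψ-cong = trans
        (∑-cong λ j → ∑-cong λ k → trans
          (cong (λ z → - sgn j * v (suc j) * (- sgn k * v (suc (punchIn j k)) * z)) (Ψ-cong λ { zero → refl ; (suc c) → refl }))
          (signs (sgn j) (sgn k) _ _ _))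
        (double-expansion n (v ∘ suc) (λ g → Ψ (lift g)) (λ eq → Ψ-cong λ { zero → refl ; (suc c) → cong suc (eq c) }))
        where
        lift : (Fin n → Fin (2 ℕ.+ n)) → Fin (ℕ.suc n) → Fin (3 ℕ.+ n)
        lift g = zero ◂ (suc ∘ g)
        signs : ∀ s t a b p → - s * a * (- t * b * p) ≡ s * a * (t * b * p)
        signs s t a b p = trans
          (solve 5 (λ s t a b p → s :* a :* (t :* b :* p) := s :* t :* (a :* b :* p)) refl (- s) (- t) a b p)
          (trans (cong (_* (a * b * p)) (trans (sym (-‿distribˡ-* s (- t))) (trans (cong -_ (sym (-‿distribʳ-* s t))) (-‿involutive _))))
            (solve 5 (λ s t a b p → s :* t :* (a :* b :* p) := s :* a :* (t :* b :* p)) refl s t a b p))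

  opaque
    unfolding Det

    private
      -- If row one is the equal row, the double expansion cancels. Otherwise row one is exchanged
      -- with the equal row, which changes only the sign because the determinant already alternates
      -- in the rows below row zero.
      alternating-first : ∀ {n} → Alternating (Det {n}) → ∀ k {M : Mat (ℕ.suc n)} →
                          (∀ j → M zero j ≡ M (suc k) j) → Det M ≡ 0#
      alternating-first {ℕ.suc n} alt zero {M} eq = trans
        (∑-cong λ j → trans
          (cong (sgn j * M zero j *_) (∑-cong λ k →
            cong (λ z → sgn k * z * Det (minor (minor M j) k)) (sym (eq (punchIn j k)))))
          (*-distribˡ-∑ (sgn j * M zero j) (λ k → sgn k * M zero (punchIn j k) * Det (minor (minor M j) k))))
        (double-expansion n (M zero) (λ g → Det λ i k → M (suc (suc i)) (g k))
          λ eq → Det-cong λ i k → cong (M (suc (suc i))) (eq k))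
      alternating-first {ℕ.suc n} alt (suc k) {M} eq = begin
        Det M                                     ≡⟨ η-rows Det-multilinear M ⟩
        Det (M zero ◂ M ∘ suc)                    ≡⟨ +-identityʳ _ ⟨
        Det (M zero ◂ M ∘ suc) + 0#               ≡⟨ cong (Det (M zero ◂ M ∘ suc) +_) (alternating-first alt zero {M zero ◂ N} eq) ⟨
        Det (M zero ◂ M ∘ suc) + Det (M zero ◂ N) ≡⟨ swap-rows (tail-multilinear Det-multilinear (M zero)) tail-alt {zero} {suc k} (λ ()) (λ j → refl) N-k N-l ⟩
        0#                                        ∎
        where
        open ≡-Reasoning
        N : Fin (ℕ.suc n) → Fin (2 ℕ.+ n) → A
        N zero    = M (suc (suc k))
        N (suc l) = if does (l ≟ k) then M (suc zero) else M (suc (suc l))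
        N-k : ∀ j → N (suc k) j ≡ M (suc zero) j
        N-k j rewrite dec-true (k ≟ k) refl = refl
        N-l : ∀ l → l ≢ zero → l ≢ suc k → ∀ j → N l j ≡ M (suc l) j
        N-l zero    0≢0 _   j = ⊥-elim (0≢0 refl)
        N-l (suc l) _   l≢k j rewrite dec-false (l ≟ k) (l≢k ∘ cong suc) = refl
        tail-alt : Alternating (λ N → Det (M zero ◂ N))
        tail-alt i≢k {N} eq = ∑-zero λ j → trans
          (cong (sgn j * M zero j *_) (alt i≢k {λ i k → N i (punchIn j k)} λ l → eq (punchIn j l))) (zeroʳ _)

    Det-alternating : ∀ {n} → Alternating (Det {n})
    Det-alternating {ℕ.suc n} {zero}  {zero}  0≢0 eq = ⊥-elim (0≢0 refl)
    Det-alternating {ℕ.suc n} {zero}  {suc k} 0≢k {M} eq = alternating-first Det-alternating k {M} eq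
    Det-alternating {ℕ.suc n} {suc i} {zero}  i≢0 {M} eq = alternating-first Det-alternating i {M} (λ j → sym (eq j))
    Det-alternating {ℕ.suc n} {suc i} {suc k} i≢k {M} eq = ∑-zero λ j → trans
      (cong (sgn j * M zero j *_) (Det-alternating (i≢k ∘ cong suc) λ l → eq (punchIn j l))) (zeroʳ _)

  -- Lets a function of full rows act on the rows of a minor, padded by zero in the removed column.
  insert : ∀ {n} → Fin (ℕ.suc n) → (Fin n → A) → Fin (ℕ.suc n) → A
  insert zero                w = 0# ◂ w
  insert {ℕ.suc n} (suc j)   w = w zero ◂ insert j (w ∘ suc)

  private
    insert-cong : ∀ {n} j {v w : Fin n → A} → (∀ i → v i ≡ w i) → ∀ i → insert j v i ≡ insert j w i
    insert-cong zero eq zero = refl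
    insert-cong zero eq (suc i) = eq i
    insert-cong {ℕ.suc n} (suc j) eq zero = eq zero
    insert-cong {ℕ.suc n} (suc j) eq (suc i) = insert-cong j (eq ∘ suc) i

    insert-linear : ∀ {n} j c {u v w : Fin n → A} → (∀ i → u i ≡ v i + c * w i) →
                    ∀ i → insert j u i ≡ insert j v i + c * insert j w i
    insert-linear zero c eq zero = sym (trans (cong (0# +_) (zeroʳ c)) (+-identityˡ _))
    insert-linear zero c eq (suc i) = eq i
    insert-linear {ℕ.suc n} (suc j) c eq zero = eq zero
    insert-linear {ℕ.suc n} (suc j) c eq (suc i) = insert-linear j c (eq ∘ suc) i

    insert-punchIn : ∀ {n} j (w : Fin (ℕ.suc n) → A) i → w i ≡ insert j (w ∘ punchIn j) i + w j * δ j i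
    insert-punchIn zero w zero = sym (trans (+-identityˡ _) (*-identityʳ _))
    insert-punchIn zero w (suc i) = sym (trans (+-congˡ (zeroʳ _)) (+-identityʳ _))
    insert-punchIn {ℕ.suc n} (suc j) w zero = sym (trans (+-congˡ (zeroʳ _)) (+-identityʳ _))
    insert-punchIn {ℕ.suc n} (suc j) w (suc i) =
      trans (insert-punchIn j (w ∘ suc) i) (+-congˡ (*-congˡ (sym (δ-suc j i))))

    insert-δ : ∀ {n} j (i : Fin n) k → insert j (δ i) k ≡ δ (punchIn j i) k
    insert-δ zero i zero = refl
    insert-δ zero i (suc k) = sym (δ-suc i k)
    insert-δ (suc j) zero zero = refl
    insert-δ {ℕ.suc n} (suc j) zero (suc k) = insert-0 j k
      where
      insert-0 : ∀ {n} j k → insert {n} j (λ _ → 0#) k ≡ 0#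
      insert-0 zero zero = refl
      insert-0 zero (suc k) = refl
      insert-0 {ℕ.suc n} (suc j) zero = refl
      insert-0 {ℕ.suc n} (suc j) (suc k) = insert-0 j k
    insert-δ (suc j) (suc i) zero = refl
    insert-δ (suc j) (suc i) (suc k) = trans (insert-cong j (δ-suc i) k) (trans (insert-δ j i k) (sym (δ-suc (punchIn j i) k)))

    alternate : ∀ {n} (h : Fin (ℕ.suc n) → A) → (∀ j → h (suc j) + h (inject₁ j) ≡ 0#) →
                ∀ j → h j ≡ sgn j * h zero
    alternate h eq zero = sym (*-identityˡ _)
    alternate {ℕ.suc n} h eq (suc j) = trans (+-inverseˡ-unique _ _ (eq j))
      (trans (cong -_ (alternate (h ∘ inject₁) (λ i → eq (inject₁ i)) j)) (-‿distribˡ-* _ _))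

    punchIn-inject₁ : ∀ {n} (j : Fin n) → punchIn (inject₁ j) j ≡ suc j
    punchIn-inject₁ zero    = refl
    punchIn-inject₁ (suc j) = cong suc (punchIn-inject₁ j)

    punchIn-suc : ∀ {n} (j : Fin n) → punchIn (suc j) j ≡ inject₁ j
    punchIn-suc zero    = refl
    punchIn-suc (suc j) = cong suc (punchIn-suc j)

    punchIn-other : ∀ {n} (i j : Fin n) → i ≢ j → punchIn (inject₁ j) i ≡ punchIn (suc j) i
    punchIn-other zero    zero    i≢j = ⊥-elim (i≢j refl)
    punchIn-other (suc i) zero    i≢j = refl
    punchIn-other zero    (suc j) i≢j = refl
    punchIn-other (suc i) (suc j) i≢j = cong suc (punchIn-other i j (i≢j ∘ cong suc))

  -- The determinant is the only multilinear alternating function, up to its value at δ: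
  -- after expanding row 0 into unit vectors δ j, column j can be cleared in the other rows.
  opaque
    unfolding Det

    alternating-unique : ∀ {n} {F : Mat n → A} → Multilinear F → Alternating F → ∀ M → F M ≡ Det M * F δ
    alternating-unique {ℕ.zero} ml alt M = trans (resp ml λ ()) (sym (*-identityˡ _))
    alternating-unique {ℕ.suc n} {F} ml alt M = begin
      F M                                                       ≡⟨ resp ml (λ { zero k → sym (∑-δʳ k (M zero)) ; (suc i) k → refl }) ⟩
      F ((λ k → ∑ λ j → M zero j * δ j k) ◂ M ∘ suc)            ≡⟨ head-expand ml (M ∘ suc) (M zero) δ ⟩
      ∑ (λ j → M zero j * F (δ j ◂ M ∘ suc))                    ≡⟨ ∑-cong (λ j → cong (M zero j *_) (step j)) ⟩
      ∑ (λ j → M zero j * (Det (minor M j) * (sgn j * F δ)))    ≡⟨ ∑-cong (λ j → solve 4 (λ m d s f → m :* (d :* (s :* f)) := s :* m :* d :* f) refl (M zero j) (Det (minor M j)) (sgn j) (F δ)) ⟩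
      ∑ (λ j → sgn j * M zero j * Det (minor M j) * F δ)        ≡⟨ *-distribʳ-∑ (F δ) _ ⟨
      Det M * F δ                                               ∎
      where
      open ≡-Reasoning
      G : Fin (ℕ.suc n) → Mat n → A
      G j N = F (δ j ◂ λ i → insert j (N i))
      G-multilinear : ∀ j → Multilinear (G j)
      G-multilinear j .resp eq = resp (tail-multilinear ml (δ j)) λ i → insert-cong j (eq i)
      G-multilinear j .linear i c eq eq₁ eq₂ = linear (tail-multilinear ml (δ j)) i c
        (insert-linear j c eq) (λ k p → insert-cong j (eq₁ k p)) (λ k p → insert-cong j (eq₂ k p))
      G-alternating : ∀ j → Alternating (G j)
      G-alternating j i≢k eq = tail-alternating ml alt (δ j) i≢k (insert-cong j eq)
      h : Fin (ℕ.suc n) → A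
      h j = F (δ j ◂ λ i → δ (punchIn j i))
      h-swap : ∀ j → h (suc j) + h (inject₁ j) ≡ 0#
      -- The matrices for `suc j` and `inject₁ j` differ by the exchange of row zero and row
      -- `suc j`; this is the source of the alternating sign.
      h-swap j = swap-rows ml alt {zero} {suc j} (λ ())
        (λ k → cong (λ z → δ z k) (sym (punchIn-suc j)))
        (λ k → cong (λ z → δ z k) (punchIn-inject₁ j))
        (λ { zero 0≢0 _ → ⊥-elim (0≢0 refl)
           ; (suc l) _ l≢j k → cong (λ z → δ z k) (punchIn-other l j (l≢j ∘ cong suc)) })
      step : ∀ j → F (δ j ◂ M ∘ suc) ≡ Det (minor M j) * (sgn j * F δ)
      step j = begin
        F (δ j ◂ M ∘ suc)                 ≡⟨ clear-multiples (tail-multilinear ml (δ j)) (δ j)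
                                               (λ N i eq → alt {zero} {suc i} (λ ()) λ k → sym (eq k))
                                               (λ i → M (suc i) j) (λ i → insert-punchIn j (M (suc i))) ⟩
        G j (minor M j)                   ≡⟨ alternating-unique (G-multilinear j) (G-alternating j) (minor M j) ⟩
        Det (minor M j) * G j δ           ≡⟨ cong (Det (minor M j) *_) (trans
                                               (resp (tail-multilinear ml (δ j)) (insert-δ j))
                                               (trans (alternate h h-swap j) (cong (sgn j *_) (resp ml λ { zero k → refl ; (suc i) k → refl })))) ⟩
        Det (minor M j) * (sgn j * F δ)   ∎

  -- Products, intertwining matrices and block determinants

  infixl 7 _⊗_
  _⊗_ : ∀ {n m p} → (Fin n → Fin m → A) → (Fin m → Fin p → A) → Fin n → Fin p → A
  (M ⊗ N) i k = ∑ λ j → M i j * N j k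

  -- As a function of M the left side is multilinear and alternating, hence `Det M` times its value
  -- at `δ`, where the product is N.
  Det-⊗ : ∀ {n} (M N : Mat n) → Det (M ⊗ N) ≡ Det M * Det N
  Det-⊗ {n} M N = trans (alternating-unique ml alt M) (cong (Det M *_) (Det-cong λ i k → ∑-δˡ i λ j → N j k))
    where
    ml : Multilinear (λ M → Det (M ⊗ N))
    ml .resp eq = Det-cong λ i k → ∑-cong λ j → cong (_* N j k) (eq i j)
    ml .linear i c eq eq₁ eq₂ = linear Det-multilinear i c
      (λ k → trans
        (∑-cong λ j → trans (cong (_* N j k) (eq j))
          (solve 4 (λ a b c n → (a :+ c :* b) :* n := a :* n :+ c :* (b :* n)) refl _ _ c (N j k)))
        (∑-linear c _ _))
      (λ l p k → ∑-cong λ j → cong (_* N j k) (eq₁ l p j))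
      (λ l p k → ∑-cong λ j → cong (_* N j k) (eq₂ l p j))
    alt : Alternating (λ M → Det (M ⊗ N))
    alt i≢l eq = Det-alternating i≢l λ k → ∑-cong λ j → cong (_* N j k) (eq j)

  ⊗-assoc : ∀ {n m p q} (M : Fin n → Fin m → A) (N : Fin m → Fin p → A) (P : Fin p → Fin q → A) →
            ∀ i l → ((M ⊗ N) ⊗ P) i l ≡ (M ⊗ (N ⊗ P)) i l
  ⊗-assoc M N P i l = begin
    ∑ (λ k → ∑ (λ j → M i j * N j k) * P k l)   ≡⟨ ∑-cong (λ k → *-distribʳ-∑ (P k l) _) ⟩
    ∑ (λ k → ∑ λ j → M i j * N j k * P k l)     ≡⟨ ∑-comm _ ⟩
    ∑ (λ j → ∑ λ k → M i j * N j k * P k l)     ≡⟨ ∑-cong (λ j → trans (∑-cong λ k → *-assoc _ _ _) (sym (*-distribˡ-∑ (M i j) _))) ⟩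
    ∑ (λ j → M i j * ∑ λ k → N j k * P k l)     ∎
    where open ≡-Reasoning

  Regular : A → Set
  Regular c = ∀ {x} → c * x ≡ 0# → x ≡ 0#

  regular-* : ∀ {c d} → Regular c → Regular d → Regular (c * d)
  regular-* {c} {d} reg-c reg-d eq = reg-d (reg-c (trans (sym (*-assoc c d _)) eq))

  regular-cancel : ∀ {c} → Regular c → ∀ {x y} → c * x ≡ c * y → x ≡ y
  regular-cancel {c} reg {x} {y} eq = trans (sym (trans (+-congˡ (-‿inverseˡ y)) (+-identityʳ x)))
    (trans (sym (+-assoc x (- y) y)) (trans (+-congʳ (reg lemma)) (+-identityˡ y)))
    where
    lemma : c * (x + - y) ≡ 0#
    lemma = trans (distribˡ c x (- y)) (trans (cong₂ _+_ eq (sym (-‿distribʳ-* c y))) (-‿inverseʳ _))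

  Det-zero-column : ∀ {n} {M : Mat (ℕ.suc n)} → (∀ i → M i zero ≡ 0#) → Det M ≡ 0#
  Det-zero-column {n} {M} eq = trans (Det-suc M) (∑-zero (term n M eq))
    where
    term : ∀ n (M : Mat (ℕ.suc n)) → (∀ i → M i zero ≡ 0#) → ∀ j → sgn j * M zero j * Det (minor M j) ≡ 0#
    term n M eq zero = trans (*-congʳ (trans (*-congˡ (eq zero)) (zeroʳ _))) (zeroˡ _)
    term (ℕ.suc n) M eq (suc j) = trans (*-congˡ (Det-zero-column {M = minor M (suc j)} λ i → eq (suc i))) (zeroʳ _)

  Det-first-column : ∀ {n} (M : Mat (ℕ.suc n)) → (∀ i → M (suc i) zero ≡ 0#) → Det M ≡ M zero zero * Det (minor M zero)
  Det-first-column {n} M eq = begin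
    Det M                                                      ≡⟨ trans (Det-suc M) (∑-suc _) ⟩
    1# * M zero zero * Det (minor M zero) + ∑ (λ j → sgn (suc j) * M zero (suc j) * Det (minor M (suc j)))
                                                               ≡⟨ cong₂ _+_ (*-congʳ (*-identityˡ _)) (∑-zero (term n M eq)) ⟩
    M zero zero * Det (minor M zero) + 0#                      ≡⟨ +-identityʳ _ ⟩
    M zero zero * Det (minor M zero)                           ∎
    where
    open ≡-Reasoning
    term : ∀ n (M : Mat (ℕ.suc n)) → (∀ i → M (suc i) zero ≡ 0#) → ∀ j → sgn (suc j) * M zero (suc j) * Det (minor M (suc j)) ≡ 0#
    term (ℕ.suc n) M eq j = trans (*-congˡ (Det-zero-column {M = minor M (suc j)} eq)) (zeroʳ _)

  Det-first-row : ∀ {n} (M : Mat (ℕ.suc n)) → (∀ j → M zero (suc j) ≡ 0#) → Det M ≡ M zero zero * Det (minor M zero)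
  Det-first-row {n} M eq = begin
    Det M                                                      ≡⟨ trans (Det-suc M) (∑-suc _) ⟩
    1# * M zero zero * Det (minor M zero) + ∑ (λ j → sgn (suc j) * M zero (suc j) * Det (minor M (suc j)))
                                                               ≡⟨ cong₂ _+_ (*-congʳ (*-identityˡ _)) (∑-zero λ j → trans (*-congʳ (trans (*-congˡ (eq j)) (zeroʳ _))) (zeroˡ _)) ⟩
    M zero zero * Det (minor M zero) + 0#                      ≡⟨ +-identityʳ _ ⟩
    M zero zero * Det (minor M zero)                           ∎
    where open ≡-Reasoning

  Det-δ : ∀ n → Det (δ {n}) ≡ 1#
  Det-δ ℕ.zero = Det-empty _
  Det-δ (ℕ.suc n) = trans (Det-first-column (δ {ℕ.suc n}) λ i → refl) (trans (*-identityˡ _) (trans (Det-cong {n} δ-suc) (Det-δ n)))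

  ∏ : ∀ {n} → (Fin n → A) → A
  ∏ {ℕ.zero} f = 1#
  ∏ {ℕ.suc n} f = f zero * ∏ (f ∘ suc)

  ∏-cong : ∀ {n} {f g : Fin n → A} → (∀ i → f i ≡ g i) → ∏ f ≡ ∏ g
  ∏-cong {ℕ.zero} eq = refl
  ∏-cong {ℕ.suc n} eq = cong₂ _*_ (eq zero) (∏-cong (eq ∘ suc))

  ∏-regular : ∀ {n} {f : Fin n → A} → (∀ i → Regular (f i)) → Regular (∏ f)
  ∏-regular {ℕ.zero} reg eq = trans (sym (*-identityˡ _)) eq
  ∏-regular {ℕ.suc n} reg = regular-* (reg zero) (∏-regular (reg ∘ suc))

  Det-lower : ∀ {n} (M : Mat n) → (∀ {i j} → i Fin.< j → M i j ≡ 0#) → Det M ≡ ∏ λ i → M i i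
  Det-lower {ℕ.zero} M lower = Det-empty M
  Det-lower {ℕ.suc n} M lower = trans (Det-first-row M λ j → lower (ℕ.s≤s ℕ.z≤n))
    (*-congˡ (Det-lower (minor M zero) λ i<j → lower (ℕ.s≤s i<j)))

  Det-scalar-regular : ∀ {n} {c} → Regular c → Regular (Det λ i k → c * δ {n} i k)
  Det-scalar-regular {n} {c} reg {x} eq = ∏-regular {n} (λ i → subst Regular (sym (trans (*-congˡ (δ-refl i)) (*-identityʳ c))) reg)
    (trans (*-congʳ (sym (Det-lower (λ i k → c * δ {n} i k) λ {i} {j} i<j → trans (*-congˡ (δ-≢ {i = i} {j} λ { refl → ℕ.n≮n _ i<j })) (zeroʳ c)))) eq)

  -- Replaces conjugation where P has no inverse over the ring: `Det P * Det Q` is the determinant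
  -- of a regular scalar matrix, so it can be cancelled from both sides. The sizes are related by an
  -- equation because the two index sets are ordered as different products.
  Det-intertwine : ∀ {n n′} → n ≡ n′ → (M : Mat n′) (E : Mat n) (P : Fin n → Fin n′ → A) (Q : Fin n′ → Fin n → A) →
    ∀ {c} → Regular c → (∀ i j → (P ⊗ M) i j ≡ (E ⊗ P) i j) → (∀ i j → (P ⊗ Q) i j ≡ c * δ i j) →
    Det M ≡ Det E
  Det-intertwine {n} refl M E P Q {c} reg PM≡EP PQ≡c = regular-cancel (Det-scalar-regular {n} reg) (begin
    Det (λ i k → c * δ {n} i k) * Det M    ≡⟨ *-congʳ (trans (sym (Det-cong PQ≡c)) (Det-⊗ P Q)) ⟩
    Det P * Det Q * Det M              ≡⟨ solve 3 (λ p q m → p :* q :* m := q :* (p :* m)) refl (Det P) (Det Q) (Det M) ⟩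
    Det Q * (Det P * Det M)            ≡⟨ *-congˡ (trans (sym (Det-⊗ P M)) (trans (Det-cong {M = P ⊗ M} PM≡EP) (Det-⊗ E P))) ⟩
    Det Q * (Det E * Det P)            ≡⟨ solve 3 (λ p q m → q :* (m :* p) := p :* q :* m) refl (Det P) (Det Q) (Det E) ⟩
    Det P * Det Q * Det E              ≡⟨ *-congʳ (trans (sym (Det-⊗ P Q)) (Det-cong PQ≡c)) ⟩
    Det (λ i k → c * δ {n} i k) * Det E    ∎)
    where open ≡-Reasoning

  1-regular : Regular 1#
  1-regular eq = trans (sym (*-identityˡ _)) eq

  Det-reindex : ∀ {n n′} (π : Fin n ↔ Fin n′) (M : Mat n′) →
                Det (λ i j → M (Inverse.to π i) (Inverse.to π j)) ≡ Det M
  Det-reindex π M = sym (Det-intertwine (↔⇒≡ π) M (λ i j → M (to i) (to j)) (λ i j → δ (to i) j) (λ i j → δ i (to j)) 1-regular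
    (λ i j → trans (∑-δˡ (to i) (λ k → M k j)) (sym (trans
      (∑-cong λ k → *-congˡ {M (to i) (to k)} (δ-sym (to k) j))
      (trans (sym (∑-permute (λ k → M (to i) k * δ j k) π)) (trans (∑-cong λ k → *-congˡ {M (to i) k} (δ-sym j k)) (∑-δʳ j (M (to i))))))))
    (λ i j → trans (∑-δˡ (to i) (λ k → δ k (to j))) (trans (δ-injective to to-injective i j) (sym (*-identityˡ _)))))
    where
    to = Inverse.to π
    to-injective : ∀ {i j} → to i ≡ to j → i ≡ j
    to-injective {i} {j} eq = trans (sym (Inverse.strictlyInverseʳ π i)) (trans (cong (Inverse.from π) eq) (Inverse.strictlyInverseʳ π j))

  Det-lower-block : ∀ p {q} {M : Mat (p ℕ.+ q)} → (∀ i j → M (i ↑ˡ q) (p ↑ʳ j) ≡ 0#) →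
    Det M ≡ Det (λ i j → M (i ↑ˡ q) (j ↑ˡ q)) * Det (λ i j → M (p ↑ʳ i) (p ↑ʳ j))
  Det-lower-block ℕ.zero eq = sym (trans (*-congʳ (Det-empty _)) (*-identityˡ _))
  Det-lower-block (ℕ.suc p) {q} {M} eq = begin
    Det M                                                                     ≡⟨ trans (Det-suc M) (∑-↑ (ℕ.suc p) _) ⟩
    ∑ (λ j → sgn (j ↑ˡ q) * M zero (j ↑ˡ q) * Det (minor M (j ↑ˡ q))) +
      ∑ (λ j → sgn (ℕ.suc p ↑ʳ j) * M zero (ℕ.suc p ↑ʳ j) * Det (minor M (ℕ.suc p ↑ʳ j)))
                                                                              ≡⟨ cong₂ _+_ (∑-cong left) (∑-zero λ j → trans (*-congʳ (trans (*-congˡ (eq zero j)) (zeroʳ _))) (zeroˡ _)) ⟩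
    ∑ (λ j → sgn j * X zero j * Det (minor X j) * Det Z) + 0#                 ≡⟨ +-identityʳ _ ⟩
    ∑ (λ j → sgn j * X zero j * Det (minor X j) * Det Z)                      ≡⟨ trans (*-congʳ (Det-suc X)) (*-distribʳ-∑ (Det Z) _) ⟨
    Det X * Det Z                                                             ∎
    where
    open ≡-Reasoning
    X : Mat (ℕ.suc p)
    X i j = M (i ↑ˡ q) (j ↑ˡ q)
    Z : Mat q
    Z i j = M (ℕ.suc p ↑ʳ i) (ℕ.suc p ↑ʳ j)
    sgn-↑ˡ : ∀ {n} (j : Fin n) → sgn (j ↑ˡ q) ≡ sgn j
    sgn-↑ˡ zero = refl
    sgn-↑ˡ (suc j) = cong -_ (sgn-↑ˡ j)
    punchIn-↑ˡ : ∀ {n} (j : Fin (ℕ.suc n)) k → punchIn (j ↑ˡ q) (k ↑ˡ q) ≡ punchIn j k ↑ˡ q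
    punchIn-↑ˡ zero k = refl
    punchIn-↑ˡ (suc j) zero = refl
    punchIn-↑ˡ (suc j) (suc k) = cong suc (punchIn-↑ˡ j k)
    punchIn-↑ʳ : ∀ n (j : Fin (ℕ.suc n)) (k : Fin q) → punchIn (j ↑ˡ q) (n ↑ʳ k) ≡ ℕ.suc n ↑ʳ k
    punchIn-↑ʳ n zero k = refl
    punchIn-↑ʳ (ℕ.suc n) (suc j) k = cong suc (punchIn-↑ʳ n j k)
    left : ∀ j → sgn (j ↑ˡ q) * M zero (j ↑ˡ q) * Det (minor M (j ↑ˡ q)) ≡ sgn j * X zero j * Det (minor X j) * Det Z
    left j = begin
      sgn (j ↑ˡ q) * M zero (j ↑ˡ q) * Det (minor M (j ↑ˡ q)) ≡⟨ cong₂ (λ s d → s * X zero j * d) (sgn-↑ˡ j) (Det-lower-block p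
                                                                    λ i k → trans (cong (M (suc i ↑ˡ q)) (punchIn-↑ʳ p j k)) (eq (suc i) k)) ⟩
      sgn j * X zero j * (Det (λ i k → minor M (j ↑ˡ q) (i ↑ˡ q) (k ↑ˡ q)) * Det (λ i k → minor M (j ↑ˡ q) (p ↑ʳ i) (p ↑ʳ k)))
                                                               ≡⟨ cong (sgn j * X zero j *_) (cong₂ _*_ (Det-cong {N = minor X j} λ i k → cong (M (suc i ↑ˡ q)) (punchIn-↑ˡ j k))
                                                                    (Det-cong λ i k → cong (M (ℕ.suc p ↑ʳ i)) (punchIn-↑ʳ p j k))) ⟩
      sgn j * X zero j * (Det (minor X j) * Det Z)             ≡⟨ *-assoc _ _ _ ⟨
      sgn j * X zero j * Det (minor X j) * Det Z               ∎

  Det-block-lower : ∀ p {q} (M : Mat (p ℕ.* q)) →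
    (∀ {s t} i j → s Fin.< t → M (combine {p} {q} s i) (combine {p} {q} t j) ≡ 0#) →
    Det M ≡ ∏ {p} (λ s → Det {q} (λ i j → M (combine s i) (combine s j)))
  Det-block-lower ℕ.zero M lower = Det-empty M
  Det-block-lower (ℕ.suc p) {q} M lower = trans
    (Det-lower-block q λ i k → trans
      (cong (λ x → M (i ↑ˡ (p ℕ.* q)) (q ↑ʳ x)) (sym (combine-remQuot {p} q k)))
      (lower {zero} {suc (proj₁ (remQuot {p} q k))} i (proj₂ (remQuot {p} q k)) (ℕ.s≤s ℕ.z≤n)))
    (*-congˡ (Det-block-lower p (λ i j → M (q ↑ʳ i) (q ↑ʳ j)) λ i j s<t → lower {suc _} {suc _} i j (ℕ.s≤s s<t)))

  Det-block-diagonal : ∀ p {q} (M : Mat (p ℕ.* q)) (E : Fin p → Mat q) →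
    (∀ s i t j → M (combine s i) (combine t j) ≡ δ s t * E s i j) → Det M ≡ ∏ (λ s → Det (E s))
  Det-block-diagonal p M E eq = trans
    (Det-block-lower p M λ {s} {t} i j s<t → trans (eq s i t j)
      (trans (*-congʳ (δ-≢ {i = s} {t} λ { refl → ℕ.n≮n _ s<t })) (zeroˡ _)))
    (∏-cong λ s → Det-cong λ i j → trans (eq s i s j) (trans (*-congʳ (δ-refl s)) (*-identityˡ _)))

  -- The matrix determinant lemma, from the bordered matrix X = (1, -vᵀ; u, M), whose
  -- determinant is that of M + u vᵀ, and the product (d, vᵀ N; 0, 1) X = (d + vᵀ N u, 0; u, M).
  Det-rank-one : ∀ {n} (M N : Mat n) (u v : Fin n → A) d → (∀ i j → (N ⊗ M) i j ≡ d * δ i j) →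
    d * Det (λ i j → M i j + u i * v j) ≡ (d + ∑ (λ i → v i * ∑ λ j → N i j * u j)) * Det M
  Det-rank-one {n} M N u v d NM≡d = begin
    d * Det (λ i j → M i j + u i * v j)            ≡⟨ *-congˡ (sym Det-X) ⟩
    d * Det X                                      ≡⟨ *-congʳ Det-Y ⟨
    Det Y * Det X                                  ≡⟨ Det-⊗ Y X ⟨
    Det (Y ⊗ X)                                    ≡⟨ Det-first-row (Y ⊗ X) YX-row ⟩
    (Y ⊗ X) zero zero * Det (minor (Y ⊗ X) zero)   ≡⟨ cong₂ _*_ YX-corner (Det-cong YX-minor) ⟩
    (d + ∑ (λ i → v i * ∑ λ j → N i j * u j)) * Det M ∎
    where
    open ≡-Reasoning
    X Y Z : Mat (ℕ.suc n)
    X zero    zero    = 1#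
    X zero    (suc j) = - v j
    X (suc i) zero    = u i
    X (suc i) (suc j) = M i j
    Y zero    zero    = d
    Y zero    (suc j) = ∑ λ i → v i * N i j
    Y (suc i) zero    = 0#
    Y (suc i) (suc j) = δ i j
    Z zero    zero    = 1#
    Z zero    (suc j) = v j
    Z (suc i) zero    = 0#
    Z (suc i) (suc j) = δ i j
    Det-unit : ∀ (V : Mat (ℕ.suc n)) → (∀ i → V (suc i) zero ≡ 0#) → (∀ i j → V (suc i) (suc j) ≡ δ i j) → Det V ≡ V zero zero
    Det-unit V V₀ V₁ = trans (Det-first-column V V₀) (trans (*-congˡ (trans (Det-cong V₁) (Det-δ n))) (*-identityʳ _))
    Det-Y : Det Y ≡ d
    Det-Y = Det-unit Y (λ i → refl) (λ i j → refl)
    Det-X : Det X ≡ Det (λ i j → M i j + u i * v j)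
    Det-X = begin
      Det X                                    ≡⟨ *-identityʳ _ ⟨
      Det X * 1#                               ≡⟨ *-congˡ (Det-unit Z (λ i → refl) (λ i j → refl)) ⟨
      Det X * Det Z                            ≡⟨ Det-⊗ X Z ⟨
      Det (X ⊗ Z)                              ≡⟨ Det-first-row (X ⊗ Z) (λ j → trans (∑-suc _) (trans (cong₂ _+_ (*-identityˡ (v j)) (∑-δʳ j (λ k → - v k))) (-‿inverseʳ (v j)))) ⟩
      (X ⊗ Z) zero zero * Det (minor (X ⊗ Z) zero)
        ≡⟨ cong₂ _*_
             (trans (∑-suc _) (trans (cong₂ _+_ (*-identityˡ 1#) (∑-zero λ k → zeroʳ _)) (+-identityʳ 1#)))
             (Det-cong λ i j → trans (∑-suc _) (trans (+-comm _ _) (+-congʳ (∑-δʳ j (M i))))) ⟩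
      1# * Det (λ i j → M i j + u i * v j)     ≡⟨ *-identityˡ _ ⟩
      Det (λ i j → M i j + u i * v j)          ∎
    YX-row : ∀ j → (Y ⊗ X) zero (suc j) ≡ 0#
    YX-row j = begin
      (Y ⊗ X) zero (suc j)                                    ≡⟨ ∑-suc _ ⟩
      d * - v j + ∑ (λ k → ∑ (λ i → v i * N i k) * M k j)     ≡⟨ +-congˡ (⊗-assoc {1} (λ _ → v) N M zero j) ⟩
      d * - v j + ∑ (λ i → v i * (N ⊗ M) i j)                 ≡⟨ +-congˡ (∑-cong λ i → trans (*-congˡ (NM≡d i j)) (solve 3 (λ v d e → v :* (d :* e) := d :* (v :* e)) refl (v i) d (δ i j))) ⟩
      d * - v j + ∑ (λ i → d * (v i * δ i j))                 ≡⟨ cong₂ _+_ (sym (-‿distribʳ-* d (v j))) (trans (sym (*-distribˡ-∑ d _)) (*-congˡ (∑-δʳ j v))) ⟩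
      - (d * v j) + d * v j                                   ≡⟨ -‿inverseˡ _ ⟩
      0#                                                      ∎
    YX-corner : (Y ⊗ X) zero zero ≡ d + ∑ (λ i → v i * ∑ λ j → N i j * u j)
    YX-corner = trans (∑-suc _) (cong₂ _+_ (*-identityʳ d) (⊗-assoc {1} {q = 1} (λ _ → v) N (λ i _ → u i) zero zero))
    YX-minor : ∀ i j → minor (Y ⊗ X) zero i j ≡ M i j
    YX-minor i j = trans (∑-suc _) (trans (cong₂ _+_ (zeroˡ _) (∑-δˡ i (λ k → M k j))) (+-identityˡ _))

  module _ {S : Set} (P : (S → A) → Set)
    (P-resp : ∀ {f g} → (∀ s → f s ≡ g s) → P f → P g)
    (P-0 : P (λ _ → 0#)) (P-1 : P (λ _ → 1#))
    (P-+ : ∀ {f g} → P f → P g → P (λ s → f s + g s))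
    (P-* : ∀ {f g} → P f → P g → P (λ s → f s * g s))
    (P-neg : ∀ {f} → P f → P (λ s → - f s)) where

    ∑-closed : ∀ {n} {f : S → Fin n → A} → (∀ i → P (λ s → f s i)) → P (λ s → ∑ (f s))
    ∑-closed {ℕ.zero}  Pf = P-resp (λ s → sym (∑-empty _)) P-0
    ∑-closed {ℕ.suc n} Pf = P-resp (λ s → sym (∑-suc _)) (P-+ (Pf zero) (∑-closed (Pf ∘ suc)))

    -- A determinant is a polynomial in its entries, so it inherits every property stable under the
    -- ring operations. It serves for combinations of characters, with S the field, and for
    -- congruences, with S = `Bool` indexing the two sides.
    Det-closed : ∀ {n} {M : S → Mat n} → (∀ i j → P (λ s → M s i j)) → P (λ s → Det (M s))
    Det-closed {ℕ.zero}  PM = P-resp (λ s → sym (Det-empty _)) P-1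
    Det-closed {ℕ.suc n} PM = P-resp (λ s → sym (Det-suc _)) (∑-closed λ j → P-* (P-* (P-sgn j) (PM zero j)) (Det-closed λ i k → PM (suc i) (punchIn j k)))
      where
      P-sgn : ∀ {n} (j : Fin n) → P (λ _ → sgn j)
      P-sgn zero    = P-1
      P-sgn (suc j) = P-neg (P-sgn j)

-- Determinants under ring homomorphisms

record Homomorphism (S T : StrictRing) : Set where
  module S = StrictRing S
  module T = StrictRing T
  field
    ⟦_⟧ : S.A → T.A
    0-homo : ⟦ S.0# ⟧ ≡ T.0#
    1-homo : ⟦ S.1# ⟧ ≡ T.1#
    +-homo : ∀ x y → ⟦ x S.+ y ⟧ ≡ ⟦ x ⟧ T.+ ⟦ y ⟧
    *-homo : ∀ x y → ⟦ x S.* y ⟧ ≡ ⟦ x ⟧ T.* ⟦ y ⟧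
    neg-homo : ∀ x → ⟦ S.- x ⟧ ≡ T.- ⟦ x ⟧

  module DS = Determinant S
  module DT = Determinant T

  ∑-homo : ∀ {n} (f : Fin n → S.A) → ⟦ DS.∑ f ⟧ ≡ DT.∑ (λ i → ⟦ f i ⟧)
  ∑-homo {ℕ.zero}  f = trans (cong ⟦_⟧ (DS.∑-empty f)) (trans 0-homo (sym (DT.∑-empty _)))
  ∑-homo {ℕ.suc n} f = trans (cong ⟦_⟧ (DS.∑-suc f))
    (trans (+-homo _ _) (trans (cong (⟦ f zero ⟧ T.+_) (∑-homo (f ∘ suc))) (sym (DT.∑-suc _))))

  Det-homo : ∀ {n} (M : DS.Mat n) → ⟦ DS.Det M ⟧ ≡ DT.Det (λ i j → ⟦ M i j ⟧)
  Det-homo {ℕ.zero}  M = trans (cong ⟦_⟧ (DS.Det-empty M)) (trans 1-homo (sym (DT.Det-empty _)))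
  Det-homo {ℕ.suc n} M = trans (cong ⟦_⟧ (DS.Det-suc M)) (trans (trans (∑-homo _) (DT.∑-cong λ j → trans (*-homo _ _)
    (cong₂ T._*_ (trans (*-homo _ _) (cong (T._* ⟦ M zero j ⟧) (sgn-homo j))) (Det-homo (DS.minor M j))))) (sym (DT.Det-suc _)))
    where
    sgn-homo : ∀ {n} (j : Fin n) → ⟦ DS.sgn j ⟧ ≡ DT.sgn j
    sgn-homo zero    = 1-homo
    sgn-homo (suc j) = trans (neg-homo _) (cong T.-_ (sgn-homo j))

-- Group matrices of affine groups

-- An enumeration of a finite field: index zero is 0#, and the indices suc h
-- carry the multiplication _·_ of the unit group.
record UnitGroup {m : ℕ} (F : FiniteField (ℕ.suc m)) : Set where
  open FiniteField F
  infixl 7 _·_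
  field
    points      : Fin (ℕ.suc m) ↔ Carrier
    _·_         : Fin m → Fin m → Fin m
    inv         : Fin m → Fin m

  point : Fin (ℕ.suc m) → Carrier
  point = Inverse.to points

  unit : Fin m → Carrier
  unit h = point (suc h)

  field
    point-zero : point zero ≡ 0#
    unit-·     : ∀ h k → unit (h · k) ≡ unit h * unit k
    unit-inv   : ∀ h → unit (inv h) * unit h ≡ 1#

  point-injective : ∀ {i j} → point i ≡ point j → i ≡ j
  point-injective {i} {j} eq = trans (sym (Inverse.strictlyInverseʳ points i))
    (trans (cong (Inverse.from points) eq) (Inverse.strictlyInverseʳ points j))

  unit-injective : ∀ {h k} → unit h ≡ unit k → h ≡ k
  unit-injective = suc-injective ∘ point-injective

  unit≢0 : ∀ h → unit h ≢ 0#
  unit≢0 h eq with () ← point-injective (trans eq (sym point-zero))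

  private
    log′ : ∀ {x} i → point i ≡ x → x ≢ 0# → Fin m
    log′ zero    eq x≢0 = ⊥-elim (x≢0 (trans (sym eq) point-zero))
    log′ (suc h) eq x≢0 = h

    unit-log′ : ∀ {x} i (eq : point i ≡ x) (x≢0 : x ≢ 0#) → unit (log′ i eq x≢0) ≡ x
    unit-log′ zero    eq x≢0 = ⊥-elim (x≢0 (trans (sym eq) point-zero))
    unit-log′ (suc h) eq x≢0 = eq

  log : ∀ x → x ≢ 0# → Fin m
  log x = log′ (Inverse.from points x) (Inverse.strictlyInverseˡ points x)

  unit-log : ∀ x (x≢0 : x ≢ 0#) → unit (log x x≢0) ≡ x
  unit-log x = unit-log′ (Inverse.from points x) (Inverse.strictlyInverseˡ points x)

  log-unique : ∀ {x h} (x≢0 : x ≢ 0#) → unit h ≡ x → log x x≢0 ≡ h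
  log-unique {x} x≢0 eq = unit-injective (trans (unit-log x x≢0) (sym eq))

  fieldRing : StrictRing
  fieldRing = record { isCommutativeRing = isCommutativeRing }

  open Determinant fieldRing using (solve; _:=_; _:+_; _:*_; con)

  ·-cancel : ∀ h k → (h · k) · inv k ≡ h
  ·-cancel h k = unit-injective (begin
    unit ((h · k) · inv k)          ≡⟨ trans (unit-· _ _) (cong (_* unit (inv k)) (unit-· h k)) ⟩
    unit h * unit k * unit (inv k)  ≡⟨ solve 3 (λ h k i → h :* k :* i := i :* k :* h) refl (unit h) (unit k) (unit (inv k)) ⟩
    unit (inv k) * unit k * unit h  ≡⟨ cong (_* unit h) (unit-inv k) ⟩
    1# * unit h                     ≡⟨ *-identityˡ _ ⟩
    unit h                          ∎)
    where open ≡-Reasoning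

  inv-cancel : ∀ h k → (h · inv k) · k ≡ h
  inv-cancel h k = unit-injective (begin
    unit ((h · inv k) · k)            ≡⟨ trans (unit-· _ _) (cong (_* unit k) (unit-· h (inv k))) ⟩
    unit h * unit (inv k) * unit k    ≡⟨ *-assoc _ _ _ ⟩
    unit h * (unit (inv k) * unit k)  ≡⟨ cong (unit h *_) (unit-inv k) ⟩
    unit h * 1#                       ≡⟨ *-identityʳ _ ⟩
    unit h                            ∎)
    where open ≡-Reasoning

  unit-inv-unique : ∀ h {x} → x * unit h ≡ 1# → unit (inv h) ≡ x
  unit-inv-unique h {x} eq = begin
    unit (inv h)                   ≡⟨ *-identityˡ _ ⟨
    1# * unit (inv h)              ≡⟨ cong (_* unit (inv h)) eq ⟨
    x * unit h * unit (inv h)      ≡⟨ solve 3 (λ x h i → x :* h :* i := i :* h :* x) refl x (unit h) (unit (inv h)) ⟩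
    unit (inv h) * unit h * x      ≡⟨ cong (_* x) (unit-inv h) ⟩
    1# * x                         ≡⟨ *-identityˡ _ ⟩
    x                              ∎
    where open ≡-Reasoning

  unit-inv-·-inv : ∀ h k → unit (inv (h · inv k)) ≡ unit (inv h) * unit k
  unit-inv-·-inv h k = unit-inv-unique _ (begin
    unit (inv h) * unit k * unit (h · inv k)          ≡⟨ cong (unit (inv h) * unit k *_) (unit-· h (inv k)) ⟩
    unit (inv h) * unit k * (unit h * unit (inv k))   ≡⟨ solve 4 (λ i k h j → i :* k :* (h :* j) := (i :* h) :* (j :* k)) refl (unit (inv h)) (unit k) (unit h) (unit (inv k)) ⟩
    unit (inv h) * unit h * (unit (inv k) * unit k)   ≡⟨ cong₂ _*_ (unit-inv h) (unit-inv k) ⟩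
    1# * 1#                                           ≡⟨ *-identityˡ _ ⟩
    1#                                                ∎)
    where open ≡-Reasoning

  quotient-translate : ∀ r r′ t → (r · inv t) · inv (r′ · inv t) ≡ r · inv r′
  quotient-translate r r′ t = unit-injective (begin
    unit ((r · inv t) · inv (r′ · inv t))                      ≡⟨ trans (unit-· _ _) (cong₂ _*_ (unit-· r (inv t)) (unit-inv-·-inv r′ t)) ⟩
    unit r * unit (inv t) * (unit (inv r′) * unit t)           ≡⟨ solve 4 (λ r i j t → r :* i :* (j :* t) := i :* t :* (r :* j)) refl (unit r) (unit (inv t)) (unit (inv r′)) (unit t) ⟩
    unit (inv t) * unit t * (unit r * unit (inv r′))           ≡⟨ cong₂ _*_ (unit-inv t) (sym (unit-· r (inv r′))) ⟩
    1# * unit (r · inv r′)                                     ≡⟨ *-identityˡ _ ⟩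
    unit (r · inv r′)                                          ∎)
    where open ≡-Reasoning

  translation : Fin m → Fin m ↔ Fin m
  translation t = mk↔ₛ′ (_· inv t) (_· t) (λ h → ·-cancel h t) (λ h → inv-cancel h t)

  open GeneralAffine F hiding (_∙_; ε; inv)

  aff : Fin m → Carrier → Affine
  aff h b = affine (unit h) b (unit≢0 h)

  -- An enumeration by pairs of a unit and a field element, which turns sums over the group into
  -- double sums over H and K.
  affines : Fin (m ℕ.* ℕ.suc m) ↔ Affine
  affines = mk↔ₛ′ to from to-from from-to
    where
    to : Fin (m ℕ.* ℕ.suc m) → Affine
    to i = aff (proj₁ (remQuot {m} (ℕ.suc m) i)) (point (proj₂ (remQuot {m} (ℕ.suc m) i)))
    from : Affine → Fin (m ℕ.* ℕ.suc m)
    from g = combine (log (Affine.a g) (Affine.a≢0 g)) (Inverse.from points (Affine.b g))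
    to-from : ∀ g → to (from g) ≡ g
    to-from g = trans
      (cong (λ p → aff (proj₁ p) (point (proj₂ p))) (remQuot-combine (log (Affine.a g) (Affine.a≢0 g)) (Inverse.from points (Affine.b g))))
      (affine-≡ (unit-log _ (Affine.a≢0 g)) (Inverse.strictlyInverseˡ points _))
    from-to : ∀ i → from (to i) ≡ i
    from-to i = trans (cong₂ combine (log-unique _ refl) (Inverse.strictlyInverseʳ points _)) (combine-remQuot {m} (ℕ.suc m) i)

record AdditiveCharacter {m : ℕ} (F : FiniteField (ℕ.suc m)) (U : UnitGroup F) (S : StrictRing) : Set where
  open FiniteField F using (Carrier) renaming (_+_ to _+ᴷ_; _*_ to _*ᴷ_; 0# to 0ᴷ)
  open StrictRing S
  open Determinant S using (∑)
  field
    ψ            : Carrier → A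
    ψ-0          : ψ 0ᴷ ≡ 1#
    ψ-+          : ∀ x y → ψ (x +ᴷ y) ≡ ψ x * ψ y
    ψ-orthogonal : ∀ {s} → s ≢ 0ᴷ → ∑ (λ b → ψ (s *ᴷ UnitGroup.point U b)) ≡ 0#

module Factorisation
  {m : ℕ} (F : FiniteField (ℕ.suc m)) (U : UnitGroup F) (S : StrictRing) (χ : AdditiveCharacter F U S)
  (order-regular : Determinant.Regular S (Determinant.∑ S {ℕ.suc m} λ _ → StrictRing.1# S))
  where

  open FiniteField F using () renaming (Carrier to K; _+_ to _+ᴷ_; _*_ to _*ᴷ_; -_ to -ᴷ_; 0# to 0ᴷ; 1# to 1ᴷ)
  open StrictRing S
  open AdditiveCharacter χ
  open UnitGroup U
  open GeneralAffine F hiding (inv)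
  open Affine
  private
    module K = Determinant fieldRing
    module F = FiniteField F
    inverseᴳ : Affine → Affine
    inverseᴳ = GeneralAffine.inv F
  open Determinant S

  q : A
  q = ∑ {ℕ.suc m} λ _ → 1#

  -- Right translation by g permutes the group. This is the substitution that moves g out of α(x
  -- g⁻¹).
  ∑-affine : ∀ {n} (e : Fin n ↔ Affine) (g : Affine) (f : Affine → A) →
             ∑ (λ i → f (Inverse.to e i)) ≡ ∑ (λ h → ∑ λ b → f (aff h (point b) ∙ g))
  ∑-affine e g f = begin
    ∑ (λ i → f (Inverse.to e i))                      ≡⟨ ∑-permute _ (↔-sym e ↔-∘ (right-mult ↔-∘ affines)) ⟩
    ∑ (λ i → f (Inverse.to e (Inverse.from e (Inverse.to affines i ∙ g)))) ≡⟨ ∑-cong (λ i → cong f (Inverse.strictlyInverseˡ e _)) ⟩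
    ∑ (λ i → f (Inverse.to affines i ∙ g))            ≡⟨ ∑-combine m (ℕ.suc m) _ ⟩
    ∑ (λ h → ∑ λ b → f (Inverse.to affines (combine h b) ∙ g))
      ≡⟨ ∑-cong (λ h → ∑-cong λ b → cong (λ p → f (aff (proj₁ p) (point (proj₂ p)) ∙ g)) (remQuot-combine h b)) ⟩
    ∑ (λ h → ∑ λ b → f (aff h (point b) ∙ g))         ∎
    where
    open ≡-Reasoning
    open IsGroup Affine-isGroup using (assoc; inverseˡ; inverseʳ; identityʳ)
    right-mult : Affine ↔ Affine
    right-mult = mk↔ₛ′ (_∙ g) (_∙ inverseᴳ g)
      (λ x → trans (assoc x (inverseᴳ g) g) (trans (cong (x ∙_) (inverseˡ g)) (identityʳ x)))
      (λ x → trans (assoc x g (inverseᴳ g)) (trans (cong (x ∙_) (inverseʳ g)) (identityʳ x)))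

  -- The matrix of α acting on the representation induced from the character b ↦ ψ (s b).
  E : (Affine → A) → K → Mat m
  E α s r r′ = ∑ λ b → ψ (s *ᴷ (unit (inv r) *ᴷ point b)) * α (aff (r · inv r′) (point b))

  Det-E-translate : ∀ α t → Det (E α (unit t)) ≡ Det (E α 1ᴷ)
  Det-E-translate α t = trans
    (Det-cong λ r r′ → ∑-cong λ b → cong₂ (λ x h → ψ x * α (aff h (point b)))
      (trans
        (K.solve 3 (λ t i b → t K.:* (i K.:* b) K.:= K.con 1 K.:* ((i K.:* t) K.:* b)) refl (unit t) (unit (inv r)) (point b))
        (cong (λ x → 1ᴷ *ᴷ (x *ᴷ point b)) (sym (unit-inv-·-inv r t))))
      (sym (quotient-translate r r′ t)))
    (Det-reindex (translation t) (E α 1ᴷ))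

  E-zero : ∀ α r r′ → E α 0ᴷ r r′ ≡ ∑ (λ b → α (aff (r · inv r′) (point b)))
  E-zero α r r′ = ∑-cong λ b → trans (*-congʳ (trans (cong ψ (F.zeroˡ _)) ψ-0)) (*-identityˡ _)

  module _ {n : ℕ} (e : Fin n ↔ Affine) (α : Affine → A) where

    private
      at : Fin n → Affine
      at = Inverse.to e

      logᴳ : Affine → Fin m
      logᴳ g = log (a g) (a≢0 g)

      phase : Fin (ℕ.suc m) → Fin m → K → K
      phase s r b = point s *ᴷ (unit (inv r) *ᴷ b)

      row : Fin (ℕ.suc m ℕ.* m) → Fin (ℕ.suc m) × Fin m
      row = remQuot m

      -- The Fourier matrix: row (s, r) is supported on the coset a = r, where it is the character b
      -- ↦ ψ(s r⁻¹ b). Its partner `p⁻` is the transpose with the inverse character.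
      p : Fin (ℕ.suc m) × Fin m → Affine → A
      p (s , r) g = δ r (logᴳ g) * ψ (phase s r (b g))

      p⁻ : Affine → Fin (ℕ.suc m) × Fin m → A
      p⁻ g (s , r) = δ r (logᴳ g) * ψ (-ᴷ phase s r (b g))

      P : Fin (ℕ.suc m ℕ.* m) → Fin n → A
      P x i = p (row x) (at i)

      Q : Fin n → Fin (ℕ.suc m ℕ.* m) → A
      Q i x = p⁻ (at i) (row x)

      M : Mat n
      M i j = α (at i ∙ inverseᴳ (at j))

      block : Fin (ℕ.suc m) × Fin m → Fin (ℕ.suc m) × Fin m → A
      block (s , r) (s′ , r′) = δ s s′ * E α (point s) r r′

      D : Mat (ℕ.suc m ℕ.* m)
      D x y = block (row x) (row y)

      δ-quotient : ∀ r h k → δ r (h · k) ≡ δ (r · inv k) h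
      δ-quotient r h k with r · inv k ≟ h
      ... | yes refl = trans (cong (δ r) (inv-cancel r k)) (δ-refl r)
      ... | no ≢h    = δ-≢ {i = r} {h · k} λ { refl → ≢h (·-cancel h k) }

      logᴳ-∙ : ∀ h b g → logᴳ (aff h b ∙ g) ≡ h · logᴳ g
      logᴳ-∙ h b g = log-unique (a≢0 (aff h b ∙ g)) (trans (unit-· h (logᴳ g)) (cong (unit h *ᴷ_) (unit-log (a g) (a≢0 g))))

      -- After replacing x by x g, with x = (h, c), the phase splits into a part in h b(g) and a
      -- part in c. The support condition forces h = r k⁻¹, and the sum over c is an entry of E.
      PM : ∀ s r g → ∑ (λ i → p (s , r) (at i) * α (at i ∙ inverseᴳ g)) ≡
           E α (point s) r (logᴳ g) * ψ (phase s (logᴳ g) (b g))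
      PM s r g = begin
        ∑ (λ i → p (s , r) (at i) * α (at i ∙ inverseᴳ g))                     ≡⟨ ∑-affine e g (λ x → p (s , r) x * α (x ∙ inverseᴳ g)) ⟩
        ∑ (λ h → ∑ λ c → p (s , r) (aff h (point c) ∙ g) * α (aff h (point c) ∙ g ∙ inverseᴳ g))
          ≡⟨ ∑-cong (λ h → trans (∑-cong λ c → term h (point c)) (trans (sym (*-distribˡ-∑ (δ (r · inv k) h) _)) (*-congˡ (sym (*-distribˡ-∑ (ψ (phase s r (unit h *ᴷ b g))) _))))) ⟩
        ∑ (λ h → δ (r · inv k) h * (ψ (phase s r (unit h *ᴷ b g)) * ∑ λ c → ψ (phase s r (point c)) * α (aff h (point c))))
          ≡⟨ ∑-δˡ (r · inv k) _ ⟩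
        ψ (phase s r (unit (r · inv k) *ᴷ b g)) * E α (point s) r k             ≡⟨ *-comm _ _ ⟩
        E α (point s) r k * ψ (phase s r (unit (r · inv k) *ᴷ b g))             ≡⟨ cong (λ x → E α (point s) r k * ψ (point s *ᴷ x)) shift ⟩
        E α (point s) r k * ψ (phase s k (b g))                                 ∎
        where
        open ≡-Reasoning
        open IsGroup Affine-isGroup using (assoc; inverseʳ; identityʳ)
        k = logᴳ g
        term : ∀ h c → p (s , r) (aff h c ∙ g) * α (aff h c ∙ g ∙ inverseᴳ g) ≡
               δ (r · inv k) h * (ψ (phase s r (unit h *ᴷ b g)) * (ψ (phase s r c) * α (aff h c)))
        term h c = begin
          p (s , r) (aff h c ∙ g) * α (aff h c ∙ g ∙ inverseᴳ g)
            ≡⟨ cong₂ (λ x y → x * α y)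
                 (cong₂ _*_ (trans (cong (δ r) (logᴳ-∙ h c g)) (δ-quotient r h k))
                   (trans (cong ψ (K.solve 4 (λ s i x c → s K.:* (i K.:* (x K.:+ c)) K.:= s K.:* (i K.:* x) K.:+ s K.:* (i K.:* c)) refl (point s) (unit (inv r)) (unit h *ᴷ b g) c)) (ψ-+ _ _)))
                 (trans (assoc (aff h c) g (inverseᴳ g)) (trans (cong (aff h c ∙_) (inverseʳ g)) (identityʳ (aff h c)))) ⟩
          δ (r · inv k) h * (ψ (phase s r (unit h *ᴷ b g)) * ψ (phase s r c)) * α (aff h c)
            ≡⟨ solve 4 (λ d x y z → d :* (x :* y) :* z := d :* (x :* (y :* z))) refl (δ (r · inv k) h) (ψ (phase s r (unit h *ᴷ b g))) (ψ (phase s r c)) (α (aff h c)) ⟩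
          δ (r · inv k) h * (ψ (phase s r (unit h *ᴷ b g)) * (ψ (phase s r c) * α (aff h c))) ∎
        shift : unit (inv r) *ᴷ (unit (r · inv k) *ᴷ b g) ≡ unit (inv k) *ᴷ b g
        shift = begin
          unit (inv r) *ᴷ (unit (r · inv k) *ᴷ b g)                 ≡⟨ cong (λ x → unit (inv r) *ᴷ (x *ᴷ b g)) (unit-· r (inv k)) ⟩
          unit (inv r) *ᴷ (unit r *ᴷ unit (inv k) *ᴷ b g)           ≡⟨ K.solve 4 (λ i r k b → i K.:* (r K.:* k K.:* b) K.:= i K.:* r K.:* (k K.:* b)) refl (unit (inv r)) (unit r) (unit (inv k)) (b g) ⟩
          unit (inv r) *ᴷ unit r *ᴷ (unit (inv k) *ᴷ b g)           ≡⟨ cong (_*ᴷ (unit (inv k) *ᴷ b g)) (unit-inv r) ⟩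
          1ᴷ *ᴷ (unit (inv k) *ᴷ b g)                               ≡⟨ F.*-identityˡ _ ⟩
          unit (inv k) *ᴷ b g                                       ∎

      DP : ∀ x g → ∑ (λ y → block x (row y) * p (row y) g) ≡ E α (point (proj₁ x)) (proj₂ x) (logᴳ g) * ψ (phase (proj₁ x) (logᴳ g) (b g))
      DP (s , r) g = begin
        ∑ (λ y → block (s , r) (row y) * p (row y) g)                         ≡⟨ ∑-combine (ℕ.suc m) m _ ⟩
        ∑ (λ s′ → ∑ λ r′ → block (s , r) (row (combine s′ r′)) * p (row (combine s′ r′)) g)
          ≡⟨ ∑-cong (λ s′ → trans (∑-cong λ r′ → trans (cong (λ z → block (s , r) z * p z g) (remQuot-combine s′ r′))
               (solve 4 (λ d e d′ f → d :* e :* (d′ :* f) := d :* (e :* f :* d′)) refl (δ s s′) (E α (point s) r r′) (δ r′ k) (ψ (phase s′ r′ (b g)))))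
               (trans (sym (*-distribˡ-∑ (δ s s′) _)) (*-congˡ (∑-δʳ k _)))) ⟩
        ∑ (λ s′ → δ s s′ * (E α (point s) r k * ψ (phase s′ k (b g))))        ≡⟨ ∑-δˡ s _ ⟩
        E α (point s) r k * ψ (phase s k (b g))                               ∎
        where
        open ≡-Reasoning
        k = logᴳ g

      sum-of-phases : ∀ s s′ r → ∑ (λ c → ψ (phase s r (point c)) * ψ (-ᴷ phase s′ r (point c))) ≡ q * δ s s′
      sum-of-phases s s′ r with s ≟ s′
      ... | yes refl = trans (∑-cong λ c → trans (sym (ψ-+ _ _)) (trans (cong ψ (F.-‿inverseʳ _)) ψ-0)) (sym (*-identityʳ q))
      ... | no s≢s′  = trans
        (∑-cong λ c → trans (sym (ψ-+ _ _)) (cong ψ (trans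
          (cong (point s *ᴷ (unit (inv r) *ᴷ point c) +ᴷ_) (trans (K.-‿distribˡ-* (point s′) _) refl))
          (K.solve 4 (λ s t i c → s K.:* (i K.:* c) K.:+ t K.:* (i K.:* c) K.:= (s K.:+ t) K.:* i K.:* c) refl (point s) (-ᴷ point s′) (unit (inv r)) (point c)))))
        (trans (ψ-orthogonal {(point s +ᴷ -ᴷ point s′) *ᴷ unit (inv r)} nonzero) (sym (zeroʳ q)))
        where
        nonzero : (point s +ᴷ -ᴷ point s′) *ᴷ unit (inv r) ≢ 0ᴷ
        nonzero eq = s≢s′ (point-injective (K.x∙y⁻¹≈ε⇒x≈y (point s) (point s′) (begin
          point s +ᴷ -ᴷ point s′                                      ≡⟨ F.*-identityʳ _ ⟨
          (point s +ᴷ -ᴷ point s′) *ᴷ 1ᴷ                              ≡⟨ cong ((point s +ᴷ -ᴷ point s′) *ᴷ_) (unit-inv r) ⟨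
          (point s +ᴷ -ᴷ point s′) *ᴷ (unit (inv r) *ᴷ unit r)        ≡⟨ F.*-assoc _ _ _ ⟨
          (point s +ᴷ -ᴷ point s′) *ᴷ unit (inv r) *ᴷ unit r          ≡⟨ cong (_*ᴷ unit r) eq ⟩
          0ᴷ *ᴷ unit r                                                ≡⟨ F.zeroˡ _ ⟩
          0ᴷ                                                          ∎)))
          where open ≡-Reasoning

      PQ : ∀ s r s′ r′ → ∑ (λ i → p (s , r) (at i) * p⁻ (at i) (s′ , r′)) ≡ q * (δ s s′ * δ r r′)
      PQ s r s′ r′ = begin
        ∑ (λ i → p (s , r) (at i) * p⁻ (at i) (s′ , r′))      ≡⟨ ∑-affine e ε (λ g → p (s , r) g * p⁻ g (s′ , r′)) ⟩
        ∑ (λ h → ∑ λ c → p (s , r) (aff h (point c) ∙ ε) * p⁻ (aff h (point c) ∙ ε) (s′ , r′))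
          ≡⟨ ∑-cong (λ h → trans (∑-cong λ c → trans (cong (λ g → p (s , r) g * p⁻ g (s′ , r′)) (identityʳ (aff h (point c)))) (term h (point c)))
               (trans (sym (*-distribˡ-∑ (δ r h) _)) (*-congˡ (sym (*-distribˡ-∑ (δ r′ h) _))))) ⟩
        ∑ (λ h → δ r h * (δ r′ h * ∑ λ c → ψ (phase s r (point c)) * ψ (-ᴷ phase s′ r′ (point c))))   ≡⟨ ∑-δˡ r _ ⟩
        δ r′ r * ∑ (λ c → ψ (phase s r (point c)) * ψ (-ᴷ phase s′ r′ (point c)))                     ≡⟨ collapse ⟩
        q * (δ s s′ * δ r r′)                                                                         ∎
        where
        open ≡-Reasoning
        open IsGroup Affine-isGroup using (identityʳ)
        term : ∀ h c → p (s , r) (aff h c) * p⁻ (aff h c) (s′ , r′) ≡ δ r h * (δ r′ h * (ψ (phase s r c) * ψ (-ᴷ phase s′ r′ c)))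
        term h c = trans
          (cong (λ k → δ r k * ψ (phase s r c) * (δ r′ k * ψ (-ᴷ phase s′ r′ c))) (log-unique (unit≢0 h) refl))
          (solve 4 (λ d x d′ y → d :* x :* (d′ :* y) := d :* (d′ :* (x :* y))) refl (δ r h) (ψ (phase s r c)) (δ r′ h) (ψ (-ᴷ phase s′ r′ c)))
        collapse : δ r′ r * ∑ (λ c → ψ (phase s r (point c)) * ψ (-ᴷ phase s′ r′ (point c))) ≡ q * (δ s s′ * δ r r′)
        collapse with r ≟ r′
        ... | yes refl = trans (cong₂ _*_ (δ-refl r) (sum-of-phases s s′ r)) (trans (*-identityˡ _) (*-congˡ (sym (*-identityʳ _))))
        ... | no r≢r′  = trans (trans (*-congʳ (δ-≢ (r≢r′ ∘ sym))) (zeroˡ _)) (sym (trans (*-congˡ (zeroʳ _)) (zeroʳ q)))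

      δ-row : ∀ x y → δ (proj₁ (row x)) (proj₁ (row y)) * δ (proj₂ (row x)) (proj₂ (row y)) ≡ δ x y
      δ-row x y with x ≟ y
      ... | yes refl = trans (cong₂ _*_ (δ-refl (proj₁ (row x))) (δ-refl (proj₂ (row x)))) (*-identityˡ _)
      ... | no x≢y with proj₁ (row x) ≟ proj₁ (row y) | proj₂ (row x) ≟ proj₂ (row y)
      ...   | no _    | _     = zeroˡ _
      ...   | yes _   | no _  = zeroʳ _
      ...   | yes s≡s | yes r≡r = ⊥-elim (x≢y (begin
        x                                              ≡⟨ combine-remQuot {ℕ.suc m} m x ⟨
        combine (proj₁ (row x)) (proj₂ (row x))        ≡⟨ cong₂ combine s≡s r≡r ⟩
        combine (proj₁ (row y)) (proj₂ (row y))        ≡⟨ combine-remQuot {ℕ.suc m} m y ⟩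
        y                                              ∎))
        where open ≡-Reasoning

    groupDet-product : Det M ≡ ∏ (λ s → Det (E α (point s)))
    groupDet-product = trans
      (Det-intertwine (trans (ℕ.*-comm (ℕ.suc m) m) (sym (↔⇒≡ (↔-sym affines ↔-∘ e)))) M D P Q order-regular
        (λ x j → trans (PM (proj₁ (row x)) (proj₂ (row x)) (at j)) (sym (DP (row x) (at j))))
        (λ x y → trans (PQ (proj₁ (row x)) (proj₂ (row x)) (proj₁ (row y)) (proj₂ (row y))) (*-congˡ (δ-row x y))))
      (Det-block-diagonal (ℕ.suc m) D (λ s → E α (point s)) λ s i t j →
        cong₂ block (remQuot-combine s i) (remQuot-combine t j))

    groupDet-factors : Det M ≡ Det (E α 0ᴷ) * ∏ {m} (λ _ → Det (E α 1ᴷ))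
    groupDet-factors = trans groupDet-product
      (cong₂ _*_ (cong (λ x → Det (E α x)) point-zero) (∏-cong λ h → Det-E-translate α h))

-- Integer group determinants of affine groups in characteristic 3

open import Data.Integer.Base as ℤ using (ℤ; +_; 0ℤ; 1ℤ; -1ℤ)

ℤ-ring : StrictRing
ℤ-ring = record { isCommutativeRing = ℤ.+-*-isCommutativeRing }

module Dℤ = Determinant ℤ-ring

sum≡∑ : ∀ {n} (f : Fin n → ℤ) → sum f ≡ Dℤ.∑ f
sum≡∑ {ℕ.zero}  f = sym (Dℤ.∑-empty f)
sum≡∑ {ℕ.suc n} f = trans (cong (ℤ._+_ (f zero)) (sum≡∑ (f ∘ suc))) (sym (Dℤ.∑-suc f))

det≡Det : ∀ {n} (M : Matrix n) → det M ≡ Dℤ.Det M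
det≡Det {ℕ.zero}  M = sym (Dℤ.Det-empty M)
det≡Det {ℕ.suc n} M = trans (sum≡∑ _) (trans
  (Dℤ.∑-cong λ j → cong₂ (λ s d → s ℤ.* M zero j ℤ.* d) (sign j) (det≡Det (Dℤ.minor M j)))
  (sym (Dℤ.Det-suc M)))
  where
  sign : ∀ {n} (j : Fin n) → -1ℤ ℤ.^ toℕ j ≡ Dℤ.sgn j
  sign zero    = refl
  sign (suc j) = trans (cong (ℤ._*_ -1ℤ) (sign j)) (ℤ.-1*i≡-i _)

-- (a , b) stands for a + b ω, where ω² = - 1 - ω.
Eisenstein : Set
Eisenstein = ℤ × ℤ

infixl 6 _+ω_
infixl 7 _*ω_
infix  8 -ω_

_+ω_ _*ω_ : Eisenstein → Eisenstein → Eisenstein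
(a , b) +ω (c , d) = a ℤ.+ c , b ℤ.+ d
(a , b) *ω (c , d) = a ℤ.* c ℤ.+ ℤ.- (b ℤ.* d) , a ℤ.* d ℤ.+ b ℤ.* c ℤ.+ ℤ.- (b ℤ.* d)

-ω_ : Eisenstein → Eisenstein
-ω (a , b) = ℤ.- a , ℤ.- b

Eisenstein-isCommutativeRing : IsCommutativeRing _≡_ _+ω_ _*ω_ -ω_ (0ℤ , 0ℤ) (1ℤ , 0ℤ)
Eisenstein-isCommutativeRing = record
  { isRing = record
    { +-isAbelianGroup = record
      { isGroup = record
        { isMonoid = record
          { isSemigroup = record
            { isMagma = record { isEquivalence = isEquivalence ; ∙-cong = cong₂ _+ω_ }
            ; assoc   = λ (a , b) (c , d) (e , f) → cong₂ _,_ (ℤ.+-assoc a c e) (ℤ.+-assoc b d f)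
            }
          ; identity = (λ (a , b) → cong₂ _,_ (ℤ.+-identityˡ a) (ℤ.+-identityˡ b))
                     , (λ (a , b) → cong₂ _,_ (ℤ.+-identityʳ a) (ℤ.+-identityʳ b))
          }
        ; inverse = (λ (a , b) → cong₂ _,_ (ℤ.+-inverseˡ a) (ℤ.+-inverseˡ b))
                  , (λ (a , b) → cong₂ _,_ (ℤ.+-inverseʳ a) (ℤ.+-inverseʳ b))
        ; ⁻¹-cong = cong -ω_
        }
      ; comm = λ (a , b) (c , d) → cong₂ _,_ (ℤ.+-comm a c) (ℤ.+-comm b d)
      }
    ; *-cong     = cong₂ _*ω_
    ; *-assoc    = λ (a , b) (c , d) (e , f) → cong₂ _,_ (assoc₁ a b c d e f) (assoc₂ a b c d e f)
    ; *-identity = (λ (a , b) → cong₂ _,_ (identity₁ a b) (identity₂ a b)) , (λ (a , b) → cong₂ _,_ (identity₃ a b) (identity₄ a b))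
    ; distrib    = (λ (a , b) (c , d) (e , f) → cong₂ _,_ (distrib₁ a b c d e f) (distrib₂ a b c d e f))
                 , (λ (a , b) (c , d) (e , f) → cong₂ _,_ (distrib₃ a b c d e f) (distrib₄ a b c d e f))
    }
  ; *-comm = λ (a , b) (c , d) → cong₂ _,_ (comm₁ a b c d) (comm₂ a b c d)
  }
  where
  open import Data.Integer.Base
  assoc₁ : ∀ a b c d e f → (a * c + - (b * d)) * e + - ((a * d + b * c + - (b * d)) * f)
         ≡ a * (c * e + - (d * f)) + - (b * (c * f + d * e + - (d * f)))
  assoc₁ = solve-∀
  assoc₂ : ∀ a b c d e f → (a * c + - (b * d)) * f + (a * d + b * c + - (b * d)) * e + - ((a * d + b * c + - (b * d)) * f)
         ≡ a * (c * f + d * e + - (d * f)) + b * (c * e + - (d * f)) + - (b * (c * f + d * e + - (d * f)))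
  assoc₂ = solve-∀
  identity₁ : ∀ a b → 1ℤ * a + - (0ℤ * b) ≡ a
  identity₁ = solve-∀
  identity₂ : ∀ a b → 1ℤ * b + 0ℤ * a + - (0ℤ * b) ≡ b
  identity₂ = solve-∀
  identity₃ : ∀ a b → a * 1ℤ + - (b * 0ℤ) ≡ a
  identity₃ = solve-∀
  identity₄ : ∀ a b → a * 0ℤ + b * 1ℤ + - (b * 0ℤ) ≡ b
  identity₄ = solve-∀
  distrib₁ : ∀ a b c d e f → a * (c + e) + - (b * (d + f)) ≡ (a * c + - (b * d)) + (a * e + - (b * f))
  distrib₁ = solve-∀
  distrib₂ : ∀ a b c d e f → a * (d + f) + b * (c + e) + - (b * (d + f)) ≡ (a * d + b * c + - (b * d)) + (a * f + b * e + - (b * f))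
  distrib₂ = solve-∀
  distrib₃ : ∀ a b c d e f → (c + e) * a + - ((d + f) * b) ≡ (c * a + - (d * b)) + (e * a + - (f * b))
  distrib₃ = solve-∀
  distrib₄ : ∀ a b c d e f → (c + e) * b + (d + f) * a + - ((d + f) * b) ≡ (c * b + d * a + - (d * b)) + (e * b + f * a + - (f * b))
  distrib₄ = solve-∀
  comm₁ : ∀ a b c d → a * c + - (b * d) ≡ c * a + - (d * b)
  comm₁ = solve-∀
  comm₂ : ∀ a b c d → a * d + b * c + - (b * d) ≡ c * b + d * a + - (d * b)
  comm₂ = solve-∀

Eisenstein-ring : StrictRing
Eisenstein-ring = record { isCommutativeRing = Eisenstein-isCommutativeRing }

Eisenstein-embedding : Homomorphism ℤ-ring Eisenstein-ring
Eisenstein-embedding = record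
  { ⟦_⟧      = λ a → a , 0ℤ
  ; 0-homo   = refl
  ; 1-homo   = refl
  ; +-homo   = λ a b → refl
  ; *-homo   = λ a b → cong₂ _,_ (sym (ℤ.+-identityʳ _)) (second a b)
  ; neg-homo = λ a → refl
  }
  where
  second : ∀ a b → 0ℤ ≡ a ℤ.* 0ℤ ℤ.+ 0ℤ ℤ.* b ℤ.+ 0ℤ
  second = solve-∀

Eisenstein-conjugation : Homomorphism Eisenstein-ring Eisenstein-ring
Eisenstein-conjugation = record
  { ⟦_⟧      = λ (a , b) → a ℤ.+ ℤ.- b , ℤ.- b
  ; 0-homo   = refl
  ; 1-homo   = refl
  ; +-homo   = λ (a , b) (c , d) → cong₂ _,_ (plus a b c d) (ℤ.neg-distrib-+ b d)
  ; *-homo   = λ (a , b) (c , d) → cong₂ _,_ (times₁ a b c d) (times₂ a b c d)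
  ; neg-homo = λ (a , b) → cong₂ _,_ (sym (ℤ.neg-distrib-+ a (ℤ.- b))) refl
  }
  where
  open import Data.Integer.Base
  plus : ∀ a b c d → (a + c) + - (b + d) ≡ (a + - b) + (c + - d)
  plus = solve-∀
  times₁ : ∀ a b c d → (a * c + - (b * d)) + - (a * d + b * c + - (b * d)) ≡ (a + - b) * (c + - d) + - (- b * - d)
  times₁ = solve-∀
  times₂ : ∀ a b c d → - (a * d + b * c + - (b * d)) ≡ (a + - b) * - d + - b * (c + - d) + - (- b * - d)
  times₂ = solve-∀

-- What the argument uses of ℤ[ω]: nonzero integers are not zero divisors, the elements fixed by
-- conjugation are integers, and a retraction `re` onto ℤ respects multiplication by integers.
record ComplexRing : Set₁ where
  field
    ring        : StrictRing
    embedding   : Homomorphism ℤ-ring ring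
    conjugation : Homomorphism ring ring

  module ι = Homomorphism embedding
  module conj = Homomorphism conjugation
  open StrictRing ring public
  open Determinant ring public

  ι : ℤ → A
  ι = ι.⟦_⟧

  field
    re         : A → ℤ
    re-ι       : ∀ a → re (ι a) ≡ a
    re-scale   : ∀ a z → re (ι a * z) ≡ a ℤ.* re z
    conj-ι     : ∀ a → conj.⟦ ι a ⟧ ≡ ι a
    conj-fixed : ∀ z → conj.⟦ z ⟧ ≡ z → z ≡ ι (re z)
    ι-regular  : ∀ {a} → a ≢ 0ℤ → Regular (ι a)

  ι-injective : ∀ {a b} → ι a ≡ ι b → a ≡ b
  ι-injective {a} {b} eq = trans (sym (re-ι a)) (trans (cong re eq) (re-ι b))

  ι-δ : ∀ {n} (i j : Fin n) → ι (Dℤ.δ i j) ≡ δ i j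
  ι-δ i j with does (i ≟ j)
  ... | true  = ι.1-homo
  ... | false = ι.0-homo

  ∏-const : ∀ n c → ∏ {n} (λ _ → ι c) ≡ ι (c ℤ.^ n)
  ∏-const ℕ.zero    c = sym ι.1-homo
  ∏-const (ℕ.suc n) c = trans (*-congˡ (∏-const n c)) (sym (ι.*-homo c (c ℤ.^ n)))

Eisenstein-complex : ComplexRing
Eisenstein-complex = record
  { ring        = Eisenstein-ring
  ; embedding   = Eisenstein-embedding
  ; conjugation = Eisenstein-conjugation
  -- The coefficient of 1 in the basis 1, ω, which is not the real part.
  ; re          = proj₁
  ; re-ι        = λ a → refl
  ; re-scale    = λ d (a , b) → sym (first d a b)
  ; conj-ι      = λ a → cong (_, 0ℤ) (ℤ.+-identityʳ a)
  ; conj-fixed  = λ (a , b) eq → cong (a ,_) (b≡0 b (cong proj₂ eq))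
  ; ι-regular   = λ {d} d≢0 {z} eq → cong₂ _,_
      (cancel d d≢0 (trans (first d (proj₁ z) (proj₂ z)) (cong proj₁ eq)))
      (cancel d d≢0 (trans (second d (proj₁ z) (proj₂ z)) (cong proj₂ eq)))
  }
  where
  b≡0 : ∀ b → ℤ.- b ≡ b → b ≡ 0ℤ
  b≡0 (+ ℕ.zero) _ = refl
  b≡0 (+ ℕ.suc n) ()
  b≡0 ℤ.-[1+ n ] ()
  cancel : ∀ d → d ≢ 0ℤ → ∀ {x} → d ℤ.* x ≡ 0ℤ → x ≡ 0ℤ
  cancel d d≢0 {x} eq = ℤ.*-cancelˡ-≡ d x 0ℤ {{ℤ.≢-nonZero d≢0}} (trans eq (sym (ℤ.*-zeroʳ d)))
  first : ∀ d a b → d ℤ.* a ≡ d ℤ.* a ℤ.+ ℤ.- (0ℤ ℤ.* b)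
  first = solve-∀
  second : ∀ d a b → d ℤ.* b ≡ d ℤ.* b ℤ.+ 0ℤ ℤ.* a ℤ.+ ℤ.- (0ℤ ℤ.* b)
  second = solve-∀

∑-const : ∀ n c → Dℤ.∑ {n} (λ _ → c) ≡ + n ℤ.* c
∑-const ℕ.zero    c = trans (Dℤ.∑-empty _) (sym (ℤ.*-zeroˡ c))
∑-const (ℕ.suc n) c = trans (Dℤ.∑-suc _) (trans (cong (ℤ._+_ c) (∑-const n c)) (sym (ℤ.suc-* (+ n) c)))

-- Integrality, congruence and realisation of the two factors

module AffineDeterminants
  {m : ℕ} (F : FiniteField (ℕ.suc m)) (U : UnitGroup F)
  (C : ComplexRing) (χ : AdditiveCharacter F U (ComplexRing.ring C))
  (ψ-neg : ∀ x → AdditiveCharacter.ψ χ (FiniteField.-_ F x) ≡ Homomorphism.⟦_⟧ (ComplexRing.conjugation C) (AdditiveCharacter.ψ χ x))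
  where

  open FiniteField F using () renaming (Carrier to K; _+_ to _+ᴷ_; _*_ to _*ᴷ_; -_ to -ᴷ_; 0# to 0ᴷ; 1# to 1ᴷ)
  open ComplexRing C
  open AdditiveCharacter χ
  open UnitGroup U
  open GeneralAffine F hiding (inv; _∙_; ε)
  private module F = FiniteField F

  ∑-1 : ∑ {ℕ.suc m} (λ _ → 1#) ≡ ι (+ ℕ.suc m)
  ∑-1 = trans (trans (∑-cong {ℕ.suc m} λ _ → sym ι.1-homo) (sym (ι.∑-homo λ _ → 1ℤ))) (cong ι (trans (∑-const (ℕ.suc m) 1ℤ) (ℤ.*-identityʳ _)))

  open Factorisation F U ring χ (subst Regular (sym ∑-1) (ι-regular {+ ℕ.suc m} λ ()))

  -- Linear combinations of the characters s ↦ ψ(s n). They form a ring since ψ(s n) ψ(s k) = ψ(s (n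
  -- + k)), so determinants stay among them; `cs-resp` closes the predicate under pointwise
  -- equality.
  data CharacterSum : (K → A) → Set where
    character : ∀ c n → CharacterSum (λ s → c * ψ (s *ᴷ n))
    plus      : ∀ {f g} → CharacterSum f → CharacterSum g → CharacterSum (λ s → f s + g s)
    cs-resp   : ∀ {f g} → (∀ s → f s ≡ g s) → CharacterSum f → CharacterSum g

  cs-constant : ∀ c → CharacterSum (λ _ → c)
  cs-constant c = cs-resp (λ s → trans (*-congˡ (trans (cong ψ (F.zeroʳ s)) ψ-0)) (*-identityʳ c)) (character c 0ᴷ)

  cs-times : ∀ {f g} → CharacterSum f → CharacterSum g → CharacterSum (λ s → f s * g s)
  cs-times (cs-resp eq f) g = cs-resp (λ s → *-congʳ (eq s)) (cs-times f g)
  cs-times (plus f f′) g = cs-resp (λ s → sym (distribʳ _ _ _)) (plus (cs-times f g) (cs-times f′ g))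
  cs-times f@(character _ _) (cs-resp eq g) = cs-resp (λ s → *-congˡ (eq s)) (cs-times f g)
  cs-times f@(character _ _) (plus g g′) = cs-resp (λ s → sym (distribˡ _ _ _)) (plus (cs-times f g) (cs-times f g′))
  cs-times (character c n) (character d k) = cs-resp
    (λ s → trans (*-congˡ (trans (cong ψ (F.distribˡ s n k)) (ψ-+ _ _)))
      (solve 4 (λ c d x y → c :* d :* (x :* y) := c :* x :* (d :* y)) refl c d (ψ (s *ᴷ n)) (ψ (s *ᴷ k))))
    (character (c * d) (n +ᴷ k))

  cs-neg : ∀ {f} → CharacterSum f → CharacterSum (λ s → - f s)
  cs-neg f = cs-resp (λ s → -1*x≈-x _) (cs-times (cs-constant (- 1#)) f)

  -- The sum over all s picks out the coefficient of the trivial character, |K| times.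
  cs-sum : ∀ {f} → CharacterSum f → ∃[ x ] ∑ (λ s → f (point s)) ≡ ι (+ ℕ.suc m) * x
  cs-sum (cs-resp eq f) = let x , p = cs-sum f in x , trans (∑-cong λ s → sym (eq (point s))) p
  cs-sum (plus f g) = let x , p = cs-sum f ; y , q = cs-sum g in
    x + y , trans (∑-distrib-+ _ _) (trans (cong₂ _+_ p q) (sym (distribˡ _ x y)))
  cs-sum (character c n) with Inverse.from points n ≟ zero
  ... | yes n≡0 = c , trans
    (trans (∑-cong λ s → trans (*-congˡ (trans (cong ψ (trans (cong (point s *ᴷ_) n≡0#) (F.zeroʳ _))) ψ-0)) (*-comm c 1#))
      (sym (*-distribʳ-∑ c (λ _ → 1#))))
    (*-congʳ ∑-1)
    where
    n≡0# : n ≡ 0ᴷ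
    n≡0# = trans (sym (Inverse.strictlyInverseˡ points n)) (trans (cong point n≡0) point-zero)
  ... | no n≢0 = 0# , trans (sym (*-distribˡ-∑ c _)) (trans (*-congˡ (trans
    (∑-cong λ s → cong ψ (F.*-comm _ _))
    (ψ-orthogonal λ n≡0# → n≢0 (trans (cong (Inverse.from points) (trans n≡0# (sym point-zero))) (Inverse.strictlyInverseʳ points zero)))))
    (trans (zeroʳ c) (sym (zeroʳ _))))

  linearMatrix : (Affine → ℤ) → Dℤ.Mat m
  linearMatrix α r r′ = Dℤ.∑ λ b → α (aff (r · inv r′) (point b))

  linearPart : (Affine → ℤ) → ℤ
  linearPart α = Dℤ.Det (linearMatrix α)

  Det-E₀ : ∀ α → Det (E (ι ∘ α) 0ᴷ) ≡ ι (linearPart α)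
  Det-E₀ α = trans (Det-cong λ r r′ → trans (E-zero (ι ∘ α) r r′) (sym (ι.∑-homo _))) (sym (ι.Det-homo (linearMatrix α)))

  principalPart : (Affine → ℤ) → ℤ
  principalPart α = re (Det (E (ι ∘ α) 1ᴷ))

  -- Complex conjugation replaces the character ψ by ψ(- _), which lies in the same orbit of the unit group.
  Det-E₁ : ∀ α → Det (E (ι ∘ α) 1ᴷ) ≡ ι (principalPart α)
  Det-E₁ α = conj-fixed _ (begin
    conj.⟦ Det (E (ι ∘ α) 1ᴷ) ⟧                    ≡⟨ conj.Det-homo (E (ι ∘ α) 1ᴷ) ⟩
    Det (λ r r′ → conj.⟦ E (ι ∘ α) 1ᴷ r r′ ⟧)      ≡⟨ Det-cong conj-E ⟩
    Det (E (ι ∘ α) (-ᴷ 1ᴷ))                        ≡⟨ cong (λ s → Det (E (ι ∘ α) s)) (unit-log _ -1≢0) ⟨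
    Det (E (ι ∘ α) (unit (log (-ᴷ 1ᴷ) -1≢0)))      ≡⟨ Det-E-translate (ι ∘ α) _ ⟩
    Det (E (ι ∘ α) 1ᴷ)                             ∎)
    where
    open ≡-Reasoning
    module K = Determinant fieldRing
    conj-E : ∀ r r′ → conj.⟦ E (ι ∘ α) 1ᴷ r r′ ⟧ ≡ E (ι ∘ α) (-ᴷ 1ᴷ) r r′
    conj-E r r′ = trans (conj.∑-homo _) (∑-cong λ b → trans (conj.*-homo _ _) (cong₂ _*_
      (trans (sym (ψ-neg _)) (cong ψ (K.-‿distribˡ-* 1ᴷ (unit (inv r) *ᴷ point b))))
      (conj-ι (α (aff (r · inv r′) (point b))))))
    -1≢0 : -ᴷ 1ᴷ ≢ 0ᴷ
    -1≢0 eq = F.1#≢0# (trans (sym (K.-‿involutive 1ᴷ)) (trans (cong -ᴷ_ eq) K.-0#≈0#))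

  groupDeterminant-factors : ∀ α → groupDeterminant (GA₁ F) α ≡ linearPart α ℤ.* principalPart α ℤ.^ m
  groupDeterminant-factors α = ι-injective (begin
    ι (groupDeterminant (GA₁ F) α)                                                ≡⟨ cong ι (det≡Det M) ⟩
    ι (Dℤ.Det M)                                                                  ≡⟨ ι.Det-homo M ⟩
    Det (λ i j → ι (α (element i ∙ element j ⁻¹)))                                ≡⟨ groupDet-factors Affine-enumeration (ι ∘ α) ⟩
    Det (E (ι ∘ α) 0ᴷ) * ∏ {m} (λ _ → Det (E (ι ∘ α) 1ᴷ))                         ≡⟨ cong₂ _*_ (Det-E₀ α) (trans (∏-cong {m} λ _ → Det-E₁ α) (∏-const m _)) ⟩
    ι (linearPart α) * ι (principalPart α ℤ.^ m)                                  ≡⟨ ι.*-homo _ _ ⟨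
    ι (linearPart α ℤ.* principalPart α ℤ.^ m)                                    ∎)
    where
    open ≡-Reasoning
    open FiniteGroup (GA₁ F) using (element; _∙_; _⁻¹)
    M : Matrix (m ℕ.* ℕ.suc m)
    M i j = α (element i ∙ element j ⁻¹)

  principal≡linear : ∀ α → + ℕ.suc m ∣ principalPart α ℤ.- linearPart α
  principal≡linear α =
    let x , eq = cs-sum (Det-closed CharacterSum cs-resp (cs-constant 0#) (cs-constant 1#) plus cs-times cs-neg entry) in
    -- With q = m + 1 and q x the sum of all the determinants, B - A = q B - (A + m B) = q (B - re
    -- x).
    ∣⇒∣ᵤ (divides (principalPart α ℤ.- re x)
      (arith (linearPart α) (principalPart α) (+ m) (re x) (trans (sym (re-ι _)) (trans (cong re (trans (sym total) eq)) (re-scale (+ ℕ.suc m) x)))))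
    where
    entry : ∀ r r′ → CharacterSum (λ s → E (ι ∘ α) s r r′)
    entry r r′ = ∑-closed CharacterSum cs-resp (cs-constant 0#) (cs-constant 1#) plus cs-times cs-neg
      λ b → cs-resp (λ s → *-comm _ _) (character (ι (α (aff (r · inv r′) (point b)))) (unit (inv r) *ᴷ point b))
    total : ∑ (λ s → Det (E (ι ∘ α) (point s))) ≡ ι (linearPart α ℤ.+ + m ℤ.* principalPart α)
    total = trans (trans (∑-suc _) (cong₂ _+_
      (trans (cong (λ s → Det (E (ι ∘ α) s)) point-zero) (Det-E₀ α))
      (trans (∑-cong λ h → trans (Det-E-translate (ι ∘ α) h) (Det-E₁ α)) (trans (sym (ι.∑-homo λ _ → principalPart α)) (cong ι (∑-const m _))))))
      (sym (ι.+-homo _ _))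
    arith : ∀ A B m x → A ℤ.+ m ℤ.* B ≡ (1ℤ ℤ.+ m) ℤ.* x → B ℤ.- A ≡ (B ℤ.- x) ℤ.* (1ℤ ℤ.+ m)
    arith A B m x eq = trans (rearrange A B m) (trans (cong (λ z → (1ℤ ℤ.+ m) ℤ.* B ℤ.- z) eq) (finish B m x))
      where
      rearrange : ∀ A B m → B ℤ.- A ≡ (1ℤ ℤ.+ m) ℤ.* B ℤ.- (A ℤ.+ m ℤ.* B)
      rearrange = solve-∀
      finish : ∀ B m x → (1ℤ ℤ.+ m) ℤ.* B ℤ.- (1ℤ ℤ.+ m) ℤ.* x ≡ (B ℤ.- x) ℤ.* (1ℤ ℤ.+ m)
      finish = solve-∀

  -- The group ring element c + n Σ y: here n is translation by -1, Σ the sum of all x ↦ u x,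
  -- and y the combination of the translations by point i with coefficients y i.
  module Realisation (c c* : Fin m → ℤ) (d σ : ℤ) (y : Fin (ℕ.suc m) → ℤ)
    (d≢0 : d ≢ 0ℤ)
    (Det-c : Dℤ.Det (λ r r′ → c (r · inv r′)) ≡ d)
    (c*⋆c : ∀ r r′ → Dℤ.∑ (λ k → c* (r · inv k) ℤ.* c (k · inv r′)) ≡ d ℤ.* Dℤ.δ r r′)
    (∑c* : ∀ r → Dℤ.∑ (λ k → c* (r · inv k)) ≡ σ)
    (∑c*′ : Dℤ.∑ c* ≡ σ)
    where

    private
      module K = Determinant fieldRing

      index : K → Fin (ℕ.suc m)
      index = Inverse.from points

      index-point : ∀ i → index (point i) ≡ i
      index-point = Inverse.strictlyInverseʳ points

      total τ : ℤ
      total = Dℤ.∑ y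
      τ = Dℤ.∑ λ t → c* t ℤ.* y (suc t)

      M N : Mat m
      M r r′ = ι (c (r · inv r′))
      N r r′ = ι (c* (r · inv r′))

      u v : K → Fin m → A
      u s r  = ψ (s *ᴷ (unit (inv r) *ᴷ -ᴷ 1ᴷ))
      v s r′ = ∑ λ b → ψ (s *ᴷ (unit (inv r′) *ᴷ point b)) * ι (y b)

    -- The product of n, the unit h and the translation by `point i` is the map x ↦ h (x + point i)
    -- - 1. Its last coordinate is b = h point i - 1, so i is recovered as the index of h⁻¹ (b + 1).
    element-of : Affine → ℤ
    element-of g = c h ℤ.* Dℤ.δ zero (index (b g)) ℤ.+ y (index (unit (inv h) *ᴷ (b g +ᴷ 1ᴷ)))
      where
      open Affine
      h = log (a g) (a≢0 g)

    private
      shift : ∀ h → Fin (ℕ.suc m) ↔ Fin (ℕ.suc m)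
      shift h = mk↔ₛ′ (λ i → index (unit h *ᴷ point i +ᴷ -ᴷ 1ᴷ)) (λ i → index (unit (inv h) *ᴷ (point i +ᴷ 1ᴷ)))
        (λ i → trans (cong (λ x → index (unit h *ᴷ x +ᴷ -ᴷ 1ᴷ)) (Inverse.strictlyInverseˡ points _)) (trans (cong index (there (point i))) (index-point i)))
        (λ i → trans (cong (λ x → index (unit (inv h) *ᴷ (x +ᴷ 1ᴷ))) (Inverse.strictlyInverseˡ points _)) (trans (cong index (back (point i))) (index-point i)))
        where
        open ≡-Reasoning
        there : ∀ x → unit h *ᴷ (unit (inv h) *ᴷ (x +ᴷ 1ᴷ)) +ᴷ -ᴷ 1ᴷ ≡ x
        there x = begin
          unit h *ᴷ (unit (inv h) *ᴷ (x +ᴷ 1ᴷ)) +ᴷ -ᴷ 1ᴷ   ≡⟨ K.solve 4 (λ h i x n → h K.:* (i K.:* x) K.:+ n K.:= i K.:* h K.:* x K.:+ n) refl (unit h) (unit (inv h)) (x +ᴷ 1ᴷ) (-ᴷ 1ᴷ) ⟩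
          unit (inv h) *ᴷ unit h *ᴷ (x +ᴷ 1ᴷ) +ᴷ -ᴷ 1ᴷ     ≡⟨ cong (λ z → z *ᴷ (x +ᴷ 1ᴷ) +ᴷ -ᴷ 1ᴷ) (unit-inv h) ⟩
          1ᴷ *ᴷ (x +ᴷ 1ᴷ) +ᴷ -ᴷ 1ᴷ                         ≡⟨ K.solve 2 (λ x n → K.con 1 K.:* (x K.:+ K.con 1) K.:+ n K.:= x K.:+ (K.con 1 K.:+ n)) refl x (-ᴷ 1ᴷ) ⟩
          x +ᴷ (1ᴷ +ᴷ -ᴷ 1ᴷ)                               ≡⟨ cong (x +ᴷ_) (F.-‿inverseʳ 1ᴷ) ⟩
          x +ᴷ 0ᴷ                                          ≡⟨ F.+-identityʳ x ⟩
          x                                                ∎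
        back : ∀ x → unit (inv h) *ᴷ (unit h *ᴷ x +ᴷ -ᴷ 1ᴷ +ᴷ 1ᴷ) ≡ x
        back x = begin
          unit (inv h) *ᴷ (unit h *ᴷ x +ᴷ -ᴷ 1ᴷ +ᴷ 1ᴷ)     ≡⟨ cong (unit (inv h) *ᴷ_) (trans (F.+-assoc _ _ _) (trans (cong (unit h *ᴷ x +ᴷ_) (F.-‿inverseˡ 1ᴷ)) (F.+-identityʳ _))) ⟩
          unit (inv h) *ᴷ (unit h *ᴷ x)                    ≡⟨ F.*-assoc _ _ _ ⟨
          unit (inv h) *ᴷ unit h *ᴷ x                      ≡⟨ cong (_*ᴷ x) (unit-inv h) ⟩
          1ᴷ *ᴷ x                                          ≡⟨ F.*-identityˡ x ⟩
          x                                                ∎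

      -- For x = r r′⁻¹ the phase s r⁻¹ (x p - 1) equals s r′⁻¹ p - s r⁻¹, which separates r from
      -- r′.
      E-rank-one : ∀ s r r′ → E (ι ∘ element-of) s r r′ ≡ M r r′ + u s r * v s r′
      E-rank-one s r r′ = begin
        ∑ (λ b → ph (point b) * ι (element-of (aff x (point b))))
          ≡⟨ ∑-cong (λ b → trans (*-congˡ (trans (cong ι (cong₂ (λ h i → c h ℤ.* Dℤ.δ zero i ℤ.+ y (index (unit (inv h) *ᴷ (point b +ᴷ 1ᴷ)))) (log-unique (unit≢0 x) refl) (index-point b))) (ι.+-homo _ _))) (distribˡ _ _ _)) ⟩
        ∑ (λ b → ph (point b) * ι (c x ℤ.* Dℤ.δ zero b) + ph (point b) * ι (y (Inverse.from (shift x) b)))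
          ≡⟨ ∑-distrib-+ _ _ ⟩
        ∑ (λ b → ph (point b) * ι (c x ℤ.* Dℤ.δ zero b)) + ∑ (λ b → ph (point b) * ι (y (Inverse.from (shift x) b)))
          ≡⟨ cong₂ _+_ constant (∑-permute _ (shift x)) ⟩
        ι (c x) + ∑ (λ b → ph (point (Inverse.to (shift x) b)) * ι (y (Inverse.from (shift x) (Inverse.to (shift x) b))))
          ≡⟨ +-congˡ (∑-cong λ b → cong₂ (λ z i → ψ (s *ᴷ (unit (inv r) *ᴷ z)) * ι (y i)) (Inverse.strictlyInverseˡ points _) (Inverse.strictlyInverseʳ (shift x) b)) ⟩
        ι (c x) + ∑ (λ b → ph (unit x *ᴷ point b +ᴷ -ᴷ 1ᴷ) * ι (y b))
          ≡⟨ +-congˡ (trans (∑-cong λ b → trans (*-congʳ (phase b)) (*-assoc _ _ _)) (sym (*-distribˡ-∑ (u s r) _))) ⟩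
        ι (c x) + u s r * v s r′ ∎
        where
        open ≡-Reasoning
        x = r · inv r′
        ph : K → A
        ph z = ψ (s *ᴷ (unit (inv r) *ᴷ z))
        constant : ∑ (λ b → ph (point b) * ι (c x ℤ.* Dℤ.δ zero b)) ≡ ι (c x)
        constant = begin
          ∑ (λ b → ph (point b) * ι (c x ℤ.* Dℤ.δ zero b))    ≡⟨ ∑-cong (λ b → trans (*-congˡ (trans (ι.*-homo _ _) (*-congˡ (ι-δ zero b)))) (solve 3 (λ p c d → p :* (c :* d) := d :* (p :* c)) refl (ph (point b)) (ι (c x)) (δ zero b))) ⟩
          ∑ (λ b → δ zero b * (ph (point b) * ι (c x)))       ≡⟨ ∑-δˡ zero _ ⟩
          ph (point zero) * ι (c x)                            ≡⟨ *-congʳ (trans (cong (λ z → ψ (s *ᴷ (unit (inv r) *ᴷ z))) point-zero) (trans (cong ψ (trans (cong (s *ᴷ_) (F.zeroʳ _)) (F.zeroʳ s))) ψ-0)) ⟩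
          1# * ι (c x)                                         ≡⟨ *-identityˡ _ ⟩
          ι (c x)                                              ∎
        phase : ∀ b → ph (unit x *ᴷ point b +ᴷ -ᴷ 1ᴷ) ≡ u s r * ψ (s *ᴷ (unit (inv r′) *ᴷ point b))
        phase b = begin
          ψ (s *ᴷ (unit (inv r) *ᴷ (unit x *ᴷ point b +ᴷ -ᴷ 1ᴷ)))
            ≡⟨ cong (λ z → ψ (s *ᴷ (unit (inv r) *ᴷ (z *ᴷ point b +ᴷ -ᴷ 1ᴷ)))) (unit-· r (inv r′)) ⟩
          ψ (s *ᴷ (unit (inv r) *ᴷ (unit r *ᴷ unit (inv r′) *ᴷ point b +ᴷ -ᴷ 1ᴷ)))
            ≡⟨ cong ψ (K.solve 6 (λ s i r j b n → s K.:* (i K.:* (r K.:* j K.:* b K.:+ n)) K.:= s K.:* (i K.:* n) K.:+ (i K.:* r) K.:* (s K.:* (j K.:* b))) refl s (unit (inv r)) (unit r) (unit (inv r′)) (point b) (-ᴷ 1ᴷ)) ⟩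
          ψ (s *ᴷ (unit (inv r) *ᴷ -ᴷ 1ᴷ) +ᴷ (unit (inv r) *ᴷ unit r) *ᴷ (s *ᴷ (unit (inv r′) *ᴷ point b)))
            ≡⟨ cong (λ z → ψ (s *ᴷ (unit (inv r) *ᴷ -ᴷ 1ᴷ) +ᴷ z)) (trans (cong (_*ᴷ (s *ᴷ (unit (inv r′) *ᴷ point b))) (unit-inv r)) (F.*-identityˡ _)) ⟩
          ψ (s *ᴷ (unit (inv r) *ᴷ -ᴷ 1ᴷ) +ᴷ s *ᴷ (unit (inv r′) *ᴷ point b))
            ≡⟨ ψ-+ _ _ ⟩
          u s r * ψ (s *ᴷ (unit (inv r′) *ᴷ point b)) ∎

      Det-E : ∀ s w → ∑ (λ r′ → v s r′ * ∑ λ r → N r′ r * u s r) ≡ ι w → Det (E (ι ∘ element-of) s) ≡ ι (d ℤ.+ w)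
      Det-E s w eq = regular-cancel (ι-regular d≢0) (begin
        ι d * Det (E (ι ∘ element-of) s)                                      ≡⟨ *-congˡ (Det-cong (E-rank-one s)) ⟩
        ι d * Det (λ r r′ → M r r′ + u s r * v s r′)                          ≡⟨ Det-rank-one M N (u s) (v s) (ι d) NM ⟩
        (ι d + ∑ (λ r′ → v s r′ * ∑ λ r → N r′ r * u s r)) * Det M            ≡⟨ cong₂ _*_ (trans (+-congˡ eq) (sym (ι.+-homo d w))) (trans (sym (ι.Det-homo (λ r r′ → c (r · inv r′)))) (cong ι Det-c)) ⟩
        ι (d ℤ.+ w) * ι d                                                     ≡⟨ *-comm _ _ ⟩
        ι d * ι (d ℤ.+ w)                                                     ∎)
        where
        open ≡-Reasoning
        NM : ∀ i j → (N ⊗ M) i j ≡ ι d * δ i j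
        NM i j = begin
          ∑ (λ k → ι (c* (i · inv k)) * ι (c (k · inv j)))     ≡⟨ ∑-cong (λ k → ι.*-homo _ _) ⟨
          ∑ (λ k → ι (c* (i · inv k) ℤ.* c (k · inv j)))       ≡⟨ ι.∑-homo _ ⟨
          ι (Dℤ.∑ (λ k → c* (i · inv k) ℤ.* c (k · inv j)))    ≡⟨ cong ι (c*⋆c i j) ⟩
          ι (d ℤ.* Dℤ.δ i j)                                   ≡⟨ trans (ι.*-homo _ _) (*-congˡ (ι-δ i j)) ⟩
          ι d * δ i j                                          ∎

      W₀ : ∑ (λ r′ → v 0ᴷ r′ * ∑ λ r → N r′ r * u 0ᴷ r) ≡ ι (+ m ℤ.* (total ℤ.* σ))
      W₀ = begin
        ∑ (λ r′ → v 0ᴷ r′ * ∑ λ r → N r′ r * u 0ᴷ r)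
          ≡⟨ ∑-cong (λ r′ → cong₂ _*_
               (trans (∑-cong λ b → trans (*-congʳ trivial) (*-identityˡ _)) (sym (ι.∑-homo y)))
               (trans (∑-cong λ r → trans (*-congˡ trivial) (*-identityʳ _)) (trans (sym (ι.∑-homo _)) (cong ι (∑c* r′))))) ⟩
        ∑ {m} (λ r′ → ι total * ι σ)         ≡⟨ ∑-cong {m} (λ _ → ι.*-homo _ _) ⟨
        ∑ {m} (λ r′ → ι (total ℤ.* σ))       ≡⟨ ι.∑-homo {m} (λ _ → total ℤ.* σ) ⟨
        ι (Dℤ.∑ {m} (λ _ → total ℤ.* σ))     ≡⟨ cong ι (∑-const m _) ⟩
        ι (+ m ℤ.* (total ℤ.* σ))            ∎
        where
        open ≡-Reasoning
        trivial : ∀ {x} → ψ (0ᴷ *ᴷ x) ≡ 1#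
        trivial = trans (cong ψ (F.zeroˡ _)) ψ-0

      -- The orthogonality sum over all of K without its term 1 at zero. The frequency t⁻¹ b - 1
      -- vanishes exactly when b = t.
      ∑-units : ∀ b t → ∑ (λ r → ψ (unit (inv r) *ᴷ (unit (inv t) *ᴷ point b +ᴷ -ᴷ 1ᴷ))) ≡
                ι (+ ℕ.suc m) * δ (suc t) b + - 1#
      ∑-units b t = begin
        ∑ (λ r → ψ (unit (inv r) *ᴷ z))                   ≡⟨ ∑-permute _ inverses ⟩
        ∑ (λ r → ψ (unit (inv (inv r)) *ᴷ z))             ≡⟨ ∑-cong (λ r → cong ψ (trans (cong (λ h → unit h *ᴷ z) (inv-inv r)) (F.*-comm _ _))) ⟩
        ∑ (λ r → ψ (z *ᴷ unit r))                         ≡⟨ trans (sym (+-identityʳ _)) (trans (+-congˡ (sym (-‿inverseʳ 1#))) (trans (sym (+-assoc _ _ _)) (+-congʳ (+-comm _ _)))) ⟩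
        1# + ∑ (λ r → ψ (z *ᴷ unit r)) + - 1#             ≡⟨ +-congʳ (trans (∑-suc _) (+-congʳ (trans (cong ψ (trans (cong (z *ᴷ_) point-zero) (F.zeroʳ z))) ψ-0))) ⟨
        ∑ (λ i → ψ (z *ᴷ point i)) + - 1#                 ≡⟨ +-congʳ all ⟩
        ι (+ ℕ.suc m) * δ (suc t) b + - 1#                ∎
        where
        open ≡-Reasoning
        z : K
        z = unit (inv t) *ᴷ point b +ᴷ -ᴷ 1ᴷ
        inv-inv : ∀ h → inv (inv h) ≡ h
        inv-inv h = unit-injective (unit-inv-unique (inv h) (trans (F.*-comm _ _) (unit-inv h)))
        inverses : Fin m ↔ Fin m
        inverses = mk↔ₛ′ inv inv inv-inv inv-inv
        all : ∑ (λ i → ψ (z *ᴷ point i)) ≡ ι (+ ℕ.suc m) * δ (suc t) b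
        all with suc t ≟ b
        ... | yes refl = trans
          (∑-cong λ i → trans (cong ψ (trans (cong (_*ᴷ point i) (trans (cong (_+ᴷ -ᴷ 1ᴷ) (unit-inv t)) (F.-‿inverseʳ 1ᴷ))) (F.zeroˡ _))) ψ-0)
          (trans ∑-1 (sym (*-identityʳ _)))
        ... | no t≢b = trans (ψ-orthogonal z≢0) (sym (zeroʳ _))
          where
          z≢0 : z ≢ 0ᴷ
          z≢0 z≡0 = t≢b (point-injective (begin
            unit t                                      ≡⟨ F.*-identityʳ _ ⟨
            unit t *ᴷ 1ᴷ                                ≡⟨ cong (unit t *ᴷ_) (K.x∙y⁻¹≈ε⇒x≈y _ _ z≡0) ⟨
            unit t *ᴷ (unit (inv t) *ᴷ point b)         ≡⟨ K.solve 3 (λ t i b → t K.:* (i K.:* b) K.:= i K.:* t K.:* b) refl (unit t) (unit (inv t)) (point b) ⟩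
            unit (inv t) *ᴷ unit t *ᴷ point b           ≡⟨ trans (cong (_*ᴷ point b) (unit-inv t)) (F.*-identityˡ _) ⟩
            point b                                     ∎))

      -- In terms of t = r′ r⁻¹ the phase is r⁻¹ (t⁻¹ b - 1), so `∑-units` evaluates the sum over r.
      -- Its diagonal part pairs c*(t) with y at the point t and gives τ; the rest is the product of
      -- the two total sums.
      W₁ : ∑ (λ r′ → v 1ᴷ r′ * ∑ λ r → N r′ r * u 1ᴷ r) ≡ ι (+ ℕ.suc m ℤ.* τ ℤ.- total ℤ.* σ)
      W₁ = begin
        ∑ (λ r′ → v 1ᴷ r′ * ∑ λ r → N r′ r * u 1ᴷ r)
          ≡⟨ ∑-cong (λ r′ → trans (*-distribʳ-∑ _ _) (∑-cong λ b → *-distribˡ-∑ _ _)) ⟩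
        ∑ (λ r′ → ∑ λ b → ∑ λ r → ψ (1ᴷ *ᴷ (unit (inv r′) *ᴷ point b)) * ι (y b) * (N r′ r * u 1ᴷ r))
          ≡⟨ ∑-cong (λ r′ → ∑-cong λ b → ∑-cong λ r → term r′ b r) ⟩
        ∑ (λ r′ → ∑ λ b → ∑ λ r → f b (r′ · inv r) r)
          ≡⟨ ∑-comm _ ⟩
        ∑ (λ b → ∑ λ r′ → ∑ λ r → f b (r′ · inv r) r)
          ≡⟨ ∑-cong (λ b → trans (∑-comm _) (trans (∑-cong λ r → sym (∑-permute (λ t → f b t r) (translation r))) (∑-comm _))) ⟩
        ∑ (λ b → ∑ λ t → ∑ λ r → f b t r)
          ≡⟨ ∑-cong (λ b → ∑-cong λ t → trans (sym (*-distribˡ-∑ _ _)) (trans (*-congˡ (∑-units b t)) (expand b t))) ⟩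
        ∑ (λ b → ∑ λ t → ι (+ ℕ.suc m ℤ.* (c* t ℤ.* y b)) * δ (suc t) b + ι (ℤ.- (y b ℤ.* c* t)))
          ≡⟨ ∑-cong (λ b → ∑-distrib-+ _ _) ⟩
        ∑ (λ b → ∑ (λ t → ι (+ ℕ.suc m ℤ.* (c* t ℤ.* y b)) * δ (suc t) b) + ∑ (λ t → ι (ℤ.- (y b ℤ.* c* t))))
          ≡⟨ ∑-distrib-+ _ _ ⟩
        ∑ (λ b → ∑ (λ t → ι (+ ℕ.suc m ℤ.* (c* t ℤ.* y b)) * δ (suc t) b)) + ∑ (λ b → ∑ (λ t → ι (ℤ.- (y b ℤ.* c* t))))
          ≡⟨ cong₂ _+_
               (trans (∑-comm _) (∑-cong λ t → trans (∑-cong λ b → *-comm _ _) (∑-δˡ (suc t) (λ b → ι (+ ℕ.suc m ℤ.* (c* t ℤ.* y b))))))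
               (∑-cong λ b → trans (sym (ι.∑-homo _)) (cong ι (trans (Dℤ.∑-cong λ t → ℤ.neg-distribˡ-* (y b) (c* t)) (trans (sym (Dℤ.*-distribˡ-∑ (ℤ.- y b) c*)) (cong (ℤ._*_ (ℤ.- y b)) ∑c*′))))) ⟩
        ∑ (λ t → ι (+ ℕ.suc m ℤ.* (c* t ℤ.* y (suc t)))) + ∑ (λ b → ι (ℤ.- y b ℤ.* σ))
          ≡⟨ cong₂ _+_ (sym (ι.∑-homo _)) (sym (ι.∑-homo _)) ⟩
        ι (Dℤ.∑ (λ t → + ℕ.suc m ℤ.* (c* t ℤ.* y (suc t)))) + ι (Dℤ.∑ (λ b → ℤ.- y b ℤ.* σ))
          ≡⟨ sym (ι.+-homo _ _) ⟩
        ι (Dℤ.∑ (λ t → + ℕ.suc m ℤ.* (c* t ℤ.* y (suc t))) ℤ.+ Dℤ.∑ (λ b → ℤ.- y b ℤ.* σ))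
          ≡⟨ cong ι (cong₂ ℤ._+_ (sym (Dℤ.*-distribˡ-∑ (+ ℕ.suc m) _)) negate) ⟩
        ι (+ ℕ.suc m ℤ.* τ ℤ.- total ℤ.* σ) ∎
        where
        open ≡-Reasoning
        f : Fin (ℕ.suc m) → Fin m → Fin m → A
        f b t r = ι (y b ℤ.* c* t) * ψ (unit (inv r) *ᴷ (unit (inv t) *ᴷ point b +ᴷ -ᴷ 1ᴷ))
        term : ∀ r′ b r → ψ (1ᴷ *ᴷ (unit (inv r′) *ᴷ point b)) * ι (y b) * (N r′ r * u 1ᴷ r) ≡ f b (r′ · inv r) r
        term r′ b r = begin
          ψ (1ᴷ *ᴷ (unit (inv r′) *ᴷ point b)) * ι (y b) * (N r′ r * u 1ᴷ r)
            ≡⟨ solve 4 (λ x y n u → x :* y :* (n :* u) := y :* n :* (x :* u)) refl _ (ι (y b)) (N r′ r) (u 1ᴷ r) ⟩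
          ι (y b) * N r′ r * (ψ (1ᴷ *ᴷ (unit (inv r′) *ᴷ point b)) * u 1ᴷ r)
            ≡⟨ cong₂ _*_ (sym (ι.*-homo _ _)) (trans (sym (ψ-+ _ _)) (cong ψ (begin
                 1ᴷ *ᴷ (unit (inv r′) *ᴷ point b) +ᴷ 1ᴷ *ᴷ (unit (inv r) *ᴷ -ᴷ 1ᴷ)
                   ≡⟨ cong₂ _+ᴷ_ (trans (F.*-identityˡ _) (cong (_*ᴷ point b) (trans (sym (F.*-identityˡ _)) (cong (_*ᴷ unit (inv r′)) (sym (unit-inv r)))))) (F.*-identityˡ _) ⟩
                 unit (inv r) *ᴷ unit r *ᴷ unit (inv r′) *ᴷ point b +ᴷ unit (inv r) *ᴷ -ᴷ 1ᴷ
                   ≡⟨ K.solve 5 (λ i r j b n → i K.:* r K.:* j K.:* b K.:+ i K.:* n K.:= i K.:* (j K.:* r K.:* b K.:+ n)) refl (unit (inv r)) (unit r) (unit (inv r′)) (point b) (-ᴷ 1ᴷ) ⟩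
                 unit (inv r) *ᴷ (unit (inv r′) *ᴷ unit r *ᴷ point b +ᴷ -ᴷ 1ᴷ)
                   ≡⟨ cong (λ z → unit (inv r) *ᴷ (z *ᴷ point b +ᴷ -ᴷ 1ᴷ)) (unit-inv-·-inv r′ r) ⟨
                 unit (inv r) *ᴷ (unit (inv (r′ · inv r)) *ᴷ point b +ᴷ -ᴷ 1ᴷ) ∎))) ⟩
          f b (r′ · inv r) r ∎
        expand : ∀ b t → ι (y b ℤ.* c* t) * (ι (+ ℕ.suc m) * δ (suc t) b + - 1#) ≡
                 ι (+ ℕ.suc m ℤ.* (c* t ℤ.* y b)) * δ (suc t) b + ι (ℤ.- (y b ℤ.* c* t))
        expand b t = trans (distribˡ _ _ _) (cong₂ _+_
          (trans (sym (*-assoc _ _ _)) (*-congʳ (trans (sym (ι.*-homo _ _)) (cong ι (shuffle (y b) (c* t) (+ ℕ.suc m))))))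
          (trans (sym (-‿distribʳ-* _ _)) (trans (cong -_ (*-identityʳ _)) (sym (ι.neg-homo _)))))
          where
          shuffle : ∀ y c q → y ℤ.* c ℤ.* q ≡ q ℤ.* (c ℤ.* y)
          shuffle = solve-∀
        negate : Dℤ.∑ (λ b → ℤ.- y b ℤ.* σ) ≡ ℤ.- (total ℤ.* σ)
        negate = begin
          Dℤ.∑ (λ b → ℤ.- y b ℤ.* σ)      ≡⟨ Dℤ.∑-cong (λ b → flip (y b) σ) ⟩
          Dℤ.∑ (λ b → y b ℤ.* ℤ.- σ)      ≡⟨ Dℤ.*-distribʳ-∑ (ℤ.- σ) y ⟨
          total ℤ.* ℤ.- σ                 ≡⟨ ℤ.neg-distribʳ-* total σ ⟨
          ℤ.- (total ℤ.* σ)               ∎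
          where
          flip : ∀ y σ → ℤ.- y ℤ.* σ ≡ y ℤ.* ℤ.- σ
          flip = solve-∀

    linearPart-element : linearPart element-of ≡ d ℤ.+ + m ℤ.* (total ℤ.* σ)
    linearPart-element = ι-injective (trans (sym (Det-E₀ element-of)) (Det-E 0ᴷ _ W₀))

    principalPart-element : principalPart element-of ≡ d ℤ.+ (+ ℕ.suc m ℤ.* τ ℤ.- total ℤ.* σ)
    principalPart-element = ι-injective (trans (sym (Det-E₁ element-of)) (Det-E 1ᴷ _ W₁))

  Realisable : ℤ → ℤ → Set
  Realisable A B = Σ (Affine → ℤ) λ α → linearPart α ≡ A × principalPart α ≡ B

  realisable-≡ : ∀ {A B} → Realisable A B → + ℕ.suc m ∣ B ℤ.- A
  realisable-≡ (α , refl , refl) = principal≡linear α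

  realisable-circulant : ∀ {A B} → Realisable A B → Σ (Fin m → ℤ) λ c → A ≡ Dℤ.Det (λ r r′ → c (r · inv r′))
  realisable-circulant (α , refl , _) = (λ h → Dℤ.∑ λ b → α (aff h (point b))) , refl

  -- If the entries of c* are coprime, y can be chosen with any given total and any given τ.
  realised : (c c* w : Fin m → ℤ) (d σ : ℤ) (e : Fin m) → d ≢ 0ℤ →
    Dℤ.Det (λ r r′ → c (r · inv r′)) ≡ d →
    (∀ r r′ → Dℤ.δ (r · inv r′) e ≡ Dℤ.δ r r′) →
    (∀ h → Dℤ.∑ (λ k → c* (h · inv k) ℤ.* c k) ≡ d ℤ.* Dℤ.δ h e) →
    (∀ h → Dℤ.∑ (λ k → c* (h · inv k)) ≡ σ) → Dℤ.∑ c* ≡ σ →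
    Dℤ.∑ (λ h → c* h ℤ.* w h) ≡ 1ℤ →
    ∀ k t → Realisable (d ℤ.+ + m ℤ.* (k ℤ.* σ)) (d ℤ.+ (+ ℕ.suc m ℤ.* t ℤ.- k ℤ.* σ))
  realised c c* w d σ e d≢0 Det-c δ-e c*⋆c ∑c* ∑c*′ ∑c*w k t =
    R.element-of ,
    trans R.linearPart-element (cong (λ z → d ℤ.+ + m ℤ.* (z ℤ.* σ)) ∑y) ,
    trans R.principalPart-element (cong₂ (λ x z → d ℤ.+ (+ ℕ.suc m ℤ.* x ℤ.- z ℤ.* σ)) τ≡t ∑y)
    where
    open ≡-Reasoning
    y : Fin (ℕ.suc m) → ℤ
    -- The point zero contributes to the total but not to τ, so this coefficient sets the total
    -- freely once τ = t is fixed by the Bézout weights w.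
    y zero    = k ℤ.- t ℤ.* Dℤ.∑ w
    y (suc h) = t ℤ.* w h
    convolution : ∀ r r′ → Dℤ.∑ (λ i → c* (r · inv i) ℤ.* c (i · inv r′)) ≡ d ℤ.* Dℤ.δ r r′
    convolution r r′ = begin
      Dℤ.∑ (λ i → c* (r · inv i) ℤ.* c (i · inv r′))
        ≡⟨ Dℤ.∑-cong (λ i → cong (λ z → c* z ℤ.* c (i · inv r′)) (sym (quotient-translate r i r′))) ⟩
      Dℤ.∑ (λ i → c* ((r · inv r′) · inv (i · inv r′)) ℤ.* c (i · inv r′))
        ≡⟨ Dℤ.∑-permute (λ i → c* ((r · inv r′) · inv i) ℤ.* c i) (translation r′) ⟨
      Dℤ.∑ (λ i → c* ((r · inv r′) · inv i) ℤ.* c i)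
        ≡⟨ c*⋆c (r · inv r′) ⟩
      d ℤ.* Dℤ.δ (r · inv r′) e
        ≡⟨ cong (ℤ._*_ d) (δ-e r r′) ⟩
      d ℤ.* Dℤ.δ r r′ ∎
    module R = Realisation c c* d σ y d≢0 Det-c convolution ∑c* ∑c*′
    ∑y : Dℤ.∑ y ≡ k
    ∑y = trans (Dℤ.∑-suc y) (trans (cong (λ z → k ℤ.- t ℤ.* Dℤ.∑ w ℤ.+ z) (sym (Dℤ.*-distribˡ-∑ t w))) (arith k (t ℤ.* Dℤ.∑ w)))
      where
      arith : ∀ k x → k ℤ.- x ℤ.+ x ≡ k
      arith = solve-∀
    τ≡t : Dℤ.∑ (λ h → c* h ℤ.* (t ℤ.* w h)) ≡ t
    τ≡t = trans (Dℤ.∑-cong λ h → swap (c* h) t (w h)) (trans (sym (Dℤ.*-distribˡ-∑ t (λ h → c* h ℤ.* w h)))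
      (trans (cong (ℤ._*_ t) ∑c*w) (ℤ.*-identityʳ t)))
      where
      swap : ∀ a t w → a ℤ.* (t ℤ.* w) ≡ t ℤ.* (a ℤ.* w)
      swap = solve-∀

  -- G is a variable because comparing types that mention the concrete group unfolds the
  -- Laplace expansion of a 702 × 702 matrix.
  determinants : ∀ {n} {G : FiniteGroup n} (n≡ : m ℕ.* ℕ.suc m ≡ n) → G ≡ subst FiniteGroup n≡ (GA₁ F) → ∀ D →
    IsIntegerGroupDeterminant G D ⇔ (∃₂ λ A B → D ≡ A ℤ.* B ℤ.^ m × Realisable A B)
  determinants refl refl D = mk⇔
    (λ (α , D≡) → linearPart α , principalPart α , trans D≡ (groupDeterminant-factors α) , α , refl , refl)
    (λ (A , B , D≡ , α , linear≡ , principal≡) →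
      α , trans D≡ (sym (trans (groupDeterminant-factors α) (cong₂ (λ x y → x ℤ.* y ℤ.^ m) linear≡ principal≡))))

module AffineDeterminants₂₇
  (F : FiniteField 27) (U : UnitGroup F)
  (C : ComplexRing) (χ : AdditiveCharacter F U (ComplexRing.ring C))
  (ψ-neg : ∀ x → AdditiveCharacter.ψ χ (FiniteField.-_ F x) ≡ Homomorphism.⟦_⟧ (ComplexRing.conjugation C) (AdditiveCharacter.ψ χ x))
  where

  open AffineDeterminants F U C χ ψ-neg public

  determinants₂₇ : (G : FiniteGroup 702) → G ≡ GA₁ F → ∀ D →
    IsIntegerGroupDeterminant G D ⇔ (∃₂ λ A B → D ≡ A ℤ.* B ℤ.^ 26 × Realisable A B)
  determinants₂₇ G = determinants {702} {G} refl

open import Data.Integer.Base using (_+_; _*_; _-_; -_; _^_)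
open Determinant ℤ-ring hiding (_-_)

-- Circulants of order 26 and 13

infixl 7 _⊕_ _⊖_
_⊕_ : ∀ {n} .{{_ : ℕ.NonZero n}} → Fin n → Fin n → Fin n
_⊕_ {n} i j = (toℕ i ℕ.+ toℕ j) mod n

⊝_ : ∀ {n} .{{_ : ℕ.NonZero n}} → Fin n → Fin n
⊝_ {n} i = (n ℕ.∸ toℕ i) mod n

_⊖_ : ∀ {n} .{{_ : ℕ.NonZero n}} → Fin n → Fin n → Fin n
i ⊖ j = i ⊕ ⊝ j

-- The cyclic group C₂ × C₁₃, with (ε , i) at index 13 ε + i.
infixl 7 _·_
_·_ : Fin 26 → Fin 26 → Fin 26
r · s = combine {2} {13} (proj₁ (remQuot {2} 13 r) ⊕ proj₁ (remQuot {2} 13 s)) (proj₂ (remQuot {2} 13 r) ⊕ proj₂ (remQuot {2} 13 s))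

inv : Fin 26 → Fin 26
inv r = combine {2} {13} (proj₁ (remQuot {2} 13 r)) (⊝ proj₂ (remQuot {2} 13 r))

circ₁₃ : (Fin 13 → ℤ) → Mat 13
circ₁₃ p i j = p (i ⊖ j)

circ₂₆ : (Fin 26 → ℤ) → Mat 26
circ₂₆ c r s = c (r · inv s)

component : (Fin 26 → ℤ) → Fin 2 → Fin 13 → ℤ
component c ε i = c (combine {2} {13} ε i)

-- The images in ℤ[C₁₃] under the two characters of C₂.
plus minus : (Fin 26 → ℤ) → Fin 13 → ℤ
plus  c i = component c zero i + component c (suc zero) i
minus c i = component c zero i - component c (suc zero) i

module _ {n : ℕ} where

  Block : Set
  Block = Fin 2 → Fin 2 → Mat n

  blocks : Block → Mat (2 ℕ.* n)
  blocks G x y = G (proj₁ (remQuot n x)) (proj₁ (remQuot n y)) (proj₂ (remQuot {2} n x)) (proj₂ (remQuot {2} n y))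

  blocks-⊗ : ∀ G H x y → let (s , i) = remQuot {2} n x ; (t , j) = remQuot {2} n y in
    (blocks G ⊗ blocks H) x y ≡ (G s zero ⊗ H zero t) i j + (G s (suc zero) ⊗ H (suc zero) t) i j
  blocks-⊗ G H x y = trans (∑-combine 2 n _) (trans (∑-suc _) (cong₂ _+_
    (∑-cong λ k → cong (λ z → term (proj₁ z) (proj₂ z)) (remQuot-combine zero k))
    (trans (∑-suc _) (trans (cong₂ _+_ (∑-cong λ k → cong (λ z → term (proj₁ z) (proj₂ z)) (remQuot-combine (suc zero) k)) (∑-empty _)) (ℤ.+-identityʳ _)))))
    where
    term : Fin 2 → Fin n → ℤ
    term ε k = G (proj₁ (remQuot n x)) ε (proj₂ (remQuot {2} n x)) k * H ε (proj₁ (remQuot n y)) k (proj₂ (remQuot {2} n y))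

  scalar : ℤ → Mat n
  scalar a i j = a * δ i j

  scalar-⊗ : ∀ a (M : Mat n) i j → (scalar a ⊗ M) i j ≡ a * M i j
  scalar-⊗ a M i j = trans (∑-cong λ k → ℤ.*-assoc a (δ i k) (M k j)) (trans (sym (*-distribˡ-∑ a _)) (cong (a *_) (∑-δˡ i λ k → M k j)))

  ⊗-scalar : ∀ a (M : Mat n) i j → (M ⊗ scalar a) i j ≡ a * M i j
  ⊗-scalar a M i j = trans (∑-cong λ k → swap (M i k) a (δ k j)) (trans (sym (*-distribˡ-∑ a _)) (cong (a *_) (∑-δʳ j (M i))))
    where
    swap : ∀ m a d → m * (a * d) ≡ a * (m * d)
    swap = solve-∀

  δ-blocks : ∀ x y → δ (proj₁ (remQuot {2} n x)) (proj₁ (remQuot {2} n y)) * δ (proj₂ (remQuot {2} n x)) (proj₂ (remQuot {2} n y)) ≡ δ x y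
  δ-blocks x y with x ≟ y
  ... | yes refl = cong₂ _*_ (δ-refl (proj₁ (remQuot {2} n x))) (δ-refl (proj₂ (remQuot {2} n x)))
  ... | no x≢y with proj₁ (remQuot {2} n x) ≟ proj₁ (remQuot {2} n y) | proj₂ (remQuot {2} n x) ≟ proj₂ (remQuot {2} n y)
  ...   | no _    | _       = refl
  ...   | yes _   | no _    = refl
  ...   | yes s≡t | yes i≡j = ⊥-elim (x≢y (trans (sym (combine-remQuot {2} n x)) (trans (cong₂ combine s≡t i≡j) (combine-remQuot {2} n y))))

  block₂ : (a b c d : Mat n) → Block
  block₂ a b c d zero    zero    = a
  block₂ a b c d zero    (suc _) = b
  block₂ a b c d (suc _) zero    = c
  block₂ a b c d (suc _) (suc _) = d

  -- Conjugation by (1, -1; 0, 1) makes (X, Y; Y, X) block triangular.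
  Det-symmetric-blocks : ∀ (X Y : Mat n) →
    Det (blocks (block₂ X Y Y X)) ≡ Det (λ i j → X i j - Y i j) * Det (λ i j → X i j + Y i j)
  Det-symmetric-blocks X Y = begin
    Det (blocks W)                            ≡⟨ Det-intertwine refl (blocks W) (blocks E) (blocks P) (blocks Q) {1ℤ} 1-regular PW≡EP PQ≡1 ⟩
    Det (blocks E)                            ≡⟨ Det-block-lower 2 (blocks E) (λ {s} {t} i j s<t → trans (block-entry s i t j) (E-lower s t s<t i j)) ⟩
    _                                         ≡⟨ cong₂ _*_ (Det-cong λ i j → block-entry zero i zero j)
                                                   (trans (ℤ.*-identityʳ _) (Det-cong λ i j → block-entry (suc zero) i (suc zero) j)) ⟩
    Det (λ i j → X i j - Y i j) * Det (λ i j → X i j + Y i j) ∎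
    where
    open ≡-Reasoning
    W E P Q : Block
    W = block₂ X Y Y X
    E = block₂ (λ i j → X i j - Y i j) (λ _ _ → 0ℤ) Y (λ i j → X i j + Y i j)
    P = block₂ (scalar 1ℤ) (scalar (- 1ℤ)) (scalar 0ℤ) (scalar 1ℤ)
    Q = block₂ (scalar 1ℤ) (scalar 1ℤ) (scalar 0ℤ) (scalar 1ℤ)
    block-entry : ∀ s i t j → blocks E (combine s i) (combine t j) ≡ E s t i j
    block-entry s i t j = cong₂ (λ p q → E (proj₁ p) (proj₁ q) (proj₂ p) (proj₂ q)) (remQuot-combine s i) (remQuot-combine t j)
    E-lower : ∀ s t → s Fin.< t → ∀ i j → E s t i j ≡ 0ℤ
    E-lower zero       (suc zero) _ i j = refl
    E-lower (suc zero) (suc zero) (ℕ.s≤s ())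
    PW≡EP : ∀ x y → (blocks P ⊗ blocks W) x y ≡ (blocks E ⊗ blocks P) x y
    PW≡EP x y = trans (blocks-⊗ P W x y) (trans
      (entry (proj₁ (remQuot {2} n x)) (proj₁ (remQuot {2} n y)) (proj₂ (remQuot {2} n x)) (proj₂ (remQuot {2} n y)))
      (sym (blocks-⊗ E P x y)))
      where
      arith₁ : ∀ x y → 1ℤ * x + - 1ℤ * y ≡ 1ℤ * (x - y) + 0ℤ * 0ℤ
      arith₁ = solve-∀
      arith₂ : ∀ x y → 1ℤ * y + - 1ℤ * x ≡ - 1ℤ * (x - y) + 1ℤ * 0ℤ
      arith₂ = solve-∀
      arith₃ : ∀ x y → 0ℤ * x + 1ℤ * y ≡ 1ℤ * y + 0ℤ * (x + y)
      arith₃ = solve-∀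
      arith₄ : ∀ x y → 0ℤ * y + 1ℤ * x ≡ - 1ℤ * y + 1ℤ * (x + y)
      arith₄ = solve-∀
      entry : ∀ s t i j → (P s zero ⊗ W zero t) i j + (P s (suc zero) ⊗ W (suc zero) t) i j ≡
                          (E s zero ⊗ P zero t) i j + (E s (suc zero) ⊗ P (suc zero) t) i j
      entry zero zero i j = trans (cong₂ _+_ (scalar-⊗ 1ℤ X i j) (scalar-⊗ (- 1ℤ) Y i j))
        (trans (arith₁ (X i j) (Y i j)) (sym (cong₂ _+_ (⊗-scalar 1ℤ (E zero zero) i j) (⊗-scalar 0ℤ (E zero (suc zero)) i j))))
      entry zero (suc _) i j = trans (cong₂ _+_ (scalar-⊗ 1ℤ Y i j) (scalar-⊗ (- 1ℤ) X i j))
        (trans (arith₂ (X i j) (Y i j)) (sym (cong₂ _+_ (⊗-scalar (- 1ℤ) (E zero zero) i j) (⊗-scalar 1ℤ (E zero (suc zero)) i j))))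
      entry (suc _) zero i j = trans (cong₂ _+_ (scalar-⊗ 0ℤ X i j) (scalar-⊗ 1ℤ Y i j))
        (trans (arith₃ (X i j) (Y i j)) (sym (cong₂ _+_ (⊗-scalar 1ℤ Y i j) (⊗-scalar 0ℤ (E (suc zero) (suc zero)) i j))))
      entry (suc _) (suc _) i j = trans (cong₂ _+_ (scalar-⊗ 0ℤ Y i j) (scalar-⊗ 1ℤ X i j))
        (trans (arith₄ (X i j) (Y i j)) (sym (cong₂ _+_ (⊗-scalar (- 1ℤ) Y i j) (⊗-scalar 1ℤ (E (suc zero) (suc zero)) i j))))
    PQ≡1 : ∀ x y → (blocks P ⊗ blocks Q) x y ≡ 1ℤ * δ x y
    PQ≡1 x y = trans (blocks-⊗ P Q x y) (trans
      (entry (proj₁ (remQuot {2} n x)) (proj₁ (remQuot {2} n y)) (proj₂ (remQuot {2} n x)) (proj₂ (remQuot {2} n y)))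
      (trans (δ-blocks x y) (sym (ℤ.*-identityˡ (δ x y)))))
      where
      arith₁ : ∀ d → 1ℤ * (1ℤ * d) + - 1ℤ * (0ℤ * d) ≡ 1ℤ * d
      arith₁ = solve-∀
      arith₂ : ∀ d → 1ℤ * (1ℤ * d) + - 1ℤ * (1ℤ * d) ≡ 0ℤ * d
      arith₂ = solve-∀
      arith₃ : ∀ d → 0ℤ * (1ℤ * d) + 1ℤ * (0ℤ * d) ≡ 0ℤ * d
      arith₃ = solve-∀
      arith₄ : ∀ d → 0ℤ * (1ℤ * d) + 1ℤ * (1ℤ * d) ≡ 1ℤ * d
      arith₄ = solve-∀
      entry : ∀ s t i j → (P s zero ⊗ Q zero t) i j + (P s (suc zero) ⊗ Q (suc zero) t) i j ≡ δ s t * δ i j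
      entry zero zero i j = trans (cong₂ _+_ (scalar-⊗ 1ℤ (scalar 1ℤ) i j) (scalar-⊗ (- 1ℤ) (scalar 0ℤ) i j)) (arith₁ (δ i j))
      entry zero (suc zero) i j = trans (cong₂ _+_ (scalar-⊗ 1ℤ (scalar 1ℤ) i j) (scalar-⊗ (- 1ℤ) (scalar 1ℤ) i j)) (arith₂ (δ i j))
      entry (suc zero) zero i j = trans (cong₂ _+_ (scalar-⊗ 0ℤ (scalar 1ℤ) i j) (scalar-⊗ 1ℤ (scalar 0ℤ) i j)) (arith₃ (δ i j))
      entry (suc zero) (suc zero) i j = trans (cong₂ _+_ (scalar-⊗ 0ℤ (scalar 1ℤ) i j) (scalar-⊗ 1ℤ (scalar 1ℤ) i j)) (arith₄ (δ i j))

circ₂₆-blocks : ∀ c r s → circ₂₆ c r s ≡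
  blocks (block₂ (circ₁₃ (component c zero)) (circ₁₃ (component c (suc zero)))
                 (circ₁₃ (component c (suc zero))) (circ₁₃ (component c zero))) r s
circ₂₆-blocks c r s = trans
  (cong (λ z → component c (proj₁ (remQuot {2} 13 r) ⊕ proj₁ z) (proj₂ (remQuot {2} 13 r) ⊕ proj₂ z))
    (remQuot-combine (proj₁ (remQuot {2} 13 s)) (⊝ proj₂ (remQuot {2} 13 s))))
  (case (proj₁ (remQuot {2} 13 r)) (proj₁ (remQuot {2} 13 s)) _ _)
  where
  case : ∀ ε ε′ i j → component c (ε ⊕ ε′) (i ⊖ j) ≡
    block₂ (circ₁₃ (component c zero)) (circ₁₃ (component c (suc zero)))
           (circ₁₃ (component c (suc zero))) (circ₁₃ (component c zero)) ε ε′ i j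
  case zero       zero       i j = refl
  case zero       (suc zero) i j = refl
  case (suc zero) zero       i j = refl
  case (suc zero) (suc zero) i j = refl

Det-circ₂₆ : ∀ c → Det (circ₂₆ c) ≡ Det (circ₁₃ (minus c)) * Det (circ₁₃ (plus c))
Det-circ₂₆ c = trans (Det-cong (circ₂₆-blocks c)) (Det-symmetric-blocks (circ₁₃ (component c zero)) (circ₁₃ (component c (suc zero))))

-- Divisibility of circulant determinants by 2 and 13

Det-≡-mod : ∀ m {n} {M N : Mat n} → (∀ i j → m ∣ₛ M i j - N i j) → m ∣ₛ Det M - Det N
Det-≡-mod m {n} {M} {N} eq = Det-closed (λ f → m ∣ₛ f true - f false)
  (λ f≗g → subst (m ∣ₛ_) (cong₂ _-_ (f≗g true) (f≗g false)))
  (divides 0ℤ refl) (divides 0ℤ refl)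
  (λ {f} {g} p q → subst (m ∣ₛ_) (plus-arith (f true) (f false) (g true) (g false)) (Signed.∣m∣n⇒∣m+n p q))
  (λ {f} {g} p q → subst (m ∣ₛ_) (times-arith (f true) (f false) (g true) (g false))
    (Signed.∣m∣n⇒∣m+n (Signed.∣m⇒∣m*n (g true) p) (Signed.∣n⇒∣m*n (f false) q)))
  (λ {f} p → subst (m ∣ₛ_) (neg-arith (f true) (f false)) (Signed.∣m⇒∣-m p))
  -- The two matrices form a family over `Bool`; congruence of its members is stable under the ring
  -- operations.
  {M = λ { true → M ; false → N }} eq
  where
  plus-arith : ∀ a b c d → (a - b) + (c - d) ≡ (a + c) - (b + d)
  plus-arith = solve-∀
  times-arith : ∀ a b c d → (a - b) * c + b * (c - d) ≡ a * c - b * d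
  times-arith = solve-∀
  neg-arith : ∀ a b → - (a - b) ≡ - a - - b
  neg-arith = solve-∀

∣-transfer : ∀ {m x y} → m ∣ₛ x - y → m ∣ₛ x → m ∣ₛ y
∣-transfer {m} {x} {y} p q = subst (m ∣ₛ_) (arith x y) (Signed.∣m∣n⇒∣m-n q p)
  where
  arith : ∀ x y → x - (x - y) ≡ y
  arith = solve-∀

euclid : ∀ {p} → Prime p → ∀ x y → + p ∣ₛ x * y → + p ∣ₛ x ⊎ + p ∣ₛ y
euclid {p} p-prime x y p∣xy = [ inj₁ ∘ ∣ᵤ⇒∣ , inj₂ ∘ ∣ᵤ⇒∣ ]′
  (euclidsLemma ℤ.∣ x ∣ ℤ.∣ y ∣ p-prime (subst (p ℕ.∣_) (ℤ.abs-* x y) (∣⇒∣ᵤ p∣xy)))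

prime∣∏ : ∀ {p} → Prime p → ∀ {n} x → + p ∣ₛ ∏ {n} (λ _ → x) → + p ∣ₛ x
prime∣∏ p-prime {ℕ.zero} x p∣1 = Signed.∣-trans p∣1 (divides x (sym (ℤ.*-identityʳ x)))
prime∣∏ p-prime {ℕ.suc n} x p∣xs = [ (λ p∣x → p∣x) , prime∣∏ p-prime {n} x ]′ (euclid p-prime x _ p∣xs)

∣-*-∣ : ∀ {k l x y} → k ∣ₛ x → l ∣ₛ y → k * l ∣ₛ x * y
∣-*-∣ {k} {l} (divides q refl) (divides r refl) = divides (q * r) (arith q k r l)
  where
  arith : ∀ q k r l → q * k * (r * l) ≡ q * r * (k * l)
  arith = solve-∀

Det-circ₂₆-even : ∀ c → + 2 ∣ₛ Det (circ₂₆ c) → + 4 ∣ₛ Det (circ₂₆ c)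
Det-circ₂₆-even c 2∣D = subst (+ 4 ∣ₛ_) (sym (Det-circ₂₆ c)) (∣-*-∣ {+ 2} {+ 2} 2∣minus 2∣plus)
  where
  minus≡plus : + 2 ∣ₛ Det (circ₁₃ (minus c)) - Det (circ₁₃ (plus c))
  minus≡plus = Det-≡-mod (+ 2) λ i j → divides (- component c (suc zero) (i ⊖ j)) (arith (component c zero (i ⊖ j)) _)
    where
    arith : ∀ x y → (x - y) - (x + y) ≡ - y * + 2
    arith = solve-∀
  plus≡minus : + 2 ∣ₛ Det (circ₁₃ (plus c)) - Det (circ₁₃ (minus c))
  plus≡minus = subst (+ 2 ∣ₛ_) (arith (Det (circ₁₃ (minus c))) _) (Signed.∣m⇒∣-m minus≡plus)
    where
    arith : ∀ x y → - (x - y) ≡ y - x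
    arith = solve-∀
  either : + 2 ∣ₛ Det (circ₁₃ (minus c)) ⊎ + 2 ∣ₛ Det (circ₁₃ (plus c))
  either = euclid (from-yes (prime? 2)) _ _ (subst (+ 2 ∣ₛ_) (Det-circ₂₆ c) 2∣D)
  2∣minus : + 2 ∣ₛ Det (circ₁₃ (minus c))
  2∣minus = [ (λ p → p) , ∣-transfer plus≡minus ]′ either
  2∣plus : + 2 ∣ₛ Det (circ₁₃ (plus c))
  2∣plus = [ ∣-transfer minus≡plus , (λ p → p) ]′ either

-- Multiplication by p ∈ ℤ[C₁₃], in the basis of the powers (y - 1)ⁱ: the coefficient of
-- (y - 1)ⁱ in yᵃ is the binomial coefficient a over i. Modulo 13 the matrix is triangular,
-- because (y - 1)¹³ vanishes there.

pascal : Vec (Vec ℕ 13) 13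
pascal =
  (1 ∷ 0 ∷  0 ∷   0 ∷   0 ∷   0 ∷   0 ∷   0 ∷   0 ∷   0 ∷  0 ∷  0 ∷ 0 ∷ []) ∷
  (1 ∷ 1 ∷  0 ∷   0 ∷   0 ∷   0 ∷   0 ∷   0 ∷   0 ∷   0 ∷  0 ∷  0 ∷ 0 ∷ []) ∷
  (1 ∷ 2 ∷  1 ∷   0 ∷   0 ∷   0 ∷   0 ∷   0 ∷   0 ∷   0 ∷  0 ∷  0 ∷ 0 ∷ []) ∷
  (1 ∷ 3 ∷  3 ∷   1 ∷   0 ∷   0 ∷   0 ∷   0 ∷   0 ∷   0 ∷  0 ∷  0 ∷ 0 ∷ []) ∷
  (1 ∷ 4 ∷  6 ∷   4 ∷   1 ∷   0 ∷   0 ∷   0 ∷   0 ∷   0 ∷  0 ∷  0 ∷ 0 ∷ []) ∷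
  (1 ∷ 5 ∷ 10 ∷  10 ∷   5 ∷   1 ∷   0 ∷   0 ∷   0 ∷   0 ∷  0 ∷  0 ∷ 0 ∷ []) ∷
  (1 ∷ 6 ∷ 15 ∷  20 ∷  15 ∷   6 ∷   1 ∷   0 ∷   0 ∷   0 ∷  0 ∷  0 ∷ 0 ∷ []) ∷
  (1 ∷ 7 ∷ 21 ∷  35 ∷  35 ∷  21 ∷   7 ∷   1 ∷   0 ∷   0 ∷  0 ∷  0 ∷ 0 ∷ []) ∷
  (1 ∷ 8 ∷ 28 ∷  56 ∷  70 ∷  56 ∷  28 ∷   8 ∷   1 ∷   0 ∷  0 ∷  0 ∷ 0 ∷ []) ∷
  (1 ∷ 9 ∷ 36 ∷  84 ∷ 126 ∷ 126 ∷  84 ∷  36 ∷   9 ∷   1 ∷  0 ∷  0 ∷ 0 ∷ []) ∷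
  (1 ∷ 10 ∷ 45 ∷ 120 ∷ 210 ∷ 252 ∷ 210 ∷ 120 ∷  45 ∷  10 ∷  1 ∷  0 ∷ 0 ∷ []) ∷
  (1 ∷ 11 ∷ 55 ∷ 165 ∷ 330 ∷ 462 ∷ 462 ∷ 330 ∷ 165 ∷  55 ∷ 11 ∷  1 ∷ 0 ∷ []) ∷
  (1 ∷ 12 ∷ 66 ∷ 220 ∷ 495 ∷ 792 ∷ 924 ∷ 792 ∷ 495 ∷ 220 ∷ 66 ∷ 12 ∷ 1 ∷ []) ∷ []

binomial : Fin 13 → Fin 13 → ℤ
binomial a i = + lookup (lookup pascal a) i

pascal-P pascal-Q : Mat 13
pascal-P i a = binomial a i
pascal-Q a i = (- 1ℤ) ^ (toℕ a ℕ.+ toℕ i) * binomial i a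

-- Multiplication by yᵏ in the basis of the (y - 1)ⁱ. By linearity it is enough to check these 13
-- matrices.
pascal-shift : Fin 13 → Mat 13
pascal-shift k i l = sum λ a → pascal-P i a * pascal-Q (a ⊖ k) l

opaque
  pascal-PQ : ∀ i l → sum (λ a → pascal-P i a * pascal-Q a l) ≡ 1ℤ * δ i l
  pascal-PQ = from-yes (all? λ i → all? λ l → sum (λ a → pascal-P i a * pascal-Q a l) ℤ.≟ 1ℤ * δ i l)

  pascal-QP : ∀ i l → sum (λ a → pascal-Q i a * pascal-P a l) ≡ δ i l
  pascal-QP = from-yes (all? λ i → all? λ l → sum (λ a → pascal-Q i a * pascal-P a l) ℤ.≟ δ i l)

  pascal-upper : ∀ k i l → i Fin.< l → + 13 ∣ₛ pascal-shift k i l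
  pascal-upper = from-yes (all? λ k → all? λ i → all? λ l → (i Fin.<? l) →-dec (+ 13 ∣? pascal-shift k i l))

  pascal-diagonal : ∀ k i → + 13 ∣ₛ pascal-shift k i i - 1ℤ
  pascal-diagonal = from-yes (all? λ k → all? λ i → + 13 ∣? (pascal-shift k i i - 1ℤ))

  -- Row zero is the augmentation, which kills every (y - 1)ⁱ with i > 0. It holds over ℤ and not
  -- only modulo 13, so the factor `∑ p` splits off exactly.
  pascal-first : ∀ k l → pascal-shift k zero l ≡ δ zero l
  pascal-first = from-yes (all? λ k → all? λ l → pascal-shift k zero l ℤ.≟ δ zero l)

⊖-involutive : ∀ a k → a ⊖ (a ⊖ k) ≡ k
⊖-involutive = from-yes (all? {n = 13} λ a → all? {n = 13} λ k → a ⊖ (a ⊖ k) ≟ k)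

reflection : Fin 13 → Fin 13 ↔ Fin 13
reflection a = mk↔ₛ′ (a ⊖_) (a ⊖_) (⊖-involutive a) (⊖-involutive a)

module _ (p : Fin 13 → ℤ) where

  pascal-circ : Mat 13
  pascal-circ i l = ∑ λ k → p k * pascal-shift k i l

  pascal-conjugate : ∀ i l → ((pascal-P ⊗ circ₁₃ p) ⊗ pascal-Q) i l ≡ pascal-circ i l
  pascal-conjugate i l = begin
    ((pascal-P ⊗ circ₁₃ p) ⊗ pascal-Q) i l                                        ≡⟨ ⊗-assoc pascal-P (circ₁₃ p) pascal-Q i l ⟩
    ∑ (λ a → pascal-P i a * ∑ λ b → p (a ⊖ b) * pascal-Q b l)                     ≡⟨ ∑-cong (λ a → cong (pascal-P i a *_) (trans (∑-permute _ (reflection a))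
                                                                                       (∑-cong λ k → cong (λ b → p b * pascal-Q (a ⊖ k) l) (⊖-involutive a k)))) ⟩
    ∑ (λ a → pascal-P i a * ∑ λ k → p k * pascal-Q (a ⊖ k) l)                     ≡⟨ ∑-cong (λ a → trans (*-distribˡ-∑ (pascal-P i a) _)
                                                                                       (∑-cong λ k → swap (pascal-P i a) (p k) (pascal-Q (a ⊖ k) l))) ⟩
    ∑ (λ a → ∑ λ k → p k * (pascal-P i a * pascal-Q (a ⊖ k) l))                   ≡⟨ ∑-comm _ ⟩
    ∑ (λ k → ∑ λ a → p k * (pascal-P i a * pascal-Q (a ⊖ k) l))                   ≡⟨ ∑-cong (λ k → trans (sym (*-distribˡ-∑ (p k) _)) (cong (p k *_) (sym (sum≡∑ _)))) ⟩
    pascal-circ i l                                                               ∎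
    where
    open ≡-Reasoning
    swap : ∀ x y z → x * (y * z) ≡ y * (x * z)
    swap = solve-∀

  Det-pascal-circ : Det (circ₁₃ p) ≡ Det pascal-circ
  Det-pascal-circ = Det-intertwine refl (circ₁₃ p) pascal-circ pascal-P pascal-Q {1ℤ} 1-regular
    (λ i j → begin
      (pascal-P ⊗ circ₁₃ p) i j                                          ≡⟨ ∑-δʳ j ((pascal-P ⊗ circ₁₃ p) i) ⟨
      ∑ (λ k → (pascal-P ⊗ circ₁₃ p) i k * δ k j)                        ≡⟨ ∑-cong (λ k → cong ((pascal-P ⊗ circ₁₃ p) i k *_) (trans (sym (pascal-QP k j)) (sum≡∑ _))) ⟩
      ((pascal-P ⊗ circ₁₃ p) ⊗ (pascal-Q ⊗ pascal-P)) i j                ≡⟨ ⊗-assoc (pascal-P ⊗ circ₁₃ p) pascal-Q pascal-P i j ⟨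
      (((pascal-P ⊗ circ₁₃ p) ⊗ pascal-Q) ⊗ pascal-P) i j                ≡⟨ ∑-cong (λ k → cong (_* pascal-P k j) (pascal-conjugate i k)) ⟩
      (pascal-circ ⊗ pascal-P) i j                                       ∎)
    (λ i j → trans (sym (sum≡∑ _)) (pascal-PQ i j))
    where open ≡-Reasoning

  ∑∣ : ∀ {m n} (f : Fin n → ℤ) → (∀ i → m ∣ₛ f i) → m ∣ₛ ∑ f
  ∑∣ {m} {ℕ.zero}  f m∣f = subst (m ∣ₛ_) (sym (∑-empty f)) (divides 0ℤ refl)
  ∑∣ {m} {ℕ.suc n} f m∣f = subst (m ∣ₛ_) (sym (∑-suc f)) (Signed.∣m∣n⇒∣m+n (m∣f zero) (∑∣ (f ∘ suc) (m∣f ∘ suc)))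

  pascal-circ-upper : ∀ i l → i Fin.< l → + 13 ∣ₛ pascal-circ i l
  pascal-circ-upper i l i<l = ∑∣ _ λ k → Signed.∣n⇒∣m*n (p k) (pascal-upper k i l i<l)

  pascal-circ-diagonal : ∀ i → + 13 ∣ₛ pascal-circ i i - ∑ p
  pascal-circ-diagonal i = subst (+ 13 ∣ₛ_) total (∑∣ _ λ k → Signed.∣n⇒∣m*n (p k) (pascal-diagonal k i))
    where
    arith : ∀ x y → x * (y - 1ℤ) ≡ x * y + (- 1ℤ) * x
    arith = solve-∀
    arith′ : ∀ x y → x + (- 1ℤ) * y ≡ x - y
    arith′ = solve-∀
    total : ∑ (λ k → p k * (pascal-shift k i i - 1ℤ)) ≡ pascal-circ i i - ∑ p
    total = trans (∑-cong λ k → arith (p k) (pascal-shift k i i))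
      (trans (∑-distrib-+ _ _) (trans (cong (λ z → pascal-circ i i + z) (sym (*-distribˡ-∑ (- 1ℤ) p))) (arith′ (pascal-circ i i) (∑ p))))

  pascal-circ-first : ∀ l → pascal-circ zero l ≡ ∑ p * δ zero l
  pascal-circ-first l = trans (∑-cong λ k → cong (p k *_) (pascal-first k l)) (sym (*-distribʳ-∑ (δ zero l) p))

  private
    -- A lower triangular matrix congruent modulo 13 to the minor, with the constant diagonal `∑ p`.
    triangle : Mat 12
    triangle i j with Fin.<-cmp i j
    ... | tri< _ _ _ = 0ℤ
    ... | tri≈ _ _ _ = ∑ p
    ... | tri> _ _ _ = minor pascal-circ zero i j

    triangle-≡ : ∀ i j → + 13 ∣ₛ minor pascal-circ zero i j - triangle i j
    triangle-≡ i j with Fin.<-cmp i j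
    ... | tri< i<j _ _  = subst (+ 13 ∣ₛ_) (sym (ℤ.+-identityʳ _)) (pascal-circ-upper (suc i) (suc j) (ℕ.s≤s i<j))
    ... | tri≈ _ refl _ = pascal-circ-diagonal (suc i)
    ... | tri> _ _ _    = divides 0ℤ (ℤ.+-inverseʳ (minor pascal-circ zero i j))

    triangle-lower : ∀ {i j} → i Fin.< j → triangle i j ≡ 0ℤ
    triangle-lower {i} {j} i<j with Fin.<-cmp i j
    ... | tri< _ _ _    = refl
    ... | tri≈ i≮j _ _  = ⊥-elim (i≮j i<j)
    ... | tri> i≮j _ _  = ⊥-elim (i≮j i<j)

    triangle-diagonal : ∀ i → triangle i i ≡ ∑ p
    triangle-diagonal i with Fin.<-cmp i i
    ... | tri< _ i≢i _  = ⊥-elim (i≢i refl)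
    ... | tri≈ _ _ _    = refl
    ... | tri> _ i≢i _  = ⊥-elim (i≢i refl)

    13-prime : Prime 13
    13-prime = from-yes (prime? 13)

  -- The determinant is s N with s = `∑ p` and N ≡ s¹² modulo 13. If 13 divides either factor it
  -- divides s, and then N as well.
  Det-circ₁₃-thirteen : + 13 ∣ₛ Det (circ₁₃ p) → + 169 ∣ₛ Det (circ₁₃ p)
  Det-circ₁₃-thirteen 13∣D = subst (+ 169 ∣ₛ_) (sym factors) (∣-*-∣ {+ 13} {+ 13} 13∣∑ 13∣minor)
    where
    cofactor : ℤ
    cofactor = Det (minor pascal-circ zero)
    factors : Det (circ₁₃ p) ≡ ∑ p * cofactor
    factors = trans Det-pascal-circ (trans
      (Det-first-row pascal-circ λ j → trans (pascal-circ-first (suc j)) (ℤ.*-zeroʳ (∑ p)))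
      (cong (_* cofactor) (trans (pascal-circ-first zero) (ℤ.*-identityʳ (∑ p)))))
    cofactor≡ : + 13 ∣ₛ cofactor - ∏ {12} (λ _ → ∑ p)
    cofactor≡ = subst (λ z → + 13 ∣ₛ cofactor - z) (trans (Det-lower triangle triangle-lower) (∏-cong triangle-diagonal)) (Det-≡-mod (+ 13) triangle-≡)
    13∣∑ : + 13 ∣ₛ ∑ p
    13∣∑ = [ (λ 13∣s → 13∣s) , (λ 13∣c → prime∣∏ 13-prime {12} (∑ p) (∣-transfer cofactor≡ 13∣c)) ]′
      (euclid 13-prime (∑ p) cofactor (subst (+ 13 ∣ₛ_) factors 13∣D))
    13∣minor : + 13 ∣ₛ cofactor
    13∣minor = Signed.∣m+n∣n⇒∣m {m = cofactor} {n = - ∏ {12} (λ _ → ∑ p)} cofactor≡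
      (Signed.∣m⇒∣-m (Signed.∣m⇒∣m*n (∏ {11} (λ _ → ∑ p)) 13∣∑))

Det-circ₂₆-thirteen : ∀ c → + 13 ∣ₛ Det (circ₂₆ c) → + 169 ∣ₛ Det (circ₂₆ c)
Det-circ₂₆-thirteen c 13∣D = subst (+ 169 ∣ₛ_) (sym (Det-circ₂₆ c))
  ([ (λ 13∣m → Signed.∣m⇒∣m*n (Det (circ₁₃ (plus c))) (Det-circ₁₃-thirteen (minus c) 13∣m))
   , (λ 13∣p → Signed.∣n⇒∣m*n (Det (circ₁₃ (minus c))) (Det-circ₁₃-thirteen (plus c) 13∣p))
   ]′ (euclid (from-yes (prime? 13)) (Det (circ₁₃ (minus c))) (Det (circ₁₃ (plus c))) (subst (+ 13 ∣ₛ_) (Det-circ₂₆ c) 13∣D)))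

-- Circulants of elements of ℤ[C₁₃]

⊗-sum : ∀ {n} (M N : Mat n) i j → (M ⊗ N) i j ≡ sum (λ k → M i k * N k j)
⊗-sum M N i j = sym (sum≡∑ _)

translate : Fin 13 → Fin 13 ↔ Fin 13
translate j = mk↔ₛ′ (_⊖ j) (_⊕ j)
  (λ k → from-yes (all? {n = 13} λ j → all? {n = 13} λ k → (k ⊕ j) ⊖ j ≟ k) j k)
  (λ k → from-yes (all? {n = 13} λ j → all? {n = 13} λ k → (k ⊖ j) ⊕ j ≟ k) j k)

⊖-translate : ∀ i j k → (i ⊖ j) ⊖ (k ⊖ j) ≡ i ⊖ k
⊖-translate = from-yes (all? {n = 13} λ i → all? {n = 13} λ j → all? {n = 13} λ k → (i ⊖ j) ⊖ (k ⊖ j) ≟ i ⊖ k)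

infixl 7 _⋆_
_⋆_ : (p q : Fin 13 → ℤ) → Fin 13 → ℤ
(p ⋆ q) i = sum λ k → p (i ⊖ k) * q k

circ₁₃-⊗ : ∀ p q i j → (circ₁₃ p ⊗ circ₁₃ q) i j ≡ circ₁₃ (p ⋆ q) i j
circ₁₃-⊗ p q i j = trans
  (∑-cong λ k → cong (λ z → p z * q (k ⊖ j)) (sym (⊖-translate i j k)))
  (trans (sym (∑-permute (λ k → p ((i ⊖ j) ⊖ k) * q k) (translate j))) (sym (sum≡∑ _)))

opaque
  D₁₃ : (Fin 13 → ℤ) → ℤ
  D₁₃ p = Det (circ₁₃ p)

  D₁₃-Det : ∀ p → D₁₃ p ≡ Det (circ₁₃ p)
  D₁₃-Det p = refl

D₁₃-cong : ∀ {p q} → (∀ i → p i ≡ q i) → D₁₃ p ≡ D₁₃ q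
D₁₃-cong {p} {q} p≗q = trans (D₁₃-Det p) (trans (Det-cong λ i j → p≗q (i ⊖ j)) (sym (D₁₃-Det q)))

D₁₃-⋆ : ∀ p q → D₁₃ (p ⋆ q) ≡ D₁₃ p * D₁₃ q
D₁₃-⋆ p q = trans (D₁₃-Det (p ⋆ q)) (trans (sym (trans (sym (Det-⊗ (circ₁₃ p) (circ₁₃ q))) (Det-cong (circ₁₃-⊗ p q))))
  (sym (cong₂ _*_ (D₁₃-Det p) (D₁₃-Det q))))

dilate : Fin 13 → Fin 13 → Fin 13
dilate a i = (toℕ a ℕ.* toℕ i) mod 13

D₁₃-dilate : ∀ a → a ≢ zero → ∀ p → D₁₃ (p ∘ dilate a) ≡ D₁₃ p
D₁₃-dilate a a≢0 p = trans (D₁₃-Det (p ∘ dilate a)) (trans (trans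
  (Det-cong λ i j → cong p (dilate-⊖ i j))
  (Det-reindex (mk↔ₛ′ (dilate a) (dilate a⁻¹) (inverse a a≢0) (inverse′ a a≢0)) (circ₁₃ p))) (sym (D₁₃-Det p)))
  where
  reciprocal : Fin 13 → Fin 13
  -- By Fermat's little theorem a¹¹ is the inverse of a modulo 13.
  reciprocal a = (toℕ a ℕ.^ 11) mod 13
  a⁻¹ = reciprocal a
  dilate-⊖ : ∀ i j → dilate a (i ⊖ j) ≡ dilate a i ⊖ dilate a j
  dilate-⊖ = from-yes (all? {n = 13} λ a → all? {n = 13} λ i → all? {n = 13} λ j → dilate a (i ⊖ j) ≟ dilate a i ⊖ dilate a j) a
  inverse : ∀ a → a ≢ zero → ∀ i → dilate a (dilate (reciprocal a) i) ≡ i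
  inverse = from-yes (all? {n = 13} λ a → ¬? (a ≟ zero) →-dec all? {n = 13} λ i → dilate a (dilate (reciprocal a) i) ≟ i)
  inverse′ : ∀ a → a ≢ zero → ∀ i → dilate (reciprocal a) (dilate a i) ≡ i
  inverse′ = from-yes (all? {n = 13} λ a → ¬? (a ≟ zero) →-dec all? {n = 13} λ i → dilate (reciprocal a) (dilate a i) ≟ i)

Det-rank-one-sum : ∀ {n} (M N : Mat n) (u v : Fin n → ℤ) d → (∀ i j → sum (λ k → N i k * M k j) ≡ d * δ i j) →
  d * Det (λ i j → M i j + u i * v j) ≡ (d + sum (λ i → v i * sum λ j → N i j * u j)) * Det M
Det-rank-one-sum M N u v d NM≡d = trans
  (Det-rank-one M N u v d λ i j → trans (⊗-sum N M i j) (NM≡d i j))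
  (cong (λ z → (d + z) * Det M) (sym (trans (sum≡∑ _) (∑-cong λ i → cong (v i *_) (sum≡∑ _)))))

[_] : Bool → ℤ
[ b ] = if b then 1ℤ else 0ℤ

-- 1 - yᵃ + t (1 + y + ⋯ + y¹²)
cyclotomic : Fin 13 → ℤ → Fin 13 → ℤ
cyclotomic a t i = [ does (i ≟ zero) ] - [ does (i ≟ a) ] + t

private
  one : Fin 13
  one = suc zero

  -- The circulant of 1 - y is bidiagonal up to its corner entry.
  bidiagonal lower : Mat 13
  bidiagonal i j = [ toℕ i ≡ᵇ toℕ j ] - [ toℕ i ≡ᵇ ℕ.suc (toℕ j) ]
  lower i j = [ toℕ j ≤ᵇ toℕ i ]

  ones : Fin 13 → ℤ
  ones _ = 1ℤ

  step₁ : Mat 13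
  step₁ i j = bidiagonal i j + ones i * ones j

  -- The Sherman-Morrison formula, multiplied by 92 = 1 + 91, where 91 is the sum of the entries of
  -- `lower`, the inverse of `bidiagonal`. The row sums of `lower` are i + 1 and its column sums 13
  -- - j.
  step₁-inverse : Mat 13
  step₁-inverse i j = + 92 * lower i j - + (ℕ.suc (toℕ i) ℕ.* (13 ℕ.∸ toℕ j))

  corner-row corner-column : Fin 13 → ℤ
  corner-row i = [ toℕ i ≡ᵇ 0 ]
  corner-column j = - [ toℕ j ≡ᵇ 12 ]

  -- The inverse of 1 - y + Σ multiplied by 169: the product with 1 - y is 169 - 13 Σ, and the
  -- coefficients sum to 13.
  cofactors : Fin 13 → ℤ
  cofactors i = + 79 - + (13 ℕ.* toℕ i)

  Det-bidiagonal : Det bidiagonal ≡ 1ℤ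
  Det-bidiagonal = trans
    (Det-lower bidiagonal λ {i} {j} → from-yes (all? λ i → all? λ j → (i Fin.<? j) →-dec (bidiagonal i j ℤ.≟ 0ℤ)) i j)
    (∏-cong {13} {g = λ _ → 1ℤ} (from-yes (all? λ i → bidiagonal i i ℤ.≟ 1ℤ)))

  Det-step₁ : Det step₁ ≡ + 92
  Det-step₁ = trans (sym (ℤ.*-identityˡ (Det step₁))) (trans
    (Det-rank-one-sum bidiagonal lower ones ones 1ℤ
      (from-yes (all? λ i → all? λ j → sum (λ k → lower i k * bidiagonal k j) ℤ.≟ 1ℤ * δ i j)))
    (cong (+ 92 *_) Det-bidiagonal))

  -- A second rank one update restores the corner entry -1 in row 0 and column 12. The entry of
  -- `step₁-inverse` in row 12 and column 0 is 92 - 169, so the numerator becomes 92 + 77 = 169.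
  D₁₃-cyclotomic₁₁ : D₁₃ (cyclotomic one 1ℤ) ≡ + 169
  D₁₃-cyclotomic₁₁ = trans (D₁₃-Det _) (ℤ.*-cancelˡ-≡ (+ 92) _ _ (trans
    (cong (+ 92 *_) (Det-cong {N = λ i j → step₁ i j + corner-row i * corner-column j}
      (from-yes (all? λ i → all? λ j → circ₁₃ (cyclotomic one 1ℤ) i j ℤ.≟ step₁ i j + corner-row i * corner-column j))))
    (trans (Det-rank-one-sum step₁ step₁-inverse corner-row corner-column (+ 92)
      (from-yes (all? λ i → all? λ j → sum (λ k → step₁-inverse i k * step₁ k j) ℤ.≟ + 92 * δ i j)))
      (cong (+ 169 *_) Det-step₁))))

  -- Since 1 - y is singular, the update by multiples of Σ starts from t = 1. The value 169 t is 13
  -- t from the trivial character times 13 from the others.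
  D₁₃-cyclotomic₁ : ∀ t → D₁₃ (cyclotomic one t) ≡ + 169 * t
  D₁₃-cyclotomic₁ t = trans (D₁₃-Det _) (ℤ.*-cancelˡ-≡ (+ 169) _ _ (begin
    + 169 * Det (circ₁₃ (cyclotomic one t))
      ≡⟨ cong (+ 169 *_) (Det-cong λ i j → split ([ does ((i ⊖ j) ≟ zero) ] - [ does ((i ⊖ j) ≟ one) ]) t) ⟩
    + 169 * Det (λ i j → circ₁₃ (cyclotomic one 1ℤ) i j + ones i * (t - 1ℤ))
      ≡⟨ Det-rank-one-sum (circ₁₃ (cyclotomic one 1ℤ)) (circ₁₃ cofactors) ones (λ _ → t - 1ℤ) (+ 169)
           (from-yes (all? λ i → all? λ j → sum (λ k → circ₁₃ cofactors i k * circ₁₃ (cyclotomic one 1ℤ) k j) ℤ.≟ + 169 * δ i j)) ⟩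
    (+ 169 + sum (λ i → (t - 1ℤ) * sum λ j → circ₁₃ cofactors i j * ones j)) * Det (circ₁₃ (cyclotomic one 1ℤ))
      ≡⟨ cong₂ (λ x y → (+ 169 + x) * y) total (trans (sym (D₁₃-Det (cyclotomic one 1ℤ))) D₁₃-cyclotomic₁₁) ⟩
    (+ 169 + + 13 * ((t - 1ℤ) * + 13)) * + 169
      ≡⟨ arith t ⟩
    + 169 * (+ 169 * t) ∎))
    where
    open ≡-Reasoning
    split : ∀ x t → x + t ≡ x + 1ℤ + 1ℤ * (t - 1ℤ)
    split = solve-∀
    arith : ∀ t → (+ 169 + + 13 * ((t - 1ℤ) * + 13)) * + 169 ≡ + 169 * (+ 169 * t)
    arith = solve-∀
    total : sum (λ i → (t - 1ℤ) * sum λ j → circ₁₃ cofactors i j * ones j) ≡ + 13 * ((t - 1ℤ) * + 13)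
    total = trans (sum≡∑ _) (trans
      (∑-cong λ i → cong ((t - 1ℤ) *_) (from-yes (all? λ i → sum (λ j → circ₁₃ cofactors i j * ones j) ℤ.≟ + 13) i))
      (∑-const 13 ((t - 1ℤ) * + 13)))

D₁₃-cyclotomic : ∀ a → a ≢ zero → ∀ t → D₁₃ (cyclotomic a t) ≡ + 169 * t
D₁₃-cyclotomic a a≢0 t = trans (sym (D₁₃-dilate a a≢0 (cyclotomic a t))) (trans
  (D₁₃-cong λ i → cong (_+ t) (from-yes (all? λ a → ¬? (a ≟ zero) →-dec all? λ i →
    [ does (dilate a i ≟ zero) ] - [ does (dilate a i ≟ a) ] ℤ.≟ [ does (i ≟ zero) ] - [ does (i ≟ one) ]) a a≢0 i))
  (D₁₃-cyclotomic₁ t))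

-- The sum of y⁷ˡ over l < t.
geometric : ℕ → Fin 13 → ℤ
geometric t i = + ((t ℕ.+ 12 ℕ.∸ (2 ℕ.* toℕ i) % 13) / 13)

-- Telescoping: (1 - y⁷ + Σ) times the sum is 1 - y⁷ᵗ + t Σ. In `geometric` the coefficient of yⁱ
-- counts the l < t with l ≡ 2 i modulo 13, as 2 is inverse to 7.
D₁₃-geometric : ∀ t → (7 ℕ.* t) mod 13 ≢ zero →
  (∀ i → (cyclotomic (7 mod 13) 1ℤ ⋆ geometric t) i ≡ cyclotomic ((7 ℕ.* t) mod 13) (+ t) i) →
  D₁₃ (geometric t) ≡ + t
D₁₃-geometric t t≢0 eq = ℤ.*-cancelˡ-≡ (+ 169) (D₁₃ (geometric t)) (+ t) (begin
  + 169 * D₁₃ (geometric t)                                     ≡⟨ cong (_* D₁₃ (geometric t)) (D₁₃-cyclotomic (7 mod 13) (λ ()) 1ℤ) ⟨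
  D₁₃ (cyclotomic (7 mod 13) 1ℤ) * D₁₃ (geometric t)            ≡⟨ D₁₃-⋆ (cyclotomic (7 mod 13) 1ℤ) (geometric t) ⟨
  D₁₃ (cyclotomic (7 mod 13) 1ℤ ⋆ geometric t)                  ≡⟨ D₁₃-cong eq ⟩
  D₁₃ (cyclotomic ((7 ℕ.* t) mod 13) (+ t))                     ≡⟨ D₁₃-cyclotomic ((7 ℕ.* t) mod 13) t≢0 (+ t) ⟩
  + 169 * + t                                                   ∎)
  where open ≡-Reasoning

-- 1 + yᵃ
binary : Fin 13 → Fin 13 → ℤ
binary a i = [ does (i ≟ zero) ] + [ does (i ≟ a) ]

-- An automorphism of C₁₃ carries 1 + yᵃ to 1 + y⁷, the geometric sum of length 2.
D₁₃-binary : ∀ a → a ≢ zero → D₁₃ (binary a) ≡ + 2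
D₁₃-binary a a≢0 = begin
  D₁₃ (binary a)                             ≡⟨ D₁₃-dilate a a≢0 (binary a) ⟨
  D₁₃ (binary a ∘ dilate a)                  ≡⟨ D₁₃-cong (agree a a≢0) ⟩
  D₁₃ (geometric 2 ∘ dilate (7 mod 13))      ≡⟨ D₁₃-dilate (7 mod 13) (λ ()) (geometric 2) ⟩
  D₁₃ (geometric 2)                          ≡⟨ D₁₃-geometric 2 (λ ()) (from-yes (all? λ i →
                                                  (cyclotomic (7 mod 13) 1ℤ ⋆ geometric 2) i ℤ.≟ cyclotomic (14 mod 13) (+ 2) i)) ⟩
  + 2                                        ∎
  where
  open ≡-Reasoning
  agree : ∀ a → a ≢ zero → ∀ i → binary a (dilate a i) ≡ geometric 2 (dilate (7 mod 13) i)
  agree = from-yes (all? λ a → ¬? (a ≟ zero) →-dec all? λ i → binary a (dilate a i) ℤ.≟ geometric 2 (dilate (7 mod 13) i))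

-- The base elements of ℤ[C₂₆]

-- The units modulo 26, each with its inverse.
inverse-pairs : Vec (ℕ × ℕ) 12
inverse-pairs = (1 , 1) ∷ (3 , 9) ∷ (5 , 21) ∷ (7 , 15) ∷ (9 , 3) ∷ (11 , 19) ∷
                (15 , 7) ∷ (17 , 23) ∷ (19 , 11) ∷ (21 , 5) ∷ (23 , 17) ∷ (25 , 25) ∷ []

-- The index (ε , i) is the exponent 13 ε + 2 i of the generator x of C₂₆, whose square is y.
exponent : Fin 26 → ℕ
exponent h = (13 ℕ.* toℕ (proj₁ (remQuot {2} 13 h)) ℕ.+ 2 ℕ.* toℕ (proj₂ (remQuot {2} 13 h))) % 26

-- In terms of the sum Σ of all group elements, unit stands for 1 + x + ⋯ + xʲ⁻¹ and twice for
-- (1 + x²) (1 + x + ⋯ + xʲ⁻¹) + Σ, where j runs over the units modulo 26; twentysix stands for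
-- 1 - x + 2 Σ, and thirteen for the element with the images (1 - y + Σ) (1 + y² + ⋯ + y¹²) and 1
-- in ℤ[C₁₃] under the two characters of C₂.
data Base : Set where
  unit twice : Fin 12 → Base
  thirteen twentysix : Base

inverse-pair : Fin 12 → ℕ × ℕ
inverse-pair = lookup inverse-pairs

indicator : ℕ → Fin 26 → ℤ
indicator j h = [ exponent h <ᵇ j ]

-- The inverse of 1 + x + ⋯ + xʲ⁻¹ up to a multiple of Σ is 1 + xʲ + ⋯ + xʲ⁽ʲ′⁻¹⁾.
inverse-indicator : ℕ → ℕ → ℕ → ℤ
inverse-indicator j′ a e = [ ((j′ ℕ.* (e ℕ.+ a)) % 26) <ᵇ j′ ]

-- For `thirteen`, the factor 1 + y² + ⋯ + y¹² makes the first image congruent to 1 modulo 2, so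
-- that the two images come from one element of ℤ[C₂₆]. For `twentysix`, the coefficient 2 of Σ
-- makes the adjugate primitive: with Σ alone its entries would be 326 - 26 e, all even.
coefficient : Base → Fin 26 → ℤ
coefficient (unit k) h = let (j , _) = inverse-pair k in indicator j h
coefficient (twice k) h = let (j , _) = inverse-pair k in
  indicator j h + [ ((exponent h ℕ.+ 24) % 26) <ᵇ j ] + 1ℤ
coefficient thirteen h = let (ε , i) = remQuot {2} 13 h in
  + (3 ℕ.+ (ℕ.suc (toℕ i)) % 2) - [ toℕ ε ℕ.* 13 ℕ.+ toℕ i ≡ᵇ 13 ]
coefficient twentysix h = + 2 + [ exponent h ≡ᵇ 0 ] - [ exponent h ≡ᵇ 1 ]

-- The numbers d and σ. In each case σ is d divided by the coefficient sum: j, 2 (j + 13), 91 and 52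
-- for the four kinds.
determinant content : Base → ℤ
determinant (unit k) = let (j , _) = inverse-pair k in + j
determinant (twice k) = let (j , _) = inverse-pair k in + (4 ℕ.* (j ℕ.+ 13))
determinant thirteen = + 1183
determinant twentysix = + 1352

content (unit k) = + 1
content (twice k) = + 2
content thirteen = + 13
content twentysix = + 26

-- The inverse of the group ring element, multiplied by its determinant. For twice, note that
-- 1 + x² is inverted by 1 + x⁴ + ⋯ + x²⁴ up to multiples of the sum of all even powers of x.
adjugate : Base → Fin 26 → ℤ
adjugate (unit k) h = let (j , j′) = inverse-pair k in
  + j * inverse-indicator j′ 0 (exponent h) - + (j ℕ.* j′ / 26)
adjugate (twice k) h = let (j , j′) = inverse-pair k in
  + (4 ℕ.* (j ℕ.+ 13)) * (sum {7} λ a → inverse-indicator j′ (22 ℕ.* toℕ a) (exponent h))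
    - + (1 ℕ.+ 28 ℕ.* (j ℕ.* j′ / 26) ℕ.+ 14 ℕ.* j′)
    - + (j ℕ.+ 13) * (- 1ℤ) ^ exponent h
adjugate thirteen h = let (ε , i) = remQuot {2} 13 h in
  + 592 - + (91 ℕ.* toℕ i) - + 1183 * [ toℕ ε ℕ.* 13 ℕ.+ toℕ i ≡ᵇ 13 ]
adjugate twentysix h = + 651 - + (52 ℕ.* exponent h)

-- Bézout coefficients for the adjugate. For `unit` its entries already sum to 1. For `twice` they
-- sum to 2 and the entry at 0 is odd, so that entry plus a constant multiple of the sum gives 1.
-- The others combine neighbouring entries: 3 · 46 - 137 and -12 · 27 + 13 · 25.
weight : Base → Fin 26 → ℤ
weight (unit k) h = 1ℤ
weight (twice k) h = let (j , j′) = inverse-pair k in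
  [ toℕ h ≡ᵇ 0 ] + + ((1 ℕ.+ 28 ℕ.* (j ℕ.* j′ / 26) ℕ.+ 14 ℕ.* j′ ℕ.+ (j ℕ.+ 13) ℕ.+ 1) / 2)
    - + (2 ℕ.* (j ℕ.+ 13)) * (sum {7} λ a → inverse-indicator j′ (22 ℕ.* toℕ a) 0)
weight thirteen h = + 3 * [ toℕ h ≡ᵇ 6 ] - [ toℕ h ≡ᵇ 5 ]
weight twentysix h = - (+ 12 * [ exponent h ≡ᵇ 12 ]) - + 13 * [ exponent h ≡ᵇ 13 ]

module _ (P : Base → Set) (P? : ∀ b → Dec (P b)) where
  all-bases? : Dec (∀ b → P b)
  all-bases? = map′
    (λ { (u , t , p , q) → λ { (unit k) → u k ; (twice k) → t k ; thirteen → p ; twentysix → q } })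
    (λ f → f ∘ unit , f ∘ twice , f thirteen , f twentysix)
    (all? (P? ∘ unit) ×-dec all? (P? ∘ twice) ×-dec P? thirteen ×-dec P? twentysix)

  any-base? : Dec (∃[ b ] P b)
  any-base? = map′
    (λ { (inj₁ (k , p)) → unit k , p ; (inj₂ (inj₁ (k , p))) → twice k , p ; (inj₂ (inj₂ (inj₁ p))) → thirteen , p ; (inj₂ (inj₂ (inj₂ p))) → twentysix , p })
    (λ { (unit k , p) → inj₁ (k , p) ; (twice k , p) → inj₂ (inj₁ (k , p)) ; (thirteen , p) → inj₂ (inj₂ (inj₁ p)) ; (twentysix , p) → inj₂ (inj₂ (inj₂ p)) })
    (any? (P? ∘ unit) ⊎-dec any? (P? ∘ twice) ⊎-dec P? thirteen ⊎-dec P? twentysix)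

opaque
  -- Let j j′ = 26 q + 1. For `unit`, 1 + x + ⋯ + xʲ⁻¹ times its partner is 1 + q Σ, and subtracting
  -- q Σ from j times the partner corrects this. For `twice`, (1 + x²)(1 + x⁴ + ⋯ + x²⁴) is 1 plus
  -- the sum of the even powers, which is half of Σ plus half of the alternating sum of the xᵉ. The
  -- element acts on these two by 2 (j + 13) and 2, which determines both corrections.
  adjugate-coefficient : ∀ b h → sum (λ k → adjugate b (h · inv k) * coefficient b k) ≡ determinant b * δ h zero
  adjugate-coefficient = from-yes (all-bases? _ λ b → all? λ h →
    sum (λ k → adjugate b (h · inv k) * coefficient b k) ℤ.≟ determinant b * δ h zero)

  adjugate-content : ∀ b r → sum (λ k → adjugate b (r · inv k)) ≡ content b
  adjugate-content = from-yes (all-bases? _ λ b → all? λ r → sum (λ k → adjugate b (r · inv k)) ℤ.≟ content b)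

  adjugate-sum : ∀ b → sum (adjugate b) ≡ content b
  adjugate-sum = from-yes (all-bases? _ λ b → sum (adjugate b) ℤ.≟ content b)

  adjugate-weight : ∀ b → sum (λ k → adjugate b k * weight b k) ≡ 1ℤ
  adjugate-weight = from-yes (all-bases? _ λ b → sum (λ k → adjugate b k * weight b k) ℤ.≟ 1ℤ)

  determinant≢0 : ∀ b → determinant b ≢ 0ℤ
  determinant≢0 = from-yes (all-bases? _ λ b → ¬? (determinant b ℤ.≟ 0ℤ))

private
  odd : Fin 12 → ℕ
  odd k = proj₁ (inverse-pair k)

  sevenfold : ℕ → Fin 13
  sevenfold t = (7 ℕ.* t) mod 13

opaque
  geometric-check : ∀ k i → (cyclotomic (7 mod 13) 1ℤ ⋆ geometric (odd k)) i ≡ cyclotomic (sevenfold (odd k)) (+ odd k) i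
  geometric-check = from-yes (all? λ k → all? λ i →
    (cyclotomic (7 mod 13) 1ℤ ⋆ geometric (odd k)) i ℤ.≟ cyclotomic (sevenfold (odd k)) (+ odd k) i)

  geometric-check′ : ∀ k i → (cyclotomic (7 mod 13) 1ℤ ⋆ geometric (odd k ℕ.+ 13)) i ≡ cyclotomic (sevenfold (odd k ℕ.+ 13)) (+ (odd k ℕ.+ 13)) i
  geometric-check′ = from-yes (all? λ k → all? λ i →
    (cyclotomic (7 mod 13) 1ℤ ⋆ geometric (odd k ℕ.+ 13)) i ℤ.≟ cyclotomic (sevenfold (odd k ℕ.+ 13)) (+ (odd k ℕ.+ 13)) i)

  sevenfold≢0 : ∀ k → sevenfold (odd k) ≢ zero
  sevenfold≢0 = from-yes (all? λ k → ¬? (sevenfold (odd k) ≟ zero))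

  sevenfold≢0′ : ∀ k → sevenfold (odd k ℕ.+ 13) ≢ zero
  sevenfold≢0′ = from-yes (all? λ k → ¬? (sevenfold (odd k ℕ.+ 13) ≟ zero))

  plus-unit : ∀ k i → plus (coefficient (unit k)) i ≡ geometric (odd k) i
  plus-unit = from-yes (all? λ k → all? λ i → plus (coefficient (unit k)) i ℤ.≟ geometric (odd k) i)

  -- As 13 + 2 · 7 ≡ 1 modulo 26, the sign character of C₂ sends x to -y⁷. Since j is odd, the
  -- product with 1 + y⁷ telescopes to 1 + y⁷ʲ.
  minus-unit : ∀ k i → (binary (7 mod 13) ⋆ minus (coefficient (unit k))) i ≡ binary (sevenfold (odd k)) i
  minus-unit = from-yes (all? λ k → all? λ i → (binary (7 mod 13) ⋆ minus (coefficient (unit k))) i ℤ.≟ binary (sevenfold (odd k)) i)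

  -- The sum over C₂₆ maps to twice the sum over C₁₃. That equals 1 + y times one more period, which
  -- lengthens the geometric sum by 13.
  plus-twice : ∀ k i → plus (coefficient (twice k)) i ≡ (binary (1 mod 13) ⋆ geometric (odd k ℕ.+ 13)) i
  plus-twice = from-yes (all? λ k → all? λ i → plus (coefficient (twice k)) i ℤ.≟ (binary (1 mod 13) ⋆ geometric (odd k ℕ.+ 13)) i)

  minus-twice : ∀ k i → minus (coefficient (twice k)) i ≡ (binary (1 mod 13) ⋆ minus (coefficient (unit k))) i
  minus-twice = from-yes (all? λ k → all? λ i → minus (coefficient (twice k)) i ℤ.≟ (binary (1 mod 13) ⋆ minus (coefficient (unit k))) i)

  -- As 10 · 2 ≡ 7 modulo 13, the dilation turns powers of y⁷ into powers of y².
  plus-thirteen : ∀ i → plus (coefficient thirteen) i ≡ (cyclotomic (1 mod 13) 1ℤ ⋆ (geometric 7 ∘ dilate (10 mod 13))) i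
  plus-thirteen = from-yes (all? λ i → plus (coefficient thirteen) i ℤ.≟ (cyclotomic (1 mod 13) 1ℤ ⋆ (geometric 7 ∘ dilate (10 mod 13))) i)

  minus-thirteen : ∀ i → minus (coefficient thirteen) i ≡ geometric 1 i
  minus-thirteen = from-yes (all? λ i → minus (coefficient thirteen) i ℤ.≟ geometric 1 i)

  plus-twentysix : ∀ i → plus (coefficient twentysix) i ≡ cyclotomic (7 mod 13) (+ 4) i
  plus-twentysix = from-yes (all? λ i → plus (coefficient twentysix) i ℤ.≟ cyclotomic (7 mod 13) (+ 4) i)

  minus-twentysix : ∀ i → minus (coefficient twentysix) i ≡ binary (7 mod 13) i
  minus-twentysix = from-yes (all? λ i → minus (coefficient twentysix) i ℤ.≟ binary (7 mod 13) i)

  geometric-check₁ : ∀ i → (cyclotomic (7 mod 13) 1ℤ ⋆ geometric 1) i ≡ cyclotomic (sevenfold 1) (+ 1) i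
  geometric-check₁ = from-yes (all? λ i → (cyclotomic (7 mod 13) 1ℤ ⋆ geometric 1) i ℤ.≟ cyclotomic (sevenfold 1) (+ 1) i)

  geometric-check₇ : ∀ i → (cyclotomic (7 mod 13) 1ℤ ⋆ geometric 7) i ≡ cyclotomic (sevenfold 7) (+ 7) i
  geometric-check₇ = from-yes (all? λ i → (cyclotomic (7 mod 13) 1ℤ ⋆ geometric 7) i ℤ.≟ cyclotomic (sevenfold 7) (+ 7) i)

D₁₃-minus-unit : ∀ k → D₁₃ (minus (coefficient (unit k))) ≡ 1ℤ
D₁₃-minus-unit k = ℤ.*-cancelˡ-≡ (+ 2) _ _ (begin
  + 2 * D₁₃ (minus (coefficient (unit k)))                        ≡⟨ cong (_* D₁₃ (minus (coefficient (unit k)))) (D₁₃-binary (7 mod 13) (λ ())) ⟨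
  D₁₃ (binary (7 mod 13)) * D₁₃ (minus (coefficient (unit k)))    ≡⟨ D₁₃-⋆ (binary (7 mod 13)) (minus (coefficient (unit k))) ⟨
  D₁₃ (binary (7 mod 13) ⋆ minus (coefficient (unit k)))          ≡⟨ D₁₃-cong (minus-unit k) ⟩
  D₁₃ (binary (sevenfold (odd k)))                                ≡⟨ D₁₃-binary (sevenfold (odd k)) (sevenfold≢0 k) ⟩
  + 2                                                             ∎)
  where open ≡-Reasoning

D₁₃-coefficient : ∀ b → D₁₃ (minus (coefficient b)) * D₁₃ (plus (coefficient b)) ≡ determinant b
D₁₃-coefficient (unit k) = trans
  (cong₂ _*_ (D₁₃-minus-unit k) (trans (D₁₃-cong (plus-unit k)) (D₁₃-geometric (odd k) (sevenfold≢0 k) (geometric-check k))))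
  (ℤ.*-identityˡ (+ odd k))
D₁₃-coefficient (twice k) = trans
  (cong₂ _*_
    (trans (D₁₃-cong (minus-twice k)) (trans (D₁₃-⋆ (binary (1 mod 13)) (minus (coefficient (unit k))))
      (cong₂ _*_ (D₁₃-binary (1 mod 13) (λ ())) (D₁₃-minus-unit k))))
    (trans (D₁₃-cong (plus-twice k)) (trans (D₁₃-⋆ (binary (1 mod 13)) (geometric (odd k ℕ.+ 13)))
      (cong₂ _*_ (D₁₃-binary (1 mod 13) (λ ())) (D₁₃-geometric (odd k ℕ.+ 13) (sevenfold≢0′ k) (geometric-check′ k))))))
  (arith (odd k ℕ.+ 13))
  where
  arith : ∀ n → + 2 * 1ℤ * (+ 2 * + n) ≡ + (4 ℕ.* n)
  arith n = trans (ring (+ n)) (sym (ℤ.pos-* 4 n))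
    where
    ring : ∀ x → + 2 * 1ℤ * (+ 2 * x) ≡ + 4 * x
    ring = solve-∀
D₁₃-coefficient thirteen = cong₂ _*_
  (trans (D₁₃-cong minus-thirteen) (D₁₃-geometric 1 (λ ()) geometric-check₁))
  (trans (D₁₃-cong plus-thirteen) (trans (D₁₃-⋆ (cyclotomic (1 mod 13) 1ℤ) (geometric 7 ∘ dilate (10 mod 13)))
    (cong₂ _*_ (D₁₃-cyclotomic (1 mod 13) (λ ()) 1ℤ)
      (trans (D₁₃-dilate (10 mod 13) (λ ()) (geometric 7)) (D₁₃-geometric 7 (λ ()) geometric-check₇)))))
D₁₃-coefficient twentysix = cong₂ _*_
  (trans (D₁₃-cong minus-twentysix) (D₁₃-binary (7 mod 13) (λ ())))
  (trans (D₁₃-cong plus-twentysix) (D₁₃-cyclotomic (7 mod 13) (λ ()) (+ 4)))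

Det-coefficient : ∀ b → Det (circ₂₆ (coefficient b)) ≡ determinant b
Det-coefficient b = trans (Det-circ₂₆ (coefficient b))
  (trans (sym (cong₂ _*_ (D₁₃-Det (minus (coefficient b))) (D₁₃-Det (plus (coefficient b))))) (D₁₃-coefficient b))

-- The field with 27 elements

-- In base 3 digits: 0, then the powers yⁱ and - yⁱ for y = x².
powers logarithms : Vec (Fin 27) 27
powers = Vec.map (_mod 27)
  (0 ∷ 9 ∷ 1 ∷ 7 ∷ 13 ∷ 20 ∷ 4 ∷ 19 ∷ 6 ∷ 15 ∷ 16 ∷ 14 ∷ 24 ∷ 17 ∷ 18 ∷ 2 ∷ 5 ∷ 26 ∷ 10 ∷ 8 ∷ 11 ∷ 3 ∷ 21 ∷ 23 ∷ 25 ∷ 12 ∷ 22 ∷ [])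
logarithms = Vec.map (_mod 27)
  (0 ∷ 2 ∷ 15 ∷ 21 ∷ 6 ∷ 16 ∷ 8 ∷ 3 ∷ 19 ∷ 1 ∷ 18 ∷ 20 ∷ 25 ∷ 4 ∷ 11 ∷ 9 ∷ 10 ∷ 13 ∷ 14 ∷ 7 ∷ 5 ∷ 22 ∷ 26 ∷ 23 ∷ 12 ∷ 24 ∷ 17 ∷ [])

units₂₇ : UnitGroup 𝔽₂₇.field₂₇
units₂₇ = record
  { points     = FiniteField.enumeration 𝔽₂₇.field₂₇ ↔-∘ mk↔ₛ′ (lookup powers) (lookup logarithms)
                   (from-yes (all? λ i → lookup powers (lookup logarithms i) ≟ i))
                   (from-yes (all? λ i → lookup logarithms (lookup powers i) ≟ i))
  ; _·_        = _·_
  ; inv        = inv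
  ; point-zero = refl
  ; unit-·     = from-yes (all? λ h → all? λ k → power (h · k) ≟ᵗ (power h 𝔽₂₇.* power k))
  ; unit-inv   = from-yes (all? λ h → (power (inv h) 𝔽₂₇.* power h) ≟ᵗ 𝔽₂₇.1#)
  }
  where
  open 𝔽₂₇ using (_≟ᵗ_)
  power : Fin 26 → Triple (Fin 3)
  power h = Inverse.to (FiniteField.enumeration 𝔽₂₇.field₂₇) (lookup powers (suc h))

ω^ : Fin 3 → Eisenstein
ω^ zero             = 1ℤ , 0ℤ
ω^ (suc zero)       = 0ℤ , 1ℤ
ω^ (suc (suc zero)) = - 1ℤ , - 1ℤ

-- Any nonzero linear functional to 𝔽₃ gives a nontrivial character; here it is the constant
-- coefficient.
ψ₂₇ : Triple (Fin 3) → Eisenstein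
ψ₂₇ (a , _) = ω^ a

ω^-+ : ∀ a b → ω^ (a 𝔽₃.+ b) ≡ ω^ a *ω ω^ b
ω^-+ = from-yes (all? λ a → all? λ b → ≡-dec ℤ._≟_ ℤ._≟_ (ω^ (a 𝔽₃.+ b)) (ω^ a *ω ω^ b))

ω^-neg : ∀ a → ω^ (𝔽₃.- a) ≡ Homomorphism.⟦_⟧ Eisenstein-conjugation (ω^ a)
ω^-neg = from-yes (all? λ a → ≡-dec ℤ._≟_ ℤ._≟_ (ω^ (𝔽₃.- a)) (Homomorphism.⟦_⟧ Eisenstein-conjugation (ω^ a)))

power-orthogonal : ∀ h → Determinant.∑ Eisenstein-ring (λ b → ψ₂₇ (UnitGroup.unit units₂₇ h 𝔽₂₇.* UnitGroup.point units₂₇ b)) ≡ (0ℤ , 0ℤ)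
power-orthogonal = check
  where
  opaque
    unfolding Determinant.∑
    check : ∀ h → Determinant.∑ Eisenstein-ring (λ b → ψ₂₇ (UnitGroup.unit units₂₇ h 𝔽₂₇.* UnitGroup.point units₂₇ b)) ≡ (0ℤ , 0ℤ)
    check = from-yes (all? λ h → ≡-dec ℤ._≟_ ℤ._≟_
      (Determinant.∑ Eisenstein-ring (λ b → ψ₂₇ (UnitGroup.unit units₂₇ h 𝔽₂₇.* UnitGroup.point units₂₇ b))) (0ℤ , 0ℤ))

ψ₂₇-orthogonal : ∀ {s} → s ≢ 𝔽₂₇.0# → Determinant.∑ Eisenstein-ring (λ b → ψ₂₇ (s 𝔽₂₇.* UnitGroup.point units₂₇ b)) ≡ (0ℤ , 0ℤ)
ψ₂₇-orthogonal {s} s≢0 = trans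
  (Determinant.∑-cong Eisenstein-ring λ b → cong (λ x → ψ₂₇ (x 𝔽₂₇.* UnitGroup.point units₂₇ b)) (sym (UnitGroup.unit-log units₂₇ s s≢0)))
  (power-orthogonal (UnitGroup.log units₂₇ s s≢0))

character₂₇ : AdditiveCharacter 𝔽₂₇.field₂₇ units₂₇ Eisenstein-ring
character₂₇ = record
  { ψ            = ψ₂₇
  ; ψ-0          = refl
  ; ψ-+          = λ x y → ω^-+ (proj₁ x) (proj₁ y)
  ; ψ-orthogonal = ψ₂₇-orthogonal
  }

ψ₂₇-neg : ∀ x → ψ₂₇ (FiniteField.-_ 𝔽₂₇.field₂₇ x) ≡ Homomorphism.⟦_⟧ Eisenstein-conjugation (ψ₂₇ x)
ψ₂₇-neg x = ω^-neg (proj₁ x)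

module GA₂₇ = AffineDeterminants₂₇ 𝔽₂₇.field₂₇ units₂₇ Eisenstein-complex character₂₇ ψ₂₇-neg

-- Admissible residues modulo 676

Admissible : ℤ → Set
Admissible A = (+ 2 ∣ₛ A → + 4 ∣ₛ A) × (+ 13 ∣ₛ A → + 169 ∣ₛ A)

circulant-admissible : ∀ c → Admissible (Det (circ₂₆ c))
circulant-admissible c = Det-circ₂₆-even c , Det-circ₂₆-thirteen c

circulant-Det : ∀ c → Determinant.Det ℤ-ring (λ r s → c (UnitGroup._·_ units₂₇ r (UnitGroup.inv units₂₇ s))) ≡ Det (circ₂₆ c)
circulant-Det c = Det-cong λ r s → refl

realisable-admissible : ∀ {A B} → GA₂₇.Realisable A B → Admissible A
realisable-admissible {A} realisable = conclude (GA₂₇.realisable-circulant realisable)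
  where
  conclude : (∃[ c ] A ≡ Det (λ r s → c (UnitGroup._·_ units₂₇ r (UnitGroup.inv units₂₇ s)))) → Admissible A
  conclude (c , A≡) = subst Admissible (sym (trans A≡ (circulant-Det c))) (circulant-admissible c)

step : Base → ℤ
step b = + 26 * content b

-- The four kinds of base correspond to gcd(A, 26) = 1, 2, 13, 26. Admissible A then form 12 classes
-- modulo 26, 12 modulo 52 (the multiples of 4 prime to 13), one modulo 338 and one modulo 676.
Covered : ℤ → Set
Covered A = ∃[ b ] step b ∣ₛ A - determinant b

admissible? : ∀ A → Dec (Admissible A)
admissible? A = ((+ 2 ∣? A) →-dec (+ 4 ∣? A)) ×-dec ((+ 13 ∣? A) →-dec (+ 169 ∣? A))

covered? : ∀ A → Dec (Covered A)
covered? A = any-base? (λ b → step b ∣ₛ A - determinant b) λ b → step b ∣? (A - determinant b)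

opaque
  step∣676 : ∀ b → step b ∣ₛ + 676
  step∣676 = from-yes (all-bases? _ λ b → step b ∣? + 676)

  quotient-δ : ∀ r s → δ (r · inv s) zero ≡ δ r s
  quotient-δ = from-yes (all? λ r → all? λ s → δ (r · inv s) zero ℤ.≟ δ r s)

  covering-residue : ∀ (ρ : Fin 676) → Admissible (+ toℕ ρ) → Covered (+ toℕ ρ)
  covering-residue = from-yes (all? {n = 676} {P = λ ρ → Admissible (+ toℕ ρ) → Covered (+ toℕ ρ)} λ ρ → admissible? (+ toℕ ρ) →-dec covered? (+ toℕ ρ))

-- Both properties depend only on A modulo 676, a common multiple of 4, 169 and all steps, which
-- leaves finitely many residues to check.
covering : ∀ A → Admissible A → Covered A
covering A (2⇒4 , 13⇒169) =
  let b , step∣ = covering-residue ρ (reduce (divides (+ 338) refl) (divides (+ 169) refl) 2⇒4 , reduce (divides (+ 52) refl) (divides (+ 4) refl) 13⇒169)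
  in b , subst (step b ∣ₛ_) (arith A (+ toℕ ρ) (determinant b)) (Signed.∣m∣n⇒∣m+n (Signed.∣-trans (step∣676 b) A≡ρ) step∣)
  where
  r<676 : A ℤ.%ℕ 676 ℕ.< 676
  r<676 = ℤ.n%ℕd<d A 676
  ρ : Fin 676
  ρ = fromℕ< r<676
  arith : ∀ a r d → (a - r) + (r - d) ≡ a - d
  arith = solve-∀
  A≡ρ : + 676 ∣ₛ A - + toℕ ρ
  A≡ρ = divides (A ℤ./ℕ 676) (trans (cong (λ z → A - + z) (Fin.toℕ-fromℕ< r<676))
    (trans (cong (_- + (A ℤ.%ℕ 676)) (ℤ.a≡a%ℕn+[a/ℕn]*n A 676)) (cancel (+ (A ℤ.%ℕ 676)) (A ℤ./ℕ 676 * + 676))))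
    where
    cancel : ∀ x y → x + y - x ≡ y
    cancel = solve-∀
  reduce : ∀ {k l} → k ∣ₛ + 676 → l ∣ₛ + 676 → (k ∣ₛ A → l ∣ₛ A) → k ∣ₛ + toℕ ρ → l ∣ₛ + toℕ ρ
  reduce {k} {l} k∣676 l∣676 imp k∣ρ = ∣-transfer (Signed.∣-trans l∣676 A≡ρ) (imp (subst (k ∣ₛ_) (restore A (+ toℕ ρ)) (Signed.∣m∣n⇒∣m+n (Signed.∣-trans k∣676 A≡ρ) k∣ρ)))
    where
    restore : ∀ a r → (a - r) + r ≡ a
    restore = solve-∀

base-realised : ∀ b k t → GA₂₇.Realisable (determinant b + + 26 * (k * content b)) (determinant b + (+ 27 * t - k * content b))
base-realised b = GA₂₇.realised (coefficient b) (adjugate b) (weight b) (determinant b) (content b) zero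
  (determinant≢0 b) (Det-coefficient b) quotient-δ
  (λ h → trans (sym (sum≡∑ λ k → adjugate b (h · inv k) * coefficient b k)) (adjugate-coefficient b h))
  (λ h → trans (sym (sum≡∑ λ k → adjugate b (h · inv k))) (adjugate-content b h))
  (trans (sym (sum≡∑ (adjugate b))) (adjugate-sum b))
  (trans (sym (sum≡∑ λ h → adjugate b h * weight b h)) (adjugate-weight b))

realise : ∀ A B → Admissible A → + 27 ∣ₛ B - A → GA₂₇.Realisable A B
realise A B admissible (divides w B-A≡27w) =
  let b , divides k A-d≡k = covering A admissible
      -- From A = d + 26 σ k and B = d - σ k + 27 t follows B - A = 27 (t - σ k), hence t = σ k + w.
      α , linear≡ , principal≡ = base-realised b k (content b * k + w)
  in α , trans linear≡ (linear A (determinant b) (content b) k A-d≡k) ,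
         trans principal≡ (principal A B (determinant b) (content b) k w A-d≡k B-A≡27w)
  where
  restore : ∀ x y → y + (x - y) ≡ x
  restore = solve-∀
  linear : ∀ A d σ k → A - d ≡ k * (+ 26 * σ) → d + + 26 * (k * σ) ≡ A
  linear A d σ k eq = trans (trans (arith d σ k) (cong (_+_ d) (sym eq))) (restore A d)
    where
    arith : ∀ d σ k → d + + 26 * (k * σ) ≡ d + k * (+ 26 * σ)
    arith = solve-∀
  principal : ∀ A B d σ k w → A - d ≡ k * (+ 26 * σ) → B - A ≡ w * + 27 → d + (+ 27 * (σ * k + w) - k * σ) ≡ B
  principal A B d σ k w eq eq′ = trans (arith d σ k w) (trans (cong₂ (λ x y → d + x + y) (sym eq) (sym eq′))
    (trans (cong (_+ (B - A)) (restore A d)) (restore B A)))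
    where
    arith : ∀ d σ k w → d + (+ 27 * (σ * k + w) - k * σ) ≡ d + k * (+ 26 * σ) + w * + 27
    arith = solve-∀

unsigned : ∀ {A} → Admissible A → (+ 2 ∣ A → + 4 ∣ A) × (+ 13 ∣ A → (+ 13) ^ 2 ∣ A)
unsigned (2⇒4 , 13⇒169) = (λ 2∣A → ∣⇒∣ᵤ (2⇒4 (∣ᵤ⇒∣ 2∣A))) , (λ 13∣A → ∣⇒∣ᵤ (13⇒169 (∣ᵤ⇒∣ 13∣A)))

realisable⇔ : ∀ {A B} → GA₂₇.Realisable A B ⇔
  (+ 27 ∣ B - A × (+ 2 ∣ A → + 4 ∣ A) × (+ 13 ∣ A → (+ 13) ^ 2 ∣ A))
realisable⇔ {A} {B} = mk⇔ necessary sufficient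
  where
  necessary : GA₂₇.Realisable A B →
    + 27 ∣ B - A × (+ 2 ∣ A → + 4 ∣ A) × (+ 13 ∣ A → (+ 13) ^ 2 ∣ A)
  necessary realisable = GA₂₇.realisable-≡ realisable , unsigned (realisable-admissible realisable)
  sufficient : + 27 ∣ B - A × (+ 2 ∣ A → + 4 ∣ A) × (+ 13 ∣ A → (+ 13) ^ 2 ∣ A) →
    GA₂₇.Realisable A B
  sufficient (27∣B-A , 2⇒4 , 13⇒169) =
    realise A B ((λ 2∣A → ∣ᵤ⇒∣ (2⇒4 (∣⇒∣ᵤ 2∣A))) , (λ 13∣A → ∣ᵤ⇒∣ (13⇒169 (∣⇒∣ᵤ 13∣A)))) (∣ᵤ⇒∣ 27∣B-A)

presentations⇔ : ∀ D → (∃₂ λ A B → D ≡ A * B ^ 26 × GA₂₇.Realisable A B) ⇔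
    (∃₂ λ (A B : ℤ) →
    D ≡ A * B ^ 26 ×
    + 27 ∣ B - A ×
    (+ 2 ∣ A → + 4 ∣ A) ×
    (+ 13 ∣ A → (+ 13) ^ 2 ∣ A))
presentations⇔ D = mk⇔ (λ (A , B , D≡ , r) → A , B , D≡ , Equivalence.to realisable⇔ r)
                (λ (A , B , D≡ , c) → A , B , D≡ , Equivalence.from realisable⇔ c)

theorem6 : (D : ℤ) → IsIntegerGroupDeterminant GA[1,27] D ⇔
    (∃₂ λ (A B : ℤ) →
    D ≡ A * B ^ 26 ×
    + 27 ∣ B - A ×
    (+ 2 ∣ A → + 4 ∣ A) ×
    (+ 13 ∣ A → (+ 13) ^ 2 ∣ A))
theorem6 D = ⇔-trans (GA₂₇.determinants₂₇ GA[1,27] refl D) (presentations⇔ D)
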